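{- Let $\mathbb{S}$ be any surface (orientable or non-orientable) and let $n\geq 1$ be an integer. There exists a 2-to-1 correspondence between the set of pairs $(\mathfrak{q},v_0)$, where $\mathfrak{q}$ is a rooted bipartite quadrangulation on $\mathbb{S}$ with $n$ faces and $v_0$ is a vertex of $\mathfrak{q}$, and the set of labeled unicellular maps on $\mathbb{S}$ with $n$ edges, with the following property. For such a pair $(\mathfrak{q},v_0)$, let $N_i$ be the set of vertices of $\mathfrak{q}$ at graph distance $i$ from $v_0$ and $E(N_i,N_{i-1})$ the set of edges of $\mathfrak{q}$ joining a vertex of $N_i$ to a vertex of $N_{i-1}$. Then, for every $i\geq 1$, the associated labeled unicellular map has exactly $|N_i|$ vertices of label $i+\ell_{\min}-1$ and exactly $|E(N_i,N_{i-1})|$ corners of label $i+\ell_{\min}-1$, where $\ell_{\min}$ is the minimum vertex label of the unicellular map.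
   Context: A surface is a compact connected 2-dimensional manifold, considered up to homeomorphism. A map is an embedding of a finite connected graph (loops and multiple edges allowed) into a surface such that each face is simply connected; maps are considered up to homeomorphism. A unicellular map is a map with exactly one face. A corner is an angular sector between two consecutive half-edges around a vertex. A map is rooted if it carries a distinguished half-edge together with a distinguished side of it (equivalently, a distinguished oriented corner); the vertex incident to the root is the root vertex. A quadrangulation is a map all of whose faces have degree 4 (4 corners); it is bipartite if its vertices can be 2-colored so that adjacent vertices get different colors. A labeled unicellular map is a rooted unicellular map whose vertices carry integer labels such that the root vertex has label 1 and the labels of any two adjacent vertices differ by at most 1. The label of a corner is the label of its vertex. A 2-to-1 correspondence means a surjection from the first set onto the second in which every element of the second set has exactly two preimages. -}

module Defs where

open import Data.Nat using (ℕ; zero; suc; _<_) renaming (_≤_ to _≤ℕ_)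
open import Data.Integer using (ℤ; +_; _-_; _+_; ∣_∣) renaming (_≤_ to _≤ℤ_)
open import Data.Fin using (Fin)
open import Data.Bool using (Bool)
open import Data.Unit using (⊤)
open import Data.Product using (Σ; _×_)
open import Data.Sum using (_⊎_)
open import Relation.Binary.PropositionalEquality using (_≡_)
open import Relation.Nullary using (¬_)

-- Combinatorial maps (flag / "gem" encoding), valid for orientable and
-- non-orientable closed surfaces.  Flags = (vertex, edge, face) incidences,
-- i.e. half-edges with a distinguished side.
--   τ₀ : change the vertex (same edge, same face)
--   τ₁ : change the edge   (same vertex, same face)
--   τ₂ : change the face   (same vertex, same edge)

data Closure {k : ℕ} (R : Fin k → Fin k → Set) : Fin k → Fin k → Set where
  here : ∀ {x} → Closure R x x
  step : ∀ {x y z} → R x y → Closure R y z → Closure R x z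

HasClassCount : {k : ℕ} → (Fin k → Fin k → Set) → (Fin k → Set) → ℕ → Set
HasClassCount {k} R P m =
  Σ (Fin m → Fin k) λ e →
    (∀ i → P (e i)) ×
    (∀ i j → R (e i) (e j) → i ≡ j) ×
    (∀ x → P x → Σ (Fin m) λ i → R x (e i))

record Map : Set where
  field
    size : ℕ
    τ₀ τ₁ τ₂ : Fin size → Fin size
    τ₀-inv : ∀ x → τ₀ (τ₀ x) ≡ x
    τ₁-inv : ∀ x → τ₁ (τ₁ x) ≡ x
    τ₂-inv : ∀ x → τ₂ (τ₂ x) ≡ x
    τ₀-fpf : ∀ x → ¬ (τ₀ x ≡ x)
    τ₁-fpf : ∀ x → ¬ (τ₁ x ≡ x)
    τ₂-fpf : ∀ x → ¬ (τ₂ x ≡ x)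
    τ₀τ₂-comm : ∀ x → τ₀ (τ₂ x) ≡ τ₂ (τ₀ x)
    τ₀τ₂-fpf : ∀ x → ¬ (τ₀ (τ₂ x) ≡ x)
    connected : ∀ x y → Closure (λ a b → (b ≡ τ₀ a ⊎ b ≡ τ₁ a) ⊎ b ≡ τ₂ a) x y

  AnyStep VStep EStep FStep CStep : Fin size → Fin size → Set
  AnyStep x y = (y ≡ τ₀ x ⊎ y ≡ τ₁ x) ⊎ y ≡ τ₂ x
  VStep x y = y ≡ τ₁ x ⊎ y ≡ τ₂ x
  EStep x y = y ≡ τ₀ x ⊎ y ≡ τ₂ x
  FStep x y = y ≡ τ₀ x ⊎ y ≡ τ₁ x
  CStep x y = y ≡ τ₁ x

  SameV SameE SameF SameC : Fin size → Fin size → Set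
  SameV = Closure VStep
  SameE = Closure EStep
  SameF = Closure FStep
  SameC = Closure CStep

  #V #E #F : ℕ → Set
  #V = HasClassCount SameV (λ _ → ⊤)
  #E = HasClassCount SameE (λ _ → ⊤)
  #F = HasClassCount SameF (λ _ → ⊤)

  Orientable : Set
  Orientable = Σ (Fin size → Bool) λ c →
    (∀ x → ¬ (c (τ₀ x) ≡ c x)) × (∀ x → ¬ (c (τ₁ x) ≡ c x)) × (∀ x → ¬ (c (τ₂ x) ≡ c x))

  EulerChar : ℤ → Set
  EulerChar χ = Σ ℕ λ v → Σ ℕ λ e → Σ ℕ λ f →
    #V v × #E e × #F f × χ ≡ (+ v - + e) + + f

  FaceDegree : Fin size → ℕ → Set
  FaceDegree x = HasClassCount SameC (λ y → SameF x y)

  IsQuadrangulation : Set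
  IsQuadrangulation = ∀ x → FaceDegree x 4

  IsBipartite : Set
  IsBipartite = Σ (Fin size → Bool) λ c →
    (∀ x → c (τ₁ x) ≡ c x) × (∀ x → c (τ₂ x) ≡ c x) × (∀ x → ¬ (c (τ₀ x) ≡ c x))

  IsUnicellular : Set
  IsUnicellular = #F 1

  -- walks in the underlying graph: moving around a vertex is free,
  -- traversing an edge costs 1
  data Walk : ℕ → Fin size → Fin size → Set where
    stay : ∀ {x} → Walk 0 x x
    turn : ∀ {n x y z} → VStep x y → Walk n y z → Walk n x z
    go   : ∀ {n x z} → Walk n (τ₀ x) z → Walk (suc n) x z

  Dist : Fin size → Fin size → ℕ → Set
  Dist x y i = Walk i x y × (∀ j → j < i → ¬ Walk j x y)

data Surface : Set where
  orientable    : (g : ℕ) → Surface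
  nonorientable : (h : ℕ) → Surface   -- non-orientable, genus h+1 (χ = 2 - (h+1))

OnSurface : Map → Surface → Set
OnSurface M (orientable g) =
  Map.Orientable M × Map.EulerChar M (+ 2 - (+ g + + g))
OnSurface M (nonorientable h) =
  ¬ Map.Orientable M × Map.EulerChar M (+ 2 - + suc h)

record RootedMap : Set where
  field
    map  : Map
    root : Fin (Map.size map)
  open Map map public

record RIso (M M' : RootedMap) : Set where
  private
    module A = RootedMap M
    module B = RootedMap M'
  field
    to      : Fin A.size → Fin B.size
    from    : Fin B.size → Fin A.size
    from-to : ∀ x → from (to x) ≡ x
    to-from : ∀ y → to (from y) ≡ y
    comm₀   : ∀ x → to (A.τ₀ x) ≡ B.τ₀ (to x)
    comm₁   : ∀ x → to (A.τ₁ x) ≡ B.τ₁ (to x)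
    comm₂   : ∀ x → to (A.τ₂ x) ≡ B.τ₂ (to x)
    root-pres : to A.root ≡ B.root

-- pairs (q, v₀): q rooted bipartite quadrangulation on S with n faces,
-- v₀ a vertex of q (given by any flag incident to it)
record QPair (S : Surface) (n : ℕ) : Set where
  field
    q     : RootedMap
    quad  : Map.IsQuadrangulation (RootedMap.map q)
    bip   : Map.IsBipartite (RootedMap.map q)
    onS   : OnSurface (RootedMap.map q) S
    faces : Map.#F (RootedMap.map q) n
    v₀    : Fin (RootedMap.size q)

_≅Q_ : ∀ {S n} → QPair S n → QPair S n → Set
p ≅Q p' = Σ (RIso (QPair.q p) (QPair.q p')) λ φ →
  RootedMap.SameV (QPair.q p') (RIso.to φ (QPair.v₀ p)) (QPair.v₀ p')

record LUMap (S : Surface) (n : ℕ) : Set where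
  field
    m      : RootedMap
    label  : Fin (RootedMap.size m) → ℤ
    label-v₁ : ∀ x → label (RootedMap.τ₁ m x) ≡ label x   -- labels live on vertices
    label-v₂ : ∀ x → label (RootedMap.τ₂ m x) ≡ label x
    label-root : label (RootedMap.root m) ≡ + 1
    label-adj  : ∀ x → ∣ label x - label (RootedMap.τ₀ m x) ∣ ≤ℕ 1
    unicell : Map.IsUnicellular (RootedMap.map m)
    onS    : OnSurface (RootedMap.map m) S
    edges  : Map.#E (RootedMap.map m) n

_≅L_ : ∀ {S n} → LUMap S n → LUMap S n → Set
L ≅L L' = Σ (RIso (LUMap.m L) (LUMap.m L')) λ φ →
  ∀ x → LUMap.label L' (RIso.to φ x) ≡ LUMap.label L x

IsMinLabel : ∀ {S n} → LUMap S n → ℤ → Set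
IsMinLabel L ℓ = Σ (Fin (RootedMap.size (LUMap.m L))) (λ x → LUMap.label L x ≡ ℓ)
  × (∀ x → ℓ ≤ℤ LUMap.label L x)

TwoToOne : ∀ {S n} → (QPair S n → LUMap S n) → Set
TwoToOne {S} {n} Φ =
  (∀ p p' → p ≅Q p' → Φ p ≅L Φ p') ×
  (∀ (L : LUMap S n) → Σ (QPair S n) λ p₁ → Σ (QPair S n) λ p₂ →
     Φ p₁ ≅L L × Φ p₂ ≅L L × ¬ (p₁ ≅Q p₂) ×
     (∀ p → Φ p ≅L L → p ≅Q p₁ ⊎ p ≅Q p₂))

-- the distance/label property, for i = suc j ≥ 1 (so label i + ℓmin - 1 = ℓmin + j)
LayerProperty : ∀ {S n} → (QPair S n → LUMap S n) → Set
LayerProperty {S} {n} Φ = ∀ (p : QPair S n) (j : ℕ) (ℓmin : ℤ) → IsMinLabel (Φ p) ℓmin →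
  let q = QPair.q p
      v₀ = QPair.v₀ p
      L = Φ p
      m = LUMap.m L
  in
  (Σ ℕ λ a →
     HasClassCount (RootedMap.SameV q) (λ x → RootedMap.Dist q v₀ x (suc j)) a ×
     HasClassCount (RootedMap.SameV m) (λ y → LUMap.label L y ≡ ℓmin + + j) a)
  ×
  (Σ ℕ λ b →
     HasClassCount (RootedMap.SameE q)
       (λ x → RootedMap.Dist q v₀ x (suc j) × RootedMap.Dist q v₀ (RootedMap.τ₀ q x) j) b ×
     HasClassCount (RootedMap.SameC m) (λ y → LUMap.label L y ≡ ℓmin + + j) b)

-- Cut both objects into pieces.  A unicellular map with labels is a set of edges, each with four
-- labelled flags, glued along a perfect matching τ₁ of the flags of each level; a pointed
-- quadrangulation is a set of squares, each with four sides lying between consecutive distance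
-- layers, glued along a perfect matching τ₁ of the sides of each level.  A square with distances
-- (i-1, i, i+1, i) has the same local structure as an edge labelled (i, i+1), and a square
-- (i-1, i, i-1, i) the same as an edge labelled (i, i).  On the flags of level i that lead up to
-- level i+1 there are two perfect matchings: τ₂ (crossing the edge), and P (the first return of the
-- face contour from above level i).  Having one face, and counting vertices, uses P and τ₂ on the
-- map side and τ₂ and P on the quadrangulation side.  Hence conjugating τ₁, level by level, with an
-- involution π that exchanges P and τ₂ is a bijection between the two kinds of gluings; reflecting
-- the alternating cycles of P and τ₂ gives a π that preserves all orientations.
--
-- π depends on the numbering of the flags, so this is a bijection of numbered objects only.  Rooted
-- objects have no automorphisms, so each isomorphism class is a free orbit of the permutations of
-- the flags, and the numbers of classes with given invariants agree.  A root of the quadrangulation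
-- is a root flag of the map together with one end of a side, which gives the factor two.

module Submission where

open import Defs
open import Data.Nat as ℕ using (ℕ; zero; suc; _+_; _*_; _∸_; _≤_; _<_; z≤n; s≤s)
import Data.Nat.Properties as ℕₚ
open import Data.Nat.DivMod using (_%_; _/_; m≡m%n+[m/n]*n; m%n<n)
open import Data.Integer as ℤ using (ℤ; +_)
import Data.Integer.Properties as ℤₚ
open import Data.Integer.Tactic.RingSolver using (solve-∀)
open import Data.Fin using (Fin; zero; suc; toℕ; fromℕ<; combine; remQuot)
import Data.Fin.Properties as Finₚ
open import Data.Bool using (Bool; true; false; not; _xor_)
import Data.Bool.Properties as Boolₚ
open import Data.Unit using (⊤; tt)
open import Data.Product using (Σ; _×_; _,_; proj₁; proj₂; ∃; uncurry)
import Data.Product.Properties as Productₚ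
open import Data.Sum using (_⊎_; inj₁; inj₂)
open import Data.Vec as Vec using (Vec; []; _∷_; lookup; tabulate)
import Data.Vec.Properties as Vecₚ
open import Data.List as List using (List; []; _∷_)
open import Data.List.Membership.Propositional using (_∈_; find; lose)
open import Data.List.Membership.Propositional.Properties using (∈-cartesianProductWith⁺; ∈-allFin)
open import Data.List.Relation.Unary.Any as Any using (here; there)
open import Relation.Binary.Definitions using (tri<; tri≈; tri>)
open import Relation.Binary.Structures using (IsEquivalence)
open import Relation.Binary.PropositionalEquality
open import Relation.Binary.Construct.Closure.ReflexiveTransitive as Star using (Star; ε; _◅_; _◅◅_)
open import Relation.Nullary using (¬_; Dec; yes; no; contradiction; contradiction-irr)
open import Relation.Nullary.Decidable using (map′; _×-dec_; _⊎-dec_; ¬?)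
open import Function using (_∘_; id)

-- Finite connectivity and counting of classes

-- Two facts carry the bijection of numbered objects. Having one face and being a distance function
-- are the same condition `Desc` on the components inside a level, read with P on the one side and
-- with τ₂ on the other. And the matching formed from the new gluing by the rule of the other side
-- agrees with P on the flags leading up; so the way back uses the same π, which is an involution.
-- Vertices of the map become all vertices except v₀: t vertices, n edges and one face stand against
-- t + 1 vertices, 2n edges and n faces, with the same Euler characteristic.
--
-- Since π depends on the numbering, `F` and `G` need not respect isomorphism. Whatever is asserted
-- must therefore be an invariant: the surface, the vertex count and, for each level, the counts of
-- vertices and corners are fixed, and classes that share them are paired arbitrarily.
--
-- Comparing structures for equality calls for finite tables in place of functions, for levels that
-- begin at 1 (which bounds them by the number of flags), and for a choice of π that depends on the
-- tables and not on the proofs of their laws.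

Closure⇒Star : ∀ {k} {R : Fin k → Fin k → Set} {x y} → Closure R x y → Star R x y
Closure⇒Star here       = ε
Closure⇒Star (step r c) = r ◅ Closure⇒Star c

Star⇒Closure : ∀ {k} {R : Fin k → Fin k → Set} {x y} → Star R x y → Closure R x y
Star⇒Closure ε       = here
Star⇒Closure (r ◅ c) = step r (Star⇒Closure c)

-- Reachability by paths all of whose inner vertices have index < b (Warshall).
module Warshall {k : ℕ} (R : Fin k → Fin k → Set) (R? : ∀ x y → Dec (R x y)) where

  Via : ∀ b → b ≤ k → Fin k → Fin k → Set
  Via zero    _   x y = x ≡ y ⊎ R x y
  Via (suc b) b<k x y = Via b b≤k x y ⊎ (Via b b≤k x v × Via b b≤k v y)
    where
      b≤k = ℕₚ.<⇒≤ b<k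
      v   = fromℕ< b<k

  via? : ∀ b p x y → Dec (Via b p x y)
  via? zero    _ x y = (x Finₚ.≟ y) ⊎-dec R? x y
  via? (suc b) p x y = via? b _ x y ⊎-dec (via? b _ x _ ×-dec via? b _ _ y)

  via⇒star : ∀ b p {x y} → Via b p x y → Star R x y
  via⇒star zero    _ (inj₁ refl)    = ε
  via⇒star zero    _ (inj₂ r)       = r ◅ ε
  via⇒star (suc b) p (inj₁ w)       = via⇒star b _ w
  via⇒star (suc b) p (inj₂ (w , v)) = via⇒star b _ w ◅◅ via⇒star b _ v

  via-refl : ∀ b p {x} → Via b p x x
  via-refl zero    _ = inj₁ refl
  via-refl (suc b) p = inj₁ (via-refl b _)

  via-step : ∀ b p {x y} → R x y → Via b p x y
  via-step zero    _ r = inj₂ r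
  via-step (suc b) p r = inj₁ (via-step b _ r)

  via-trans : ∀ b p {x z y} → toℕ z < b → Via b p x z → Via b p z y → Via b p x y
  via-trans (suc b) p {x} {z} {y} z<b v w with toℕ z ℕ.≟ b
  ... | yes refl = inj₂ (subst (Via b q x) z≡ (to v) , subst (λ u → Via b q u y) z≡ (from w))
    where
      q = ℕₚ.<⇒≤ p
      z≡ : z ≡ fromℕ< p
      z≡ = sym (Finₚ.fromℕ<-toℕ z p)
      to : Via (suc b) p x z → Via b q x z
      to (inj₁ a)       = a
      to (inj₂ (a , _)) = subst (Via b q x) (sym z≡) a
      from : Via (suc b) p z y → Via b q z y
      from (inj₁ a)       = a
      from (inj₂ (_ , a)) = subst (λ u → Via b q u y) (sym z≡) a
  ... | no z≢b = go v w
    where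
      z<b′ : toℕ z < b
      z<b′ = ℕₚ.≤∧≢⇒< (ℕₚ.≤-pred z<b) z≢b
      go : Via (suc b) p x z → Via (suc b) p z y → Via (suc b) p x y
      go (inj₁ a)       (inj₁ c)       = inj₁ (via-trans b _ z<b′ a c)
      go (inj₁ a)       (inj₂ (c , d)) = inj₂ (via-trans b _ z<b′ a c , d)
      go (inj₂ (a , e)) (inj₁ c)       = inj₂ (a , via-trans b _ z<b′ e c)
      go (inj₂ (a , e)) (inj₂ (c , d)) = inj₂ (a , d)

  star⇒via : ∀ {x y} → Star R x y → Via k ℕₚ.≤-refl x y
  star⇒via ε        = via-refl k _
  star⇒via (r ◅ rs) = via-trans k _ (Finₚ.toℕ<n _) (via-step k _ r) (star⇒via rs)

  opaque
    star? : ∀ x y → Dec (Star R x y)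
    star? x y = map′ (via⇒star k _) star⇒via (via? k ℕₚ.≤-refl x y)

-- `Q` is the part of `A` that has been searched: membership in a list while representatives are
-- collected, and in the end everything.
Transversal : {A : Set} (_~_ : A → A → Set) (P : A → Set) (Q : A → Set) → ℕ → Set
Transversal {A} _~_ P Q c =
  Σ (Fin c → A) λ rep →
    (∀ i → P (rep i)) ×
    (∀ i j → rep i ~ rep j → i ≡ j) ×
    (∀ x → Q x → P x → Σ (Fin c) λ i → x ~ rep i)

opaque
  transversal : {A : Set} {_~_ : A → A → Set} → IsEquivalence _~_ → (∀ x y → Dec (x ~ y)) →
    {P : A → Set} → (∀ x → Dec (P x)) → (xs : List A) → ∃ (Transversal _~_ P (_∈ xs))
  transversal eq _~?_ P? [] = 0 , (λ ()) , (λ ()) , (λ ()) , λ x ()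
  transversal {A} {_~_} eq _~?_ {P} P? (a ∷ xs) with transversal eq _~?_ P? xs
  ... | c , rep , good , inj , sur with P? a
  ...   | no ¬pa = c , rep , good , inj , sur′
    where
      sur′ : ∀ x → x ∈ a ∷ xs → P x → Σ (Fin c) λ i → x ~ rep i
      sur′ x (here refl) px = contradiction px ¬pa
      sur′ x (there m)   px = sur x m px
  ...   | yes pa with Finₚ.any? (λ i → a ~? rep i)
  ...     | yes old = c , rep , good , inj , sur′
    where
      sur′ : ∀ x → x ∈ a ∷ xs → P x → Σ (Fin c) λ i → x ~ rep i
      sur′ x (here refl) px = old
      sur′ x (there m)   px = sur x m px
  ...     | no new = suc c , rep′ , good′ , inj′ , sur′
    where
      open IsEquivalence eq using () renaming (refl to ~refl; sym to ~sym; trans to ~trans)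
      rep′ : Fin (suc c) → A
      rep′ zero    = a
      rep′ (suc i) = rep i
      good′ : ∀ i → P (rep′ i)
      good′ zero    = pa
      good′ (suc i) = good i
      inj′ : ∀ i j → rep′ i ~ rep′ j → i ≡ j
      inj′ zero    zero    r = refl
      inj′ zero    (suc j) r = contradiction (j , r) new
      inj′ (suc i) zero    r = contradiction (i , ~sym r) new
      inj′ (suc i) (suc j) r = cong suc (inj i j r)
      sur′ : ∀ x → x ∈ a ∷ xs → P x → Σ (Fin (suc c)) λ i → x ~ rep′ i
      sur′ x (here refl) px = zero , ~refl
      sur′ x (there m)   px with sur x m px
      ... | i , r = suc i , r

opaque
  classCount : ∀ {k} {R : Fin k → Fin k → Set} → IsEquivalence R → (∀ x y → Dec (R x y)) →
    {P : Fin k → Set} → (∀ x → Dec (P x)) → ∃ (HasClassCount R P)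
  classCount {k} eq R? P? with transversal eq R? P? (List.allFin k)
  ... | c , rep , good , inj , sur = c , rep , good , inj , λ x → sur x (∈-allFin x)

empty-count : ∀ {k} {R : Fin k → Fin k → Set} {P : Fin k → Set} → (∀ x → ¬ P x) → HasClassCount R P 0
empty-count ¬p = (λ ()) , (λ ()) , (λ ()) , λ x px → contradiction px (¬p x)

injection⇒≤ : ∀ {a b} (f : Fin a → Fin b) → (∀ i j → f i ≡ f j → i ≡ j) → a ≤ b
injection⇒≤ f inj = Finₚ.injective⇒≤ {f = f} (inj _ _)

classCount-≤ : ∀ {k} {R : Fin k → Fin k → Set} → IsEquivalence R → {P : Fin k → Set} →
  ∀ {m m′} → HasClassCount R P m → HasClassCount R P m′ → m ≤ m′
classCount-≤ {R = R} eq (e , good , inj , _) (e′ , _ , _ , sur′) =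
  injection⇒≤ (λ i → proj₁ (sur′ (e i) (good i))) λ i j h →
    inj i j (~trans (proj₂ (sur′ (e i) (good i)))
      (~sym (subst (λ u → R (e j) (e′ u)) (sym h) (proj₂ (sur′ (e j) (good j))))))
  where open IsEquivalence eq using () renaming (refl to ~refl; sym to ~sym; trans to ~trans)

classCount-unique : ∀ {k} {R : Fin k → Fin k → Set} → IsEquivalence R → {P : Fin k → Set} →
  ∀ {m m′} → HasClassCount R P m → HasClassCount R P m′ → m ≡ m′
classCount-unique eq h h′ = ℕₚ.≤-antisym (classCount-≤ eq h h′) (classCount-≤ eq h′ h)

-- `f` need not be onto; every class with `P′` only has to meet its image. Flags can thus be counted
-- through a smaller set, such as the upper ends of sides.
transportCount : ∀ {k k′} {R : Fin k → Fin k → Set} {R′ : Fin k′ → Fin k′ → Set} → IsEquivalence R′ →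
  {P : Fin k → Set} {P′ : Fin k′ → Set} (f : Fin k → Fin k′) →
  (∀ {x y} → R x y → R′ (f x) (f y)) → (∀ {x y} → R′ (f x) (f y) → R x y) →
  (∀ {x} → P x → P′ (f x)) → (∀ y → P′ y → ∃ λ x → P x × R′ y (f x)) →
  ∀ {m} → HasClassCount R P m → HasClassCount R′ P′ m
transportCount eq f to from pres hit (e , good , inj , sur) =
  f ∘ e , pres ∘ good , (λ i j r → inj i j (from r)) , λ y py →
    let x , px , r = hit y py ; i , r′ = sur x px in i , IsEquivalence.trans eq r (to r′)

star-isEquiv : {A : Set} {R : A → A → Set} → (∀ {x y} → R x y → R y x) → IsEquivalence (Star R)
star-isEquiv s = record { refl = ε ; sym = Star.reverse s ; trans = _◅◅_ }

closure-isEquiv : ∀ {k} {R : Fin k → Fin k → Set} → (∀ {x y} → R x y → R y x) → IsEquivalence (Closure R)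
closure-isEquiv s = record
  { refl  = here
  ; sym   = Star⇒Closure ∘ Star.reverse s ∘ Closure⇒Star
  ; trans = λ a b → Star⇒Closure (Closure⇒Star a ◅◅ Closure⇒Star b)
  }

-- Orbit counting and bijections of isomorphism classes

-- If a finite group acts freely on two sets whose elements are matched by a bijection, the
-- orbits are equinumerous, whether or not the bijection is equivariant.
module Orbits {X : Set} {_~_ : X → X → Set} (~-equiv : IsEquivalence _~_) {g : ℕ} (act : Fin g → X → X)
  (act-~ : ∀ σ x → x ~ act σ x) (~-act : ∀ {x y} → x ~ y → ∃ λ σ → act σ x ≡ y) where

  open IsEquivalence ~-equiv using () renaming (refl to ~refl; sym to ~sym; trans to ~trans)

  Free : (X → Set) → Set
  Free P = ∀ x → P x → ∀ σ σ′ → act σ x ≡ act σ′ x → σ ≡ σ′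

  module _ {A B : X → Set} (A-resp : ∀ {x y} → x ~ y → A x → A y) (A-free : Free A)
    (F G : X → X) (F-pres : ∀ {x} → A x → B (F x)) (GF : ∀ {x} → A x → G (F x) ≡ x) {a b : ℕ}
    where

    -- By freeness the points `act σ (rep i)` number `a * g`. `F` is injective on them, and each
    -- value is recovered from its class in `B` together with one group element that carries the
    -- representative of that class to it.
    orbits-* : Transversal _~_ A (λ _ → ⊤) a → Transversal _~_ B (λ _ → ⊤) b → a * g ≤ b * g
    orbits-* (rep , good , inj , _) (rep′ , _ , _ , sur′) = injection⇒≤ (code ∘ remQuot g) λ i j h →
        trans (sym (Finₚ.combine-remQuot {a} g i))
          (trans (cong (uncurry combine) (code-inj (remQuot g i) (remQuot g j) h)) (Finₚ.combine-remQuot {a} g j))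
      where
      pt : Fin a × Fin g → X
      pt (i , σ) = act σ (rep i)
      pt-good : ∀ z → A (pt z)
      pt-good (i , σ) = A-resp (act-~ σ (rep i)) (good i)
      cls : ∀ z → Σ (Fin b) λ i → F (pt z) ~ rep′ i
      cls z = sur′ (F (pt z)) tt (F-pres (pt-good z))
      elt : ∀ z → ∃ λ σ → act σ (rep′ (proj₁ (cls z))) ≡ F (pt z)
      elt z = ~-act (~sym (proj₂ (cls z)))
      code : Fin a × Fin g → Fin (b * g)
      code z = combine (proj₁ (cls z)) (proj₁ (elt z))
      F-eq : ∀ z z′ → code z ≡ code z′ → F (pt z) ≡ F (pt z′)
      F-eq z z′ h with Finₚ.combine-injective (proj₁ (cls z)) (proj₁ (elt z)) (proj₁ (cls z′)) (proj₁ (elt z′)) h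
      ... | h₁ , h₂ = trans (sym (proj₂ (elt z)))
                        (trans (cong₂ (λ σ i → act σ (rep′ i)) h₂ h₁) (proj₂ (elt z′)))
      pt-eq : ∀ z z′ → code z ≡ code z′ → pt z ≡ pt z′
      pt-eq z z′ h = trans (sym (GF (pt-good z))) (trans (cong G (F-eq z z′ h)) (GF (pt-good z′)))
      code-inj : ∀ z z′ → code z ≡ code z′ → z ≡ z′
      code-inj (i , σ) (j , σ′) h = finish (inj i j i~j)
        where
        e = pt-eq (i , σ) (j , σ′) h
        i~j : rep i ~ rep j
        i~j = ~trans (act-~ σ (rep i)) (subst (_~ rep j) (sym e) (~sym (act-~ σ′ (rep j))))
        finish : i ≡ j → (i , σ) ≡ (j , σ′)
        finish refl = cong (i ,_) (A-free (rep i) (good i) σ σ′ e)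

  module ClassBijection {I : Set} (_≟I_ : (x y : I) → Dec (x ≡ y)) {A B : X → Set} (invA invB : X → I)
    (A-resp : ∀ {x y} → x ~ y → A x → A y) (B-resp : ∀ {x y} → x ~ y → B x → B y)
    (A-free : Free A) (B-free : Free B)
    (invA-resp : ∀ {x y} → A x → x ~ y → invA x ≡ invA y) (invB-resp : ∀ {x y} → B x → x ~ y → invB x ≡ invB y)
    (F G : X → X)
    (F-pres : ∀ {x} → A x → B (F x)) (GF : ∀ {x} → A x → G (F x) ≡ x) (F-inv : ∀ {x} → A x → invB (F x) ≡ invA x)
    (G-pres : ∀ {x} → B x → A (G x)) (FG : ∀ {x} → B x → F (G x) ≡ x) (G-inv : ∀ {x} → B x → invA (G x) ≡ invB x)
    (A? : ∀ x → Dec (A x)) (B? : ∀ x → Dec (B x)) (_~?_ : ∀ x y → Dec (x ~ y))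
    (xs : List X) (all∈ : ∀ x → x ∈ xs) where

    A′ B′ : I → X → Set
    A′ ι x = A x × invA x ≡ ι
    B′ ι x = B x × invB x ≡ ι

    everywhere : ∀ {P : X → Set} {c} → Transversal _~_ P (_∈ xs) c → Transversal _~_ P (λ _ → ⊤) c
    everywhere (rep , good , inj , sur) = rep , good , inj , λ x _ → sur x (all∈ x)

    repsA : ∀ ι → ∃ (Transversal _~_ (A′ ι) (λ _ → ⊤))
    repsA ι = let c , t = transversal ~-equiv _~?_ (λ x → A? x ×-dec (invA x ≟I ι)) xs in c , everywhere t

    repsB : ∀ ι → ∃ (Transversal _~_ (B′ ι) (λ _ → ⊤))
    repsB ι = let c , t = transversal ~-equiv _~?_ (λ x → B? x ×-dec (invB x ≟I ι)) xs in c , everywhere t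

    A′-resp : ∀ {ι x y} → x ~ y → A′ ι x → A′ ι y
    A′-resp r (p , e) = A-resp r p , trans (sym (invA-resp p r)) e

    B′-resp : ∀ {ι x y} → x ~ y → B′ ι x → B′ ι y
    B′-resp r (p , e) = B-resp r p , trans (sym (invB-resp p r)) e

    module _ .{{_ : ℕ.NonZero g}} where

      same-count : ∀ ι → proj₁ (repsB ι) ≡ proj₁ (repsA ι)
      same-count ι = ℕₚ.*-cancelʳ-≡ _ _ g (ℕₚ.≤-antisym
        (orbits-* {B′ ι} {A′ ι} B′-resp (λ x → B-free x ∘ proj₁) G F
          (λ (p , e) → G-pres p , trans (G-inv p) e) (FG ∘ proj₁) (proj₂ (repsB ι)) (proj₂ (repsA ι)))
        (orbits-* {A′ ι} {B′ ι} A′-resp (λ x → A-free x ∘ proj₁) F G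
          (λ (p , e) → F-pres p , trans (F-inv p) e) (GF ∘ proj₁) (proj₂ (repsA ι)) (proj₂ (repsB ι))))

      index : ∀ ι x → B′ ι x → Fin (proj₁ (repsB ι))
      index ι x p = proj₁ (proj₂ (proj₂ (proj₂ (proj₂ (repsB ι)))) x tt p)

      index-~ : ∀ ι x p → x ~ proj₁ (proj₂ (repsB ι)) (index ι x p)
      index-~ ι x p = proj₂ (proj₂ (proj₂ (proj₂ (proj₂ (repsB ι)))) x tt p)

      repB-inj : ∀ ι i j → proj₁ (proj₂ (repsB ι)) i ~ proj₁ (proj₂ (repsB ι)) j → i ≡ j
      repB-inj ι = proj₁ (proj₂ (proj₂ (proj₂ (repsB ι))))

      repA : ∀ ι → Fin (proj₁ (repsA ι)) → X
      repA ι = proj₁ (proj₂ (repsA ι))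

      -- The two lists of representatives are matched by position. The value is itself a listed
      -- representative, so equivalent arguments give equal values and not merely equivalent ones.
      φ′ : ∀ ι x → B′ ι x → X
      φ′ ι x p = repA ι (subst Fin (same-count ι) (index ι x p))

      φ : ∀ x → B x → X
      φ x p = φ′ (invB x) x (p , refl)

      φ′-good : ∀ ι x p → A′ ι (φ′ ι x p)
      φ′-good ι x p = proj₁ (proj₂ (proj₂ (repsA ι))) _

      φ-good : ∀ x p → A (φ x p)
      φ-good x p = proj₁ (φ′-good (invB x) x (p , refl))

      φ-inv : ∀ x p → invA (φ x p) ≡ invB x
      φ-inv x p = proj₂ (φ′-good (invB x) x (p , refl))

      φ′-cong : ∀ ι x y p q → x ~ y → φ′ ι x p ≡ φ′ ι y q
      φ′-cong ι x y p q r = cong (repA ι ∘ subst Fin (same-count ι))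
        (repB-inj ι _ _ (~trans (~sym (index-~ ι x p)) (~trans r (index-~ ι y q))))

      φ′-inj : ∀ ι x y p q → φ′ ι x p ~ φ′ ι y q → x ~ y
      φ′-inj ι x y p q r = ~trans (index-~ ι x p)
        (subst (λ i → proj₁ (proj₂ (repsB ι)) i ~ y) (sym i≡j) (~sym (index-~ ι y q)))
        where
        i≡j : index ι x p ≡ index ι y q
        i≡j = subst-injective (same-count ι)
                (proj₁ (proj₂ (proj₂ (proj₂ (repsA ι)))) _ _ r)

      φ≡φ′ : ∀ ι x p (e : invB x ≡ ι) → φ x p ≡ φ′ ι x (p , e)
      φ≡φ′ _ x p refl = refl

      φ-cong : ∀ x y p q → x ~ y → φ x p ≡ φ y q
      φ-cong x y p q r = trans (φ≡φ′ (invB y) x p (invB-resp p r)) (φ′-cong _ x y _ _ r)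

      φ-injective : ∀ x y p q → φ x p ~ φ y q → x ~ y
      φ-injective x y p q r = φ′-inj (invB y) x y (p , e) (q , refl) (subst (_~ φ y q) (φ≡φ′ _ x p e) r)
        where
        e : invB x ≡ invB y
        e = trans (sym (φ-inv x p)) (trans (invA-resp (φ-good x p) r) (φ-inv y q))

      φ-surjective : ∀ a → A a → ∃ λ x → Σ (B x) λ p → φ x p ~ a
      φ-surjective a pa = b , proj₁ Bb , subst (_~ a) (sym lem) (~sym a~)
        where
        ι = invA a
        hit = proj₂ (proj₂ (proj₂ (proj₂ (repsA ι)))) a tt (pa , refl)
        i : Fin (proj₁ (repsA ι))
        i = proj₁ hit
        a~ : a ~ repA ι i
        a~ = proj₂ hit
        j : Fin (proj₁ (repsB ι))
        j = subst Fin (sym (same-count ι)) i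
        b : X
        b = proj₁ (proj₂ (repsB ι)) j
        Bb : B′ ι b
        Bb = proj₁ (proj₂ (proj₂ (repsB ι))) j
        lem : φ b (proj₁ Bb) ≡ repA ι i
        lem = trans (φ≡φ′ ι b (proj₁ Bb) (proj₂ Bb))
          (trans (cong (repA ι ∘ subst Fin (same-count ι)) (sym (repB-inj ι j _ (index-~ ι b _))))
                 (cong (repA ι) (subst-subst-sym (same-count ι))))

vectors : {A : Set} → List A → ∀ n → List (Vec A n)
vectors xs zero    = [] ∷ []
vectors xs (suc n) = List.cartesianProductWith _∷_ xs (vectors xs n)

∈-vectors : {A : Set} {xs : List A} → (∀ x → x ∈ xs) → ∀ {n} (v : Vec A n) → v ∈ vectors xs n
∈-vectors all []      = here refl
∈-vectors all (x ∷ v) = ∈-cartesianProductWith⁺ _∷_ (all x) (∈-vectors all v)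

-- Orbits of two involutions

least : {P : ℕ → Set} → (∀ k → Dec (P k)) → ∀ b → P b → ∃ λ k → P k × k ≤ b × (∀ j → j < k → ¬ P j)
least {P} P? b pb = go b (λ k → P? k) pb
  where
  go : ∀ {P : ℕ → Set} b → (∀ k → Dec (P k)) → P b → ∃ λ k → P k × k ≤ b × (∀ j → j < k → ¬ P j)
  go b P? pb with P? 0
  ... | yes p0 = 0 , p0 , z≤n , λ j ()
  go zero    P? pb | no ¬p0 = contradiction pb ¬p0
  go (suc b) P? pb | no ¬p0 with go b (P? ∘ suc) pb
  ... | k , pk , k≤b , low = suc k , pk , s≤s k≤b , λ { zero _ → ¬p0 ; (suc j) (s≤s j<k) → low j j<k }

iter : {A : Set} → (A → A) → ℕ → A → A
iter f zero    x = x
iter f (suc k) x = f (iter f k x)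

iter-+ : ∀ {A : Set} (f : A → A) a b x → iter f (a + b) x ≡ iter f a (iter f b x)
iter-+ f zero    b x = refl
iter-+ f (suc a) b x = cong f (iter-+ f a b x)

iter-comm : ∀ {A : Set} (f : A → A) a b x → iter f a (iter f b x) ≡ iter f b (iter f a x)
iter-comm f a b x = trans (sym (iter-+ f a b x)) (trans (cong (λ k → iter f k x) (ℕₚ.+-comm a b)) (iter-+ f b a x))

iter-fix : ∀ {A : Set} (f : A → A) {x} → f x ≡ x → ∀ k → iter f k x ≡ x
iter-fix f e zero    = refl
iter-fix f e (suc k) = trans (cong f (iter-fix f e k)) e

iter-fix-* : ∀ {A : Set} (f : A → A) {x} b → iter f b x ≡ x → ∀ a → iter f (a * b) x ≡ x
iter-fix-* f b e zero    = refl
iter-fix-* f b e (suc a) = trans (iter-+ f b (a * b) _) (trans (cong (iter f b) (iter-fix-* f b e a)) e)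

iter-suc : ∀ {A : Set} (f : A → A) k x → iter f (suc k) x ≡ iter f k (f x)
iter-suc f k x = trans (cong (λ j → iter f j x) (ℕₚ.+-comm 1 k)) (iter-+ f k 1 x)

iter-inverse : ∀ {A : Set} (f g : A → A) → (∀ x → g (f x) ≡ x) → ∀ k x → iter g k (iter f k x) ≡ x
iter-inverse f g gf zero    x = refl
iter-inverse f g gf (suc k) x = trans (iter-suc g k _) (trans (cong (iter g k) (gf _)) (iter-inverse f g gf k x))

iter-conj : ∀ {A B : Set} (f : A → A) (g : B → B) (h : A → B) → (∀ x → h (f x) ≡ g (h x)) → ∀ k x → h (iter f k x) ≡ iter g k (h x)
iter-conj f g h e zero    x = refl
iter-conj f g h e (suc k) x = trans (e _) (cong g (iter-conj f g h e k x))

even-odd : ∀ m → (∃ λ a → m ≡ a + a) ⊎ (∃ λ a → m ≡ suc (a + a))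
even-odd zero = inj₁ (0 , refl)
even-odd (suc m) with even-odd m
... | inj₁ (a , refl) = inj₂ (a , refl)
... | inj₂ (a , refl) = inj₁ (suc a , cong suc (sym (ℕₚ.+-suc a a)))

Step₂ : {A : Set} → (A → A) → (A → A) → A → A → Set
Step₂ f g x y = y ≡ f x ⊎ y ≡ g x

Conn : {A : Set} → (A → A) → (A → A) → A → A → Set
Conn f g = Star (Step₂ f g)

flip-involution : {A : Set} {f : A → A} → (∀ x → f (f x) ≡ x) → ∀ {x y} → y ≡ f x → x ≡ f y
flip-involution ff refl = sym (ff _)

conn-equiv : {A : Set} {f g : A → A} → (∀ x → f (f x) ≡ x) → (∀ x → g (g x) ≡ x) → IsEquivalence (Conn f g)
conn-equiv ff gg = star-isEquiv λ
  { (inj₁ e) → inj₁ (flip-involution ff e)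
  ; (inj₂ e) → inj₂ (flip-involution gg e) }

module _ {N : ℕ} (f : Fin N → Fin N) (f-inj : ∀ {x y} → f x ≡ f y → x ≡ y) where

  iter-injective : ∀ k {x y} → iter f k x ≡ iter f k y → x ≡ y
  iter-injective zero    e = e
  iter-injective (suc k) e = iter-injective k (f-inj e)

  opaque
    periodic : ∀ x → ∃ λ k → iter f (suc k) x ≡ x
    periodic x with Finₚ.pigeonhole (ℕₚ.n<1+n N) (λ i → iter f (toℕ i) x)
    ... | i , j , i<j , e = k , iter-injective (toℕ i) (trans (sym (iter-+ f (toℕ i) (suc k) x))
            (trans (cong (λ m → iter f m x) (trans (ℕₚ.+-suc (toℕ i) k) (ℕₚ.m+[n∸m]≡n i<j))) (sym e)))
      where
        k : ℕ
        k = toℕ j ∸ suc (toℕ i)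

    order : ∀ x → ∃ λ k → iter f (suc k) x ≡ x × (∀ j → j < k → ¬ iter f (suc j) x ≡ x)
    order x with periodic x
    ... | b , e with least (λ k → iter f (suc k) x Finₚ.≟ x) b e
    ...   | k , p , _ , low = k , p , low

module Dihedral {N : ℕ} (σ ρ : Fin N → Fin N) (σσ : ∀ x → σ (σ x) ≡ x) (ρρ : ∀ x → ρ (ρ x) ≡ x) where

  rot rot⁻¹ : Fin N → Fin N
  rot   x = ρ (σ x)
  rot⁻¹ x = σ (ρ x)

  rot⁻¹-rot : ∀ x → rot⁻¹ (rot x) ≡ x
  rot⁻¹-rot x = trans (cong σ (ρρ _)) (σσ x)

  rot-rot⁻¹ : ∀ x → rot (rot⁻¹ x) ≡ x
  rot-rot⁻¹ x = trans (cong ρ (σσ _)) (ρρ x)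

  rot-inj : ∀ {x y} → rot x ≡ rot y → x ≡ y
  rot-inj {x} {y} e = trans (sym (rot⁻¹-rot x)) (trans (cong rot⁻¹ e) (rot⁻¹-rot y))

  σ-rot : ∀ k x → σ (iter rot k x) ≡ iter rot⁻¹ k (σ x)
  σ-rot = iter-conj rot rot⁻¹ σ λ _ → refl

  ρ-rot : ∀ k x → ρ (iter rot k x) ≡ iter rot⁻¹ k (ρ x)
  ρ-rot = iter-conj rot rot⁻¹ ρ λ x → trans (ρρ _) (cong σ (sym (ρρ x)))

  -- A rotation that agrees with the reflection σ at y exhibits a reflection with a fixed point.
  refl-rot : ∀ m y → iter rot m y ≡ σ y →
    (∃ λ a → m ≡ a + a × σ (iter rot a y) ≡ iter rot a y) ⊎
    (∃ λ a → m ≡ suc (a + a) × ρ (σ (iter rot a y)) ≡ σ (iter rot a y))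
  refl-rot m y e with even-odd m
  ... | inj₁ (a , refl) = inj₁ (a , refl , trans (σ-rot a y)
          (trans (cong (iter rot⁻¹ a) (trans (sym e) (iter-+ rot a a y))) (iter-inverse rot rot⁻¹ rot⁻¹-rot a _)))
  ... | inj₂ (a , refl) = inj₂ (a , refl , sym (trans (σ-rot a y)
          (trans (cong (iter rot⁻¹ a) (trans (sym e) (trans (iter-suc rot (a + a) y) (trans (iter-+ rot a a _)
            (cong (iter rot a) (sym (iter-suc rot a y)))))))
            (iter-inverse rot rot⁻¹ rot⁻¹-rot a _))))

  no-refl-rot : (∀ x → ¬ σ x ≡ x) → (∀ x → ¬ ρ x ≡ x) → ∀ m y → ¬ iter rot m y ≡ σ y
  no-refl-rot σ-fpf ρ-fpf m y e with refl-rot m y e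
  ... | inj₁ (a , _ , h) = σ-fpf _ h
  ... | inj₂ (a , _ , h) = ρ-fpf _ h

  -- A coincidence would make σ act at z as a rotation, and halving that rotation (`refl-rot`) leads
  -- to a fixed point of σ or of ρ.
  rot≢σ-rot : (∀ x → ¬ σ x ≡ x) → (∀ x → ¬ ρ x ≡ x) → ∀ z k j → ¬ iter rot k z ≡ σ (iter rot j z)
  rot≢σ-rot σ-fpf ρ-fpf z k j h = no-refl-rot σ-fpf ρ-fpf (j + k) z
    (trans (iter-+ rot j k z) (trans (cong (iter rot j) (trans h (σ-rot j z))) (iter-inverse rot⁻¹ rot rot-rot⁻¹ j _)))

  -- At a point of period `suc m`, going back k steps is the same as going on `k * m` steps.
  inverse-power : ∀ k x → ∃ λ j → iter rot j x ≡ iter rot⁻¹ k x × iter rot⁻¹ j x ≡ iter rot k x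
  inverse-power k x with periodic rot rot-inj x
  ... | m , e = k * m , lem₁ , lem₂
    where
    full : iter rot (k + k * m) x ≡ x
    full = trans (cong (λ i → iter rot i x) (sym (ℕₚ.*-suc k m))) (iter-fix-* rot (suc m) e k)
    lem₁ = trans (sym (iter-inverse rot rot⁻¹ rot⁻¹-rot k _)) (cong (iter rot⁻¹ k) (trans (sym (iter-+ rot k (k * m) x)) full))
    lem₂ = trans (cong (iter rot⁻¹ (k * m)) (sym (trans (sym (iter-+ rot (k * m) k x))
             (trans (cong (λ i → iter rot i x) (ℕₚ.+-comm (k * m) k)) full))))
             (iter-inverse rot rot⁻¹ rot⁻¹-rot (k * m) _)

-- The components of the graph with edges x — σ x and x — ρ x are cycles, and paths whose ends are
-- the fixed points of ρ; an end e is sent to the other end of its path.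
module Pair {N : ℕ} (σ ρ : Fin N → Fin N) (σσ : ∀ x → σ (σ x) ≡ x) (ρρ : ∀ x → ρ (ρ x) ≡ x)
  (σ-fpf : ∀ x → ¬ σ x ≡ x) where

  open Dihedral σ ρ σσ ρρ

  opaque
    -- From an end of a path, `rot` runs to the other end and back again, so the other end is
    -- reached after half the period.
    half : Fin N → ℕ
    half e = ℕ.⌊ suc (proj₁ (order rot rot-inj e)) /2⌋

    pair : Fin N → Fin N
    pair e = iter rot (half e) e

    pair-def : ∀ e → iter rot (half e) e ≡ pair e
    pair-def e = refl

  record End (e : Fin N) : Set where
    field
      j       : ℕ
      half≡   : half e ≡ suc j
      pair≡   : pair e ≡ σ (iter rot j e)
      pair-ρ  : ρ (pair e) ≡ pair e
      period  : iter rot (suc (suc (j + j))) e ≡ e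
      minimal : ∀ i → i < suc (j + j) → ¬ iter rot (suc i) e ≡ e

  opaque
    unfolding half pair

    -- As ρ fixes e, the last point of the period, `iter rot k e`, is `σ e`. Then `refl-rot` finds
    -- where the orbit turns round: at a fixed point of σ if k is even, which is excluded, and at
    -- one of ρ if k is odd.
    end : ∀ e → ρ e ≡ e → End e
    end e ρe = build (order rot rot-inj e) refl
      where
      build : ∀ o → order rot rot-inj e ≡ o → End e
      build (k , per , low) eq = fin (refl-rot k e back)
        where
        back : iter rot k e ≡ σ e
        back = trans (sym (σσ _)) (cong σ (trans (sym (ρρ _)) (trans (cong ρ per) ρe)))
        fin : (∃ λ a → k ≡ a + a × σ (iter rot a e) ≡ iter rot a e) ⊎
              (∃ λ a → k ≡ suc (a + a) × ρ (σ (iter rot a e)) ≡ σ (iter rot a e)) → End e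
        fin (inj₁ (a , _ , h)) = contradiction h (σ-fpf _)
        fin (inj₂ (a , refl , h)) = record
          { j = a ; half≡ = half≡
          ; pair≡ = pair≡ ; pair-ρ = trans (cong ρ pair≡) (trans h (sym pair≡))
          ; period = per ; minimal = low }
          where
          half≡ : half e ≡ suc a
          half≡ = trans (cong (λ o → ℕ.⌊ suc (proj₁ o) /2⌋) eq) (cong suc (sym (ℕₚ.n≡⌊n+n/2⌋ a)))
          pair≡ : pair e ≡ σ (iter rot a e)
          pair≡ = trans (cong (λ i → iter rot i e) half≡) h

  module _ (e : Fin N) (ρe : ρ e ≡ e) where
    open End (end e ρe)

    pair-fixed : ρ (pair e) ≡ pair e
    pair-fixed = pair-ρ

    pair-≢ : ¬ pair e ≡ e
    pair-≢ h = minimal j (s≤s (ℕₚ.m≤m+n j j)) (trans (cong (λ i → iter rot i e) (sym half≡)) (trans (pair-def e) h))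

    conn-rot : ∀ i x → Conn σ ρ x (iter rot i x)
    conn-rot zero    x = ε
    conn-rot (suc i) x = conn-rot i x ◅◅ inj₁ refl ◅ inj₂ refl ◅ ε

    pair-conn : Conn σ ρ e (pair e)
    pair-conn = subst (Conn σ ρ e) (pair-def e) (conn-rot (half e) e)

    fixed-period : ∀ i → ρ (iter rot i e) ≡ iter rot i e → iter rot (i + i) e ≡ e
    fixed-period i h = trans (iter-+ rot i i e)
      (trans (cong (iter rot i) (trans (sym h) (trans (ρ-rot i e) (cong (iter rot⁻¹ i) ρe))))
             (iter-inverse rot⁻¹ rot rot-rot⁻¹ i e))

    orbit : ∀ {x} → Conn σ ρ e x → ∃ λ i → x ≡ iter rot i e
    orbit c = go 0 refl c
      where
      ρ-orbit : ∀ i → ∃ λ m → ρ (iter rot i e) ≡ iter rot m e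
      ρ-orbit i with inverse-power i e
      ... | m , h , _ = m , trans (ρ-rot i e) (trans (cong (iter rot⁻¹ i) ρe) (sym h))
      go : ∀ i {x y} → x ≡ iter rot i e → Conn σ ρ x y → ∃ λ m → y ≡ iter rot m e
      go i h ε = i , h
      go i refl (inj₁ refl ◅ c) with ρ-orbit (suc i)
      ... | m , h = go m (trans (sym (ρρ _)) h) c
      go i refl (inj₂ refl ◅ c) with ρ-orbit i
      ... | m , h = go m h c

    -- If ρ fixes `iter rot i e`, then 2i is a period by `fixed-period`. The least period is 2j + 2,
    -- so inside one period only i = 0 and i = j + 1 are possible; beyond the half, a full period is
    -- subtracted from 2i.
    small : ∀ i → i < suc (suc (j + j)) → ρ (iter rot i e) ≡ iter rot i e → i ≡ 0 ⊎ i ≡ suc j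
    small zero    _ _ = inj₁ refl
    small (suc i) (s≤s i<) h with ℕₚ.<-cmp i j
    ... | tri< i<j _ _ = contradiction (fixed-period (suc i) h)
            (minimal (i + suc i) (s≤s (ℕₚ.≤-trans (ℕₚ.≤-reflexive (ℕₚ.+-suc i i)) (ℕₚ.+-mono-≤ i<j (ℕₚ.<⇒≤ i<j)))))
    ... | tri≈ _ i≡j _ = inj₂ (cong suc i≡j)
    ... | tri> _ _ j<i = contradiction shorter (minimal m m<)
      where
      m = i + i ∸ suc (j + j)
      j+j<i+i : suc (j + j) ≤ i + i
      j+j<i+i = ℕₚ.+-mono-≤ j<i (ℕₚ.<⇒≤ j<i)
      split : m + suc (j + j) ≡ i + i
      split = ℕₚ.m∸n+n≡m j+j<i+i
      shorter : iter rot (suc m) e ≡ e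
      shorter = trans (cong (iter rot (suc m)) (sym period))
        (trans (sym (iter-+ rot (suc m) (suc (suc (j + j))) e))
        (trans (cong (λ k → iter rot (suc k) e)
           (trans (ℕₚ.+-suc m _) (trans (cong suc split) (sym (ℕₚ.+-suc i i)))))
           (fixed-period (suc i) h)))
      m< : m < suc (j + j)
      m< = ℕₚ.+-cancelʳ-< (suc (j + j)) m (suc (j + j))
             (subst (_< suc (j + j) + suc (j + j)) (sym split) (ℕₚ.+-mono-< i< i<))

    pair-unique : ∀ w → ρ w ≡ w → Conn σ ρ e w → w ≡ e ⊎ w ≡ pair e
    pair-unique w ρw c with orbit c
    ... | i , refl = fin (small (i % K) (m%n<n i K) (trans (cong ρ (sym red)) (trans ρw red)))
      where
      K = suc (suc (j + j))
      red : iter rot i e ≡ iter rot (i % K) e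
      red = trans (cong (λ k → iter rot k e) (m≡m%n+[m/n]*n i K))
              (trans (iter-+ rot (i % K) _ e) (cong (iter rot (i % K)) (iter-fix-* rot K period (i / K))))
      fin : i % K ≡ 0 ⊎ i % K ≡ suc j → _
      fin (inj₁ h) = inj₁ (trans red (cong (λ k → iter rot k e) h))
      fin (inj₂ h) = inj₂ (trans red (trans (cong (λ k → iter rot k e) (trans h (sym half≡))) (pair-def e)))

    -- Before the far end no point met is fixed by ρ, so each rotation changes the colour twice; the
    -- last σ changes it once more.
    pair-colour : (c : Fin N → Bool) → (∀ x → c (σ x) ≡ not (c x)) → (∀ x → ρ x ≡ x ⊎ c (ρ x) ≡ not (c x)) →
      c (pair e) ≡ not (c e)
    pair-colour c cσ cρ = trans (cong c pair≡) (trans (cσ _) (cong not (go j ℕₚ.≤-refl)))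
      where
      go : ∀ i → i ≤ j → c (iter rot i e) ≡ c e
      go zero    _ = refl
      go (suc i) i<j with cρ (σ (iter rot i e))
      ... | inj₁ h = contradiction (fixed-period (suc i) (cong ρ h))
               (minimal (i + suc i) (s≤s (ℕₚ.≤-trans (ℕₚ.≤-reflexive (ℕₚ.+-suc i i)) (ℕₚ.+-mono-≤ i<j (ℕₚ.<⇒≤ i<j)))))
      ... | inj₂ h = trans h (trans (cong not (cσ _)) (trans (Boolₚ.not-involutive _) (go i (ℕₚ.<⇒≤ i<j))))

  pair-pair : ∀ e → ρ e ≡ e → pair (pair e) ≡ e
  pair-pair e ρe with pair-unique e ρe (pair (pair e)) (pair-fixed (pair e) (pair-fixed e ρe))
                        (pair-conn e ρe ◅◅ pair-conn (pair e) (pair-fixed e ρe))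
  ... | inj₁ h = h
  ... | inj₂ h = contradiction h (pair-≢ (pair e) (pair-fixed e ρe))

-- An involution exchanging two fixed-point-free involutions P and T: on each orbit, reflect the
-- alternating cycle of P and T at a chosen base point, i.e. exchange P and T in words applied to it.
module Swap {N : ℕ} (Pv Tv : Vec (Fin N) N) where

  P T : Fin N → Fin N
  P = lookup Pv
  T = lookup Tv

  opaque
    -- The laws are decided from the tables and enter as irrelevant arguments, so the base points
    -- depend on `Pv` and `Tv` only. Pointwise equal matchings have equal tables and hence the same
    -- reflection.
    reps : ∃ λ m → .(∀ x → P (P x) ≡ x) → .(∀ x → T (T x) ≡ x) →
      HasClassCount (Conn P T) (λ _ → ⊤) m
    reps with Finₚ.all? (λ x → P (P x) Finₚ.≟ x) | Finₚ.all? (λ x → T (T x) Finₚ.≟ x)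
    ... | yes PP | yes TT = let m , h = classCount (conn-equiv {f = P} {g = T} PP TT) conn? (λ _ → yes tt) in m , λ _ _ → h
      where
      conn? : ∀ x y → Dec (Conn P T x y)
      conn? = Warshall.star? (Step₂ P T) (λ x y → (y Finₚ.≟ P x) ⊎-dec (y Finₚ.≟ T x))
    ... | no ¬PP | _      = 0 , λ PP _ → contradiction-irr PP ¬PP
    ... | yes _  | no ¬TT = 0 , λ _ TT → contradiction-irr TT ¬TT

  module Laws (PP : ∀ x → P (P x) ≡ x) (TT : ∀ x → T (T x) ≡ x)
    (P-fpf : ∀ x → ¬ P x ≡ x) (T-fpf : ∀ x → ¬ T x ≡ x) where

    open Dihedral P T PP TT

    base : Fin N → Fin N
    base y = let _ , h = reps ; e , _ , _ , sur = h PP TT in e (proj₁ (sur y tt))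

    base-conn : ∀ y → Conn P T (base y) y
    base-conn y = let _ , h = reps ; e , _ , _ , sur = h PP TT in IsEquivalence.sym (conn-equiv {f = P} {g = T} PP TT) (proj₂ (sur y tt))

    base-cong : ∀ {x y} → Conn P T x y → base x ≡ base y
    base-cong {x} {y} c = let _ , h = reps ; e , _ , inj , _ = h PP TT in
      cong e (inj _ _ (~trans (base-conn x) (~trans c (~sym (base-conn y)))))
      where open IsEquivalence (conn-equiv {f = P} {g = T} PP TT) using () renaming (refl to ~refl; sym to ~sym; trans to ~trans)

    -- Only words that apply P first (and the empty one) are listed; as the cycle is finite, these
    -- already reach every point of it.
    Word : Fin N → Fin N → Fin N → Set
    Word z y x = (∃ λ k → y ≡ iter rot k z × x ≡ iter rot⁻¹ k z) ⊎ (∃ λ k → y ≡ P (iter rot k z) × x ≡ T (iter rot⁻¹ k z))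

    word-total : ∀ {z y} → Conn P T z y → ∃ (Word z y)
    word-total {z} c = go (inj₁ (0 , refl , refl)) c
      where
      go : ∀ {w y x} → Word z w x → Conn P T w y → ∃ (Word z y)
      go r ε = _ , r
      go (inj₁ (k , refl , _)) (inj₁ refl ◅ c) = go (inj₂ (k , refl , refl)) c
      go (inj₂ (k , refl , _)) (inj₁ refl ◅ c) = go (inj₁ (k , PP _ , refl)) c
      go (inj₂ (k , refl , _)) (inj₂ refl ◅ c) = go (inj₁ (suc k , refl , refl)) c
      go (inj₁ (suc k , refl , _)) (inj₂ refl ◅ c) = go (inj₂ (k , TT _ , refl)) c
      go (inj₁ (zero , refl , _)) (inj₂ refl ◅ c) with inverse-power 1 z
      ... | j , h , _ = go (inj₂ (j , trans (sym (PP _)) (cong P (sym h)) , refl)) c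

    inv-eq : ∀ z k j → iter rot k z ≡ iter rot j z → iter rot⁻¹ k z ≡ iter rot⁻¹ j z
    inv-eq z k j h = trans (cong (iter rot⁻¹ k) (sym (iter-inverse rot rot⁻¹ rot⁻¹-rot j z)))
      (trans (iter-comm rot⁻¹ k j _) (cong (iter rot⁻¹ j) (trans (cong (iter rot⁻¹ k) (sym h)) (iter-inverse rot rot⁻¹ rot⁻¹-rot k z))))

    P-inj : ∀ {x y} → P x ≡ P y → x ≡ y
    P-inj {x} {y} e = trans (sym (PP x)) (trans (cong P e) (PP y))

    -- Without fixed points each component is an honest alternating cycle: a rotation of z never
    -- equals a reflection of z, and equal rotations have equal inverses.
    word-functional : ∀ {z y x x′} → Word z y x → Word z y x′ → x ≡ x′
    word-functional (inj₁ (k , refl , refl)) (inj₁ (j , h , refl)) = inv-eq _ k j h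
    word-functional (inj₁ (k , refl , refl)) (inj₂ (j , h , refl)) = contradiction h (rot≢σ-rot P-fpf T-fpf _ k j)
    word-functional (inj₂ (k , refl , refl)) (inj₁ (j , h , refl)) = contradiction (sym h) (rot≢σ-rot P-fpf T-fpf _ j k)
    word-functional (inj₂ (k , refl , refl)) (inj₂ (j , h , refl)) = cong T (inv-eq _ k j (P-inj h))

    word-sym : ∀ {z y x} → Word z y x → Word z x y
    word-sym {z} (inj₁ (k , refl , refl)) with inverse-power k z
    ... | j , h , h′ = inj₁ (j , sym h , sym h′)
    word-sym {z} (inj₂ (k , refl , refl)) with inverse-power (suc k) z
    ... | j , h , h′ = inj₂ (j , trans (sym (PP _)) (cong P (sym h)) , trans (sym (TT _)) (cong T (sym h′)))

    word-P : ∀ {z y x} → Word z y x → Word z (P y) (T x)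
    word-P (inj₁ (k , refl , refl)) = inj₂ (k , refl , refl)
    word-P (inj₂ (k , refl , refl)) = inj₁ (k , PP _ , TT _)

    private
      swapΣ : ∀ y → ∃ (Word (base y) y)
      swapΣ y = word-total (base-conn y)

    opaque
      swap : Fin N → Fin N
      swap y = proj₁ (swapΣ y)

      swap-word : ∀ y → Word (base y) y (swap y)
      swap-word y = proj₂ (swapΣ y)

    word-conn : ∀ {z y x} → Word z y x → Conn P T z x
    word-conn (inj₁ (k , _ , refl)) = go k
      where
      go : ∀ {z} k → Conn P T z (iter rot⁻¹ k z)
      go zero    = ε
      go (suc k) = go k ◅◅ inj₂ refl ◅ inj₁ refl ◅ ε
    word-conn (inj₂ (k , _ , refl)) = word-conn (inj₁ (k , refl , refl)) ◅◅ inj₂ refl ◅ ε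

    swap-conn : ∀ y → Conn P T y (swap y)
    swap-conn y = IsEquivalence.sym (conn-equiv {f = P} {g = T} PP TT) (base-conn y) ◅◅ word-conn (swap-word y)

    swap-unique : ∀ {y x} → Word (base y) y x → swap y ≡ x
    swap-unique {y} w = word-functional (swap-word y) w

    swap-swap : ∀ y → swap (swap y) ≡ y
    swap-swap y = swap-unique (subst (λ z → Word z (swap y) y) (base-cong (swap-conn y)) (word-sym (swap-word y)))

    swap-P : ∀ y → swap (P y) ≡ T (swap y)
    swap-P y = swap-unique (subst (λ z → Word z (P y) (T (swap y))) (base-cong (inj₁ refl ◅ ε)) (word-P (swap-word y)))

    swap-T : ∀ y → swap (T y) ≡ P (swap y)
    swap-T y = trans (cong (swap ∘ T) (sym (swap-swap y))) (trans (cong swap (sym (swap-P (swap y)))) (swap-swap _))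

    swap-invariant : {A : Set} (h : Fin N → A) → (∀ x → h (P x) ≡ h x) → (∀ x → h (T x) ≡ h x) → ∀ y → h (swap y) ≡ h y
    swap-invariant h hP hT y = go (swap-conn y)
      where
      go : ∀ {x z} → Conn P T x z → h z ≡ h x
      go ε = refl
      go (inj₁ refl ◅ c) = trans (go c) (hP _)
      go (inj₂ refl ◅ c) = trans (go c) (hT _)

    swap-colour : (c : Fin N → Bool) → (∀ x → c (P x) ≡ not (c x)) → (∀ x → c (T x) ≡ not (c x)) → ∀ y → c (swap y) ≡ c y
    swap-colour c cP cT y = fin (swap-word y)
      where
      fwd : ∀ k z → c (iter rot k z) ≡ c z
      fwd zero    z = refl
      fwd (suc k) z = trans (cT _) (trans (cong not (cP _)) (trans (Boolₚ.not-involutive _) (fwd k z)))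
      bwd : ∀ k z → c (iter rot⁻¹ k z) ≡ c z
      bwd zero    z = refl
      bwd (suc k) z = trans (cP _) (trans (cong not (cT _)) (trans (Boolₚ.not-involutive _) (bwd k z)))
      fin : ∀ {z y x} → Word z y x → c x ≡ c y
      fin {z} (inj₁ (k , refl , refl)) = trans (bwd k z) (sym (fwd k z))
      fin {z} (inj₂ (k , refl , refl)) = trans (cT _) (trans (cong not (trans (bwd k z) (sym (fwd k z)))) (sym (cP _)))

    -- `P y ≡ T y` closes the cycle after the two points y and `P y`. The reflection fixes the base
    -- point, which is one of them, and therefore also the other.
    swap-fixed : ∀ y → P y ≡ T y → swap y ≡ y
    swap-fixed y Py≡Ty = fin (swap-word y)
      where
      back : ∀ k {z u} → P u ≡ T u → u ≡ iter rot k z → z ≡ u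
      back k {z} {u} e h = trans (sym (iter-inverse rot rot⁻¹ rot⁻¹-rot k z)) (trans (cong (iter rot⁻¹ k) (sym h))
        (iter-fix rot⁻¹ (trans (cong P (sym e)) (PP u)) k))
      fin : ∀ {z x} → Word z y x → x ≡ y
      fin (inj₁ (k , h , refl)) with back k Py≡Ty h
      ... | refl = iter-fix rot⁻¹ (trans (cong P (sym Py≡Ty)) (PP y)) k
      fin {z} (inj₂ (k , h , refl)) with back k {z} {P y} (trans (PP y) (sym (trans (cong T Py≡Ty) (TT y)))) (trans (cong P h) (PP _))
      ... | refl = trans (cong T (iter-fix rot⁻¹ (cong P (trans (cong T Py≡Ty) (TT y))) k)) (trans (cong T Py≡Ty) (TT y))

module _ {N : ℕ} where

  -- `swap` is pinned down by `Word` at the base point, and neither depends on the proofs about P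
  -- and T. Thus π is the same for any two derivations of its laws.
  swap-cong : ∀ {Pv Pv′ Tv : Vec (Fin N) N} → Pv ≡ Pv′ → ∀ pp tq pf tf pp′ tq′ pf′ tf′ y →
    Swap.Laws.swap Pv Tv pp tq pf tf y ≡ Swap.Laws.swap Pv′ Tv pp′ tq′ pf′ tf′ y
  swap-cong {Pv} {Tv = Tv} refl pp tq pf tf pp′ tq′ pf′ tf′ y =
    Swap.Laws.swap-unique Pv Tv pp tq pf tf (Swap.Laws.swap-word Pv Tv pp′ tq′ pf′ tf′ y)

-- Layered gluings

-- Levels are normalised to minimum 1: on a map, label minus minimal label plus 1; on a
-- quadrangulation, the distance from v₀ to the upper end of a side. `bounded` leaves finitely many
-- structures and starts the induction on levels from above.
record Frame {N : ℕ} (τ₀ τ₂ : Fin N → Fin N) (ℓ : Fin N → ℕ) : Set where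
  field
    τ₀-inv    : ∀ x → τ₀ (τ₀ x) ≡ x
    τ₂-inv    : ∀ x → τ₂ (τ₂ x) ≡ x
    τ₀-fpf    : ∀ x → ¬ τ₀ x ≡ x
    τ₂-fpf    : ∀ x → ¬ τ₂ x ≡ x
    comm      : ∀ x → τ₀ (τ₂ x) ≡ τ₂ (τ₀ x)
    τ₀τ₂-fpf  : ∀ x → ¬ τ₀ (τ₂ x) ≡ x
    ℓ-τ₂      : ∀ x → ℓ (τ₂ x) ≡ ℓ x
    adjacent  : ∀ x → ℓ (τ₀ x) ≡ suc (ℓ x) ⊎ ℓ (τ₀ x) ≡ ℓ x ⊎ suc (ℓ (τ₀ x)) ≡ ℓ x
    positive  : ∀ x → 1 ≤ ℓ x
    bounded   : ∀ x → ℓ x ≤ N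
    lowest    : ∃ λ x → ℓ x ≡ 1

record Gluing {N : ℕ} (ℓ : Fin N → ℕ) (τ₁ : Fin N → Fin N) : Set where
  field
    τ₁-inv : ∀ x → τ₁ (τ₁ x) ≡ x
    τ₁-fpf : ∀ x → ¬ τ₁ x ≡ x
    ℓ-τ₁   : ∀ x → ℓ (τ₁ x) ≡ ℓ x

module Directions {N : ℕ} (τ₀ : Fin N → Fin N) (ℓ : Fin N → ℕ) where

  Up Down : Fin N → Set
  Up   x = ℓ (τ₀ x) ≡ suc (ℓ x)
  Down x = suc (ℓ (τ₀ x)) ≡ ℓ x

  up? : ∀ x → Dec (Up x)
  up? x = ℓ (τ₀ x) ℕ.≟ suc (ℓ x)

  -- The walk inside one level: at a flag leading up it jumps along T, it crosses an edge between
  -- equal levels, and it stops at a flag leading down. For `T = τ₂` it turns around a vertex of the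
  -- quadrangulation through the lower ends of sides; for `T = pU` it follows the face of the map
  -- with the excursions to higher levels cut short.
  low : (Fin N → Fin N) → Fin N → Fin N
  low T x with up? x | ℓ (τ₀ x) ℕ.≟ ℓ x
  ... | yes _ | _     = T x
  ... | no _  | yes _ = τ₀ x
  ... | no _  | no _  = x

  -- The flags above level i that it fixes are the places where the contour drops to level i. This
  -- makes the stretches of contour above level i paths in the sense of `Pair`.
  above : ℕ → Fin N → Fin N
  above i x with i ℕ.<? ℓ x | i ℕ.<? ℓ (τ₀ x)
  ... | yes _ | yes _ = τ₀ x
  ... | _     | _     = x

  -- Away from the flags leading up this is τ₂ itself, so the involution that exchanges it with τ₂
  -- is the identity there.
  turn-up : (Fin N → Fin N) → (Fin N → Fin N) → Fin N → Fin N
  turn-up P τ₂ x with up? x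
  ... | yes _ = P x
  ... | no _  = τ₂ x

-- An abstract version of the first-return matchings of flags leading one level up.
record Return {N : ℕ} (τ₀ τ₂ : Fin N → Fin N) (ℓ : Fin N → ℕ) (P : Fin N → Fin N) : Set where
  open Directions τ₀ ℓ
  field
    P-up  : ∀ {y} → Up y → Up (P y)
    ℓ-P   : ∀ {y} → Up y → ℓ (P y) ≡ ℓ y
    P-inv : ∀ {y} → Up y → P (P y) ≡ y
    P-fpf : ∀ {y} → Up y → ¬ P y ≡ y

Orients : {N : ℕ} → (Fin N → Bool) → (Fin N → Fin N) → Set
Orients c f = ∀ x → c (f x) ≡ not (c x)

module Framed {N : ℕ} {τ₀ τ₂ : Fin N → Fin N} {ℓ : Fin N → ℕ} (frame : Frame τ₀ τ₂ ℓ) where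

  open Frame frame public
  open Directions τ₀ ℓ public

  ¬up-down : ∀ {x} → Down x → ¬ Up x
  ¬up-down {x} d u = ℕₚ.1+n≰n (ℕₚ.≤-trans (ℕₚ.n≤1+n _) (ℕₚ.≤-reflexive (trans (cong suc (sym u)) d)))

  ¬flat-up : ∀ {x} → ℓ (τ₀ x) ≡ ℓ x → ¬ Up x
  ¬flat-up f u = ℕₚ.1+n≢n (trans (sym u) f)

  ¬flat-down : ∀ {x} → ℓ (τ₀ x) ≡ ℓ x → ¬ Down x
  ¬flat-down f d = ℕₚ.1+n≢n (trans d (sym f))

  up→down : ∀ {x} → Up x → Down (τ₀ x)
  up→down {x} u = trans (cong suc (cong ℓ (τ₀-inv x))) (sym u)

  down→up : ∀ {x} → Down x → Up (τ₀ x)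
  down→up {x} d = trans (cong ℓ (τ₀-inv x)) (sym d)

  up-τ₂ : ∀ {x} → Up x → Up (τ₂ x)
  up-τ₂ {x} u = trans (cong ℓ (comm x)) (trans (ℓ-τ₂ _) (trans u (cong suc (sym (ℓ-τ₂ x)))))

  low-up : ∀ T {x} → Up x → low T x ≡ T x
  low-up T {x} u with up? x
  ... | yes _ = refl
  ... | no ¬u = contradiction u ¬u

  low-flat : ∀ T {x} → ℓ (τ₀ x) ≡ ℓ x → low T x ≡ τ₀ x
  low-flat T {x} f with up? x | ℓ (τ₀ x) ℕ.≟ ℓ x
  ... | yes u | _     = contradiction u (¬flat-up f)
  ... | no _  | yes _ = refl
  ... | no _  | no ¬f = contradiction f ¬f

  low-down : ∀ T {x} → Down x → low T x ≡ x
  low-down T {x} d with up? x | ℓ (τ₀ x) ℕ.≟ ℓ x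
  ... | yes u | _     = contradiction u (¬up-down d)
  ... | no _  | yes f = contradiction d (¬flat-down f)
  ... | no _  | no _  = refl

  return-τ₂ : Return τ₀ τ₂ ℓ τ₂
  return-τ₂ = record { P-up = up-τ₂ ; ℓ-P = λ _ → ℓ-τ₂ _ ; P-inv = λ _ → τ₂-inv _ ; P-fpf = λ _ → τ₂-fpf _ }

  turn-up-up : ∀ P {x} → Up x → turn-up P τ₂ x ≡ P x
  turn-up-up P {x} u with up? x
  ... | yes _ = refl
  ... | no ¬u = contradiction u ¬u

  turn-up-¬up : ∀ P {x} → ¬ Up x → turn-up P τ₂ x ≡ τ₂ x
  turn-up-¬up P {x} ¬u with up? x
  ... | yes u = contradiction u ¬u
  ... | no _  = refl

  ¬up-τ₂ : ∀ {x} → ¬ Up x → ¬ Up (τ₂ x)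
  ¬up-τ₂ {x} ¬u u = ¬u (subst Up (τ₂-inv x) (up-τ₂ u))

  module Low {T : Fin N → Fin N} (ret : Return τ₀ τ₂ ℓ T) where
    open Return ret

    low-inv : ∀ x → low T (low T x) ≡ x
    low-inv x with adjacent x
    ... | inj₁ u        = trans (cong (low T) (low-up T u)) (trans (low-up T (P-up u)) (P-inv u))
    ... | inj₂ (inj₁ f) = trans (cong (low T) (low-flat T f))
                            (trans (low-flat T (trans (cong ℓ (τ₀-inv x)) (sym f))) (τ₀-inv x))
    ... | inj₂ (inj₂ d) = trans (cong (low T) (low-down T d)) (low-down T d)

    ℓ-low : ∀ x → ℓ (low T x) ≡ ℓ x
    ℓ-low x with adjacent x
    ... | inj₁ u        = trans (cong ℓ (low-up T u)) (ℓ-P u)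
    ... | inj₂ (inj₁ f) = trans (cong ℓ (low-flat T f)) f
    ... | inj₂ (inj₂ d) = cong ℓ (low-down T d)

    low-fixed : ∀ {x} → low T x ≡ x → Down x
    low-fixed {x} e with adjacent x
    ... | inj₁ u        = contradiction (trans (sym (low-up T u)) e) (P-fpf u)
    ... | inj₂ (inj₁ f) = contradiction (trans (sym (low-flat T f)) e) (τ₀-fpf x)
    ... | inj₂ (inj₂ d) = d

  above-in : ∀ {i x} → i < ℓ x → i < ℓ (τ₀ x) → above i x ≡ τ₀ x
  above-in {i} {x} p q with i ℕ.<? ℓ x | i ℕ.<? ℓ (τ₀ x)
  ... | yes _ | yes _ = refl
  ... | yes _ | no ¬q = contradiction q ¬q
  ... | no ¬p | _     = contradiction p ¬p

  above-out : ∀ {i x} → ¬ i < ℓ (τ₀ x) → above i x ≡ x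
  above-out {i} {x} ¬q with i ℕ.<? ℓ x | i ℕ.<? ℓ (τ₀ x)
  ... | yes _ | yes q = contradiction q ¬q
  ... | yes _ | no _  = refl
  ... | no _  | _     = refl

  above-cases : ∀ i x → above i x ≡ x ⊎ (above i x ≡ τ₀ x × i < ℓ x × i < ℓ (τ₀ x))
  above-cases i x with i ℕ.<? ℓ x | i ℕ.<? ℓ (τ₀ x)
  ... | yes p | yes q = inj₂ (refl , p , q)
  ... | yes _ | no _  = inj₁ refl
  ... | no _  | _     = inj₁ refl

  above-inv : ∀ i x → above i (above i x) ≡ x
  above-inv i x with above-cases i x
  ... | inj₁ e           = trans (cong (above i) e) e
  ... | inj₂ (e , p , q) = trans (cong (above i) e)
          (trans (above-in q (subst (λ z → i < ℓ z) (sym (τ₀-inv x)) p)) (τ₀-inv x))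

  above-mono : ∀ i x → above (suc i) x ≡ x ⊎ above (suc i) x ≡ above i x
  above-mono i x with above-cases (suc i) x
  ... | inj₁ e           = inj₁ e
  ... | inj₂ (e , p , q) = inj₂ (trans e (sym (above-in (ℕₚ.<⇒≤ p) (ℕₚ.<⇒≤ q))))

  -- With `T = τ₂`: the sides of level 1 have a single lower vertex, v₀, and every other vertex has
  -- a neighbour one level lower, which makes levels distances. With `T = pU`: level 1 of the
  -- contour hangs together and every higher component can be left downwards, which makes the
  -- contour one face.
  Desc : (Fin N → Fin N) → (Fin N → Fin N) → Set
  Desc τ₁ T = (∀ x z → ℓ x ≡ 1 → ℓ z ≡ 1 → Conn τ₁ (low T) x z) ×
              (∀ x → 2 ≤ ℓ x → ∃ λ z → Down z × Conn τ₁ (low T) x z)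

  OneFace : (Fin N → Fin N) → Set
  OneFace τ₁ = ∀ x y → Conn τ₀ τ₁ x y

-- Conjugation by the involution that exchanges P with τ₂ on the flags leading up.
module Exchange {N : ℕ} {τ₀ τ₂ : Fin N → Fin N} {ℓ : Fin N → ℕ} (frame : Frame τ₀ τ₂ ℓ)
  {P : Fin N → Fin N} (ret : Return τ₀ τ₂ ℓ P) where
  open Framed frame
  open Return ret

  κ : Fin N → Fin N
  κ = turn-up P τ₂

  κ-inv : ∀ x → κ (κ x) ≡ x
  κ-inv x with up? x
  ... | yes u = trans (turn-up-up P (P-up u)) (P-inv u)
  ... | no ¬u = trans (turn-up-¬up P (¬up-τ₂ ¬u)) (τ₂-inv x)

  κ-fpf : ∀ x → ¬ κ x ≡ x
  κ-fpf x with up? x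
  ... | yes u = P-fpf u
  ... | no ¬u = τ₂-fpf x

  ℓ-κ : ∀ x → ℓ (κ x) ≡ ℓ x
  ℓ-κ x with up? x
  ... | yes u = ℓ-P u
  ... | no ¬u = ℓ-τ₂ x

  ℓτ₀-κ : ∀ x → ℓ (τ₀ (κ x)) ≡ ℓ (τ₀ x)
  ℓτ₀-κ x with up? x
  ... | yes u = trans (P-up u) (trans (cong suc (ℓ-P u)) (sym u))
  ... | no ¬u = trans (cong ℓ (comm x)) (ℓ-τ₂ _)

  κv : Vec (Fin N) N
  κv = tabulate κ

  τ₂v : Vec (Fin N) N
  τ₂v = tabulate τ₂

  via-table : (g : Fin N → Fin N) {Q : Fin N → Fin N → Set} → (∀ x → Q x (g x)) → ∀ x → Q x (lookup (tabulate g) x)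
  via-table g {Q} q x = subst (Q x) (sym (Vecₚ.lookup∘tabulate g x)) (q x)

  table-inv : ∀ {g : Fin N → Fin N} → (∀ x → g (g x) ≡ x) → ∀ x → lookup (tabulate g) (lookup (tabulate g) x) ≡ x
  table-inv {g} gg x = trans (Vecₚ.lookup∘tabulate g _) (trans (cong g (Vecₚ.lookup∘tabulate g x)) (gg x))

  table-fpf : ∀ {g : Fin N → Fin N} → (∀ x → ¬ g x ≡ x) → ∀ x → ¬ lookup (tabulate g) x ≡ x
  table-fpf {g} = via-table g {λ x y → ¬ y ≡ x}

  module S = Swap.Laws {N} κv τ₂v (table-inv {κ} κ-inv) (table-inv {τ₂} τ₂-inv)
    (table-fpf {κ} κ-fpf) (table-fpf {τ₂} τ₂-fpf)

  π : Fin N → Fin N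
  π = S.swap

  π-inv : ∀ x → π (π x) ≡ x
  π-inv = S.swap-swap

  π-κ : ∀ x → π (κ x) ≡ τ₂ (π x)
  π-κ x = trans (cong π (sym (Vecₚ.lookup∘tabulate κ x))) (trans (S.swap-P x) (Vecₚ.lookup∘tabulate τ₂ _))

  π-τ₂ : ∀ x → π (τ₂ x) ≡ κ (π x)
  π-τ₂ x = trans (cong π (sym (Vecₚ.lookup∘tabulate τ₂ x))) (trans (S.swap-T x) (Vecₚ.lookup∘tabulate κ _))

  π-invariant : {A : Set} (h : Fin N → A) → (∀ x → h (κ x) ≡ h x) → (∀ x → h (τ₂ x) ≡ h x) → ∀ x → h (π x) ≡ h x
  π-invariant h hκ hτ = S.swap-invariant h
    (via-table κ {λ x y → h y ≡ h x} hκ) (via-table τ₂ {λ x y → h y ≡ h x} hτ)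

  ℓ-π : ∀ x → ℓ (π x) ≡ ℓ x
  ℓ-π = π-invariant ℓ ℓ-κ ℓ-τ₂

  ℓτ₀-π : ∀ x → ℓ (τ₀ (π x)) ≡ ℓ (τ₀ x)
  ℓτ₀-π = π-invariant (ℓ ∘ τ₀) ℓτ₀-κ (λ x → trans (cong ℓ (comm x)) (ℓ-τ₂ _))

  up-π : ∀ {x} → Up x → Up (π x)
  up-π {x} u = trans (ℓτ₀-π x) (trans u (cong suc (sym (ℓ-π x))))

  π-¬up : ∀ {x} → ¬ Up x → π x ≡ x
  π-¬up {x} ¬u = S.swap-fixed x (trans (Vecₚ.lookup∘tabulate κ x)
    (trans (turn-up-¬up P ¬u) (sym (Vecₚ.lookup∘tabulate τ₂ x))))

  π-colour : ∀ c → (∀ {y} → Up y → c (P y) ≡ not (c y)) → Orients c τ₂ → ∀ x → c (π x) ≡ c x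
  π-colour c cP cτ = S.swap-colour c
    (via-table κ {λ x y → c y ≡ not (c x)} cκ) (via-table τ₂ {λ x y → c y ≡ not (c x)} cτ)
    where
    cκ : Orients c κ
    cκ x with up? x
    ... | yes u = cP u
    ... | no _  = cτ x

  -- On flags leading up, `low P` is κ and `low τ₂` is τ₂, which π exchanges. On all other flags the
  -- two agree and π is the identity.
  π-low-P : ∀ x → π (low P x) ≡ low τ₂ (π x)
  π-low-P x = by (adjacent x)
    where
    by : Up x ⊎ ℓ (τ₀ x) ≡ ℓ x ⊎ Down x → π (low P x) ≡ low τ₂ (π x)
    by (inj₁ u) = trans (cong π (trans (low-up P u) (sym (turn-up-up P u)))) (trans (π-κ x) (sym (low-up τ₂ (up-π u))))
    by (inj₂ (inj₁ f)) = trans (cong π (low-flat P f))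
      (trans (π-¬up (¬flat-up (trans (cong ℓ (τ₀-inv x)) (sym f))))
        (sym (trans (cong (low τ₂) (π-¬up (¬flat-up f))) (low-flat τ₂ f))))
    by (inj₂ (inj₂ d)) = trans (cong π (low-down P d)) (sym (trans (cong (low τ₂) πx≡x) (trans (low-down τ₂ d) (sym πx≡x))))
      where
      πx≡x : π x ≡ x
      πx≡x = π-¬up (¬up-down d)

  π-low-τ₂ : ∀ x → π (low τ₂ x) ≡ low P (π x)
  π-low-τ₂ x = trans (cong (π ∘ low τ₂) (sym (π-inv x)))
    (trans (cong π (sym (π-low-P (π x)))) (π-inv _))

  π-down : ∀ {x} → Down x → π x ≡ x
  π-down d = π-¬up (¬up-down d)

  module Conjugate {τ₁ : Fin N → Fin N} (gl : Gluing ℓ τ₁) {τ₁* : Fin N → Fin N} (conj : ∀ x → τ₁* x ≡ π (τ₁ (π x))) where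
    open Gluing gl

    π-τ₁ : ∀ x → π (τ₁ x) ≡ τ₁* (π x)
    π-τ₁ x = sym (trans (conj _) (cong (π ∘ τ₁) (π-inv x)))

    π-τ₁* : ∀ x → π (τ₁* x) ≡ τ₁ (π x)
    π-τ₁* x = trans (cong π (conj x)) (π-inv _)

    gluing* : Gluing ℓ τ₁*
    gluing* = record
      { τ₁-inv = λ x → trans (conj _) (trans (cong (π ∘ τ₁) (π-τ₁* x)) (trans (cong π (τ₁-inv _)) (π-inv x)))
      ; τ₁-fpf = λ x h → τ₁-fpf (π x) (trans (sym (π-τ₁* x)) (cong π h))
      ; ℓ-τ₁   = λ x → trans (cong ℓ (conj x)) (trans (ℓ-π _) (trans (ℓ-τ₁ _) (ℓ-π x))) }

    conn-to : ∀ {x y} → Conn τ₁ (low P) x y → Conn τ₁* (low τ₂) (π x) (π y)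
    conn-to = Star.gmap π λ
      { (inj₁ refl) → inj₁ (π-τ₁ _)
      ; (inj₂ refl) → inj₂ (π-low-P _) }

    conn-to′ : ∀ {x y} → Conn τ₁ (low τ₂) x y → Conn τ₁* (low P) (π x) (π y)
    conn-to′ = Star.gmap π λ
      { (inj₁ refl) → inj₁ (π-τ₁ _)
      ; (inj₂ refl) → inj₂ (π-low-τ₂ _) }

    conn-from : ∀ {x y} → Conn τ₁* (low τ₂) x y → Conn τ₁ (low P) (π x) (π y)
    conn-from = Star.gmap π λ
      { (inj₁ refl) → inj₁ (π-τ₁* _)
      ; (inj₂ refl) → inj₂ (π-low-τ₂ _) }

    conn-to-V : ∀ {x y} → Conn τ₁ τ₂ x y → Conn τ₁* κ (π x) (π y)
    conn-to-V = Star.gmap π λ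
      { (inj₁ refl) → inj₁ (π-τ₁ _)
      ; (inj₂ refl) → inj₂ (π-τ₂ _) }

    conn-to-V′ : ∀ {x y} → Conn τ₁ κ x y → Conn τ₁* τ₂ (π x) (π y)
    conn-to-V′ = Star.gmap π λ
      { (inj₁ refl) → inj₁ (π-τ₁ _)
      ; (inj₂ refl) → inj₂ (π-κ _) }

    orients* : ∀ c → (∀ {y} → Up y → c (P y) ≡ not (c y)) → Orients c τ₁ → Orients c τ₂ → Orients c τ₁*
    orients* c cP c₁ c₂ x = trans (cong c (conj x)) (trans (cπ _) (trans (c₁ _) (cong not (cπ x))))
      where cπ = π-colour c cP c₂

    desc-to : Desc τ₁ P → Desc τ₁* τ₂
    desc-to (a , b) =
      (λ x z hx hz → subst₂ (Conn τ₁* (low τ₂)) (π-inv x) (π-inv z)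
         (conn-to (a (π x) (π z) (trans (ℓ-π x) hx) (trans (ℓ-π z) hz)))) ,
      (λ x h → let z , d , c = b (π x) (subst (2 ≤_) (sym (ℓ-π x)) h) in
         z , d , subst₂ (Conn τ₁* (low τ₂)) (π-inv x) (π-down d) (conn-to c))

    desc-to′ : Desc τ₁ τ₂ → Desc τ₁* P
    desc-to′ (a , b) =
      (λ x z hx hz → subst₂ (Conn τ₁* (low P)) (π-inv x) (π-inv z)
         (conn-to′ (a (π x) (π z) (trans (ℓ-π x) hx) (trans (ℓ-π z) hz)))) ,
      (λ x h → let z , d , c = b (π x) (subst (2 ≤_) (sym (ℓ-π x)) h) in
         z , d , subst₂ (Conn τ₁* (low P)) (π-inv x) (π-down d) (conn-to′ c))

-- The first-return matchings of a gluing

module Glued {N : ℕ} {τ₀ τ₂ : Fin N → Fin N} {ℓ : Fin N → ℕ} (frame : Frame τ₀ τ₂ ℓ)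
  {τ₁ : Fin N → Fin N} (gl : Gluing ℓ τ₁) where
  open Framed frame
  open Gluing gl

  open Low return-τ₂ public using () renaming (low-inv to low-τ₂-inv; ℓ-low to ℓ-low-τ₂; low-fixed to low-τ₂-fixed)

  module PU (i : ℕ) = Pair τ₁ (above i) τ₁-inv (above-inv i) τ₁-fpf
  module PQ = Pair τ₁ (low τ₂) τ₁-inv low-τ₂-inv τ₁-fpf

  -- For y leading up, `pU y` is where the contour that goes up at y first comes back to the level
  -- of y. `pQ y` is the upper end at which the turn around the upper vertex of the side y leaves
  -- the run of lower ends that it entered at y.
  pU pQ : Fin N → Fin N
  pU y = τ₀ (PU.pair (ℓ y) (τ₀ y))
  pQ y = τ₀ (PQ.pair (τ₀ y))

  conn-above : ∀ {i x z} → i < ℓ x → Conn τ₁ (above i) x z → i < ℓ z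
  conn-above p ε = p
  conn-above {i} p (inj₁ refl ◅ c) = conn-above (subst (i <_) (sym (ℓ-τ₁ _)) p) c
  conn-above {i} {x} p (inj₂ refl ◅ c) with above-cases i x
  ... | inj₁ e           = conn-above (subst (λ z → i < ℓ z) (sym e) p) c
  ... | inj₂ (e , _ , q) = conn-above (subst (λ z → i < ℓ z) (sym e) q) c

  exit-above : ∀ {i w} → i < ℓ w → above i w ≡ w → Down w × ℓ (τ₀ w) ≡ i
  exit-above {i} {w} p e with adjacent w
  ... | inj₁ u        = contradiction (subst (i <_) (sym u) (ℕₚ.m<n⇒m<1+n p)) λ q → τ₀-fpf w (trans (sym (above-in p q)) e)
  ... | inj₂ (inj₁ f) = contradiction (subst (i <_) (sym f) p) λ q → τ₀-fpf w (trans (sym (above-in p q)) e)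
  ... | inj₂ (inj₂ d) = d , ℕₚ.≤-antisym (ℕₚ.≮⇒≥ λ q → τ₀-fpf w (trans (sym (above-in p q)) e))
                              (ℕₚ.≤-pred (subst (i <_) (sym d) p))

  above-τ₀-up : ∀ {y} → Up y → above (ℓ y) (τ₀ y) ≡ τ₀ y
  above-τ₀-up {y} u = above-out (subst (λ z → ¬ ℓ y < ℓ z) (sym (τ₀-inv y)) (ℕₚ.<-irrefl refl))

  above-exit : ∀ {i w} → ℓ (τ₀ w) ≡ i → above i w ≡ w
  above-exit refl = above-out (ℕₚ.<-irrefl refl)

  module _ {y : Fin N} (u : Up y) where

    private
      i = ℓ y
      e = τ₀ y
      ρe = above-τ₀-up u
      e′ = PU.pair i e

    pU-conn : Conn τ₁ (above (ℓ y)) (τ₀ y) (τ₀ (pU y))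
    pU-conn = subst (Conn τ₁ (above i) e) (sym (τ₀-inv _)) (PU.pair-conn i e ρe)

    pU-exit : Down e′ × ℓ (τ₀ e′) ≡ i
    pU-exit = exit-above (conn-above (subst (i <_) (sym u) (ℕₚ.n<1+n i)) (PU.pair-conn i e ρe)) (PU.pair-fixed i e ρe)

    pU-unique : ∀ {w} → above (ℓ y) w ≡ w → Conn τ₁ (above (ℓ y)) (τ₀ y) w → ¬ w ≡ τ₀ y → pU y ≡ τ₀ w
    pU-unique {w} ρw c ≢ with PU.pair-unique i e ρe w ρw c
    ... | inj₁ h = contradiction h ≢
    ... | inj₂ h = cong τ₀ (sym h)

    pU-inv : pU (pU y) ≡ y
    pU-inv = trans (cong (λ k → τ₀ (PU.pair k (τ₀ (pU y)))) (proj₂ pU-exit))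
      (trans (cong (τ₀ ∘ PU.pair i) (τ₀-inv e′)) (trans (cong τ₀ (PU.pair-pair i e ρe)) (τ₀-inv y)))

    pU-fpf : ¬ pU y ≡ y
    pU-fpf h = PU.pair-≢ i e ρe (trans (sym (τ₀-inv e′)) (cong τ₀ h))

    pU-colour : ∀ c → Orients c τ₀ → Orients c τ₁ → c (pU y) ≡ not (c y)
    pU-colour c c₀ c₁ = trans (c₀ e′) (trans (cong not (PU.pair-colour i e ρe c c₁ cρ)) (trans (Boolₚ.not-involutive _) (c₀ y)))
      where
      cρ : ∀ x → above i x ≡ x ⊎ c (above i x) ≡ not (c x)
      cρ x with above-cases i x
      ... | inj₁ h       = inj₁ h
      ... | inj₂ (h , _) = inj₂ (trans (cong c h) (c₀ x))

  returnU : Return τ₀ τ₂ ℓ pU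
  returnU = record
    { P-up  = λ u → down→up (proj₁ (pU-exit u))
    ; ℓ-P   = λ u → proj₂ (pU-exit u)
    ; P-inv = pU-inv
    ; P-fpf = pU-fpf }

  conn-level : ∀ {T x z} → Return τ₀ τ₂ ℓ T → Conn τ₁ (low T) x z → ℓ z ≡ ℓ x
  conn-level ret ε = refl
  conn-level ret (inj₁ refl ◅ c) = trans (conn-level ret c) (ℓ-τ₁ _)
  conn-level ret (inj₂ refl ◅ c) = trans (conn-level ret c) (Low.ℓ-low ret _)

  module _ {y : Fin N} (u : Up y) where

    private
      e = τ₀ y
      ρe : low τ₂ e ≡ e
      ρe = low-down τ₂ (up→down u)
      e′ = PQ.pair e

    pQ-conn : Conn τ₁ (low τ₂) (τ₀ y) (τ₀ (pQ y))
    pQ-conn = subst (Conn τ₁ (low τ₂) e) (sym (τ₀-inv _)) (PQ.pair-conn e ρe)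

    pQ-exit : Down e′
    pQ-exit = low-τ₂-fixed (PQ.pair-fixed e ρe)

    ℓ-pQ : ℓ (pQ y) ≡ ℓ y
    ℓ-pQ = ℕₚ.suc-injective (trans pQ-exit (trans (conn-level return-τ₂ (PQ.pair-conn e ρe)) u))

    pQ-unique : ∀ {w} → Down w → Conn τ₁ (low τ₂) (τ₀ y) w → ¬ w ≡ τ₀ y → pQ y ≡ τ₀ w
    pQ-unique {w} d c ≢ with PQ.pair-unique e ρe w (low-down τ₂ d) c
    ... | inj₁ h = contradiction h ≢
    ... | inj₂ h = cong τ₀ (sym h)

    pQ-inv : pQ (pQ y) ≡ y
    pQ-inv = trans (cong (τ₀ ∘ PQ.pair) (τ₀-inv e′)) (trans (cong τ₀ (PQ.pair-pair e ρe)) (τ₀-inv y))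

    pQ-fpf : ¬ pQ y ≡ y
    pQ-fpf h = PQ.pair-≢ e ρe (trans (sym (τ₀-inv e′)) (cong τ₀ h))

    pQ-colour : ∀ c → Orients c τ₀ → Orients c τ₁ → Orients c τ₂ → c (pQ y) ≡ not (c y)
    pQ-colour c c₀ c₁ c₂ = trans (c₀ e′) (trans (cong not (PQ.pair-colour e ρe c c₁ cρ)) (trans (Boolₚ.not-involutive _) (c₀ y)))
      where
      cρ : ∀ x → low τ₂ x ≡ x ⊎ c (low τ₂ x) ≡ not (c x)
      cρ x with adjacent x
      ... | inj₁ u        = inj₂ (trans (cong c (low-up τ₂ u)) (c₂ x))
      ... | inj₂ (inj₁ f) = inj₂ (trans (cong c (low-flat τ₂ f)) (c₀ x))
      ... | inj₂ (inj₂ d) = inj₁ (low-down τ₂ d)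

  returnQ : Return τ₀ τ₂ ℓ pQ
  returnQ = record
    { P-up  = λ u → down→up (pQ-exit u)
    ; ℓ-P   = ℓ-pQ
    ; P-inv = pQ-inv
    ; P-fpf = pQ-fpf }

  above-suc⇒above : ∀ {i x z} → Conn τ₁ (above (suc i)) x z → Conn τ₁ (above i) x z
  above-suc⇒above ε = ε
  above-suc⇒above (inj₁ e ◅ c) = inj₁ e ◅ above-suc⇒above c
  above-suc⇒above {i} {x} {z} (inj₂ refl ◅ c) with above-mono i x
  ... | inj₁ e = subst (λ w → Conn τ₁ (above i) w z) e (above-suc⇒above c)
  ... | inj₂ e = inj₂ e ◅ above-suc⇒above c

  -- The chords of P at level `suc i` abbreviate stretches of contour that stay above level i; only
  -- then can walks along `low P` be read as pieces of a face.
  Realised : (Fin N → Fin N) → ℕ → Set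
  Realised P i = ∀ {x} → Up x → ℓ x ≡ suc i → Conn τ₁ (above i) x (P x)

  excursion : ∀ {P i x} → Return τ₀ τ₂ ℓ P → Up x → ℓ x ≡ suc i →
    Conn τ₁ (above (suc i)) (τ₀ x) (τ₀ (P x)) → Conn τ₁ (above i) x (P x)
  excursion {P} {i} {x} ret u refl′ c =
    inj₂ (sym (above-in i<x i<τ₀x)) ◅ above-suc⇒above c ◅◅
    inj₂ (sym (trans (above-in i<τ₀Px (subst (λ w → i < ℓ w) (sym (τ₀-inv (P x))) i<Px)) (τ₀-inv (P x)))) ◅ ε
    where
    open Return ret
    i<x : i < ℓ x
    i<x = ℕₚ.≤-reflexive (sym refl′)
    i<τ₀x : i < ℓ (τ₀ x)
    i<τ₀x = subst (i <_) (sym u) (ℕₚ.m<n⇒m<1+n i<x)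
    i<Px : i < ℓ (P x)
    i<Px = subst (i <_) (sym (ℓ-P u)) i<x
    i<τ₀Px : i < ℓ (τ₀ (P x))
    i<τ₀Px = subst (i <_) (sym (P-up u)) (ℕₚ.m<n⇒m<1+n i<Px)

  low⇒above : ∀ {P i x z} → Return τ₀ τ₂ ℓ P → Realised P i → ℓ x ≡ suc i → Conn τ₁ (low P) x z → Conn τ₁ (above i) x z
  low⇒above ret real h ε = ε
  low⇒above ret real h (inj₁ refl ◅ c) = inj₁ refl ◅ low⇒above ret real (trans (ℓ-τ₁ _) h) c
  low⇒above {P} {i} {x} {z} ret real h (inj₂ refl ◅ c) with adjacent x
  ... | inj₁ u = real u h ◅◅ subst (λ w → Conn τ₁ (above i) w z) (low-up P u) rest
    where rest = low⇒above ret real (trans (Low.ℓ-low ret x) h) c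
  ... | inj₂ (inj₁ f) = inj₂ (trans (low-flat P f) (sym (above-in i<x (subst (i <_) (sym f) i<x)))) ◅ rest
    where
    rest = low⇒above ret real (trans (Low.ℓ-low ret x) h) c
    i<x : i < ℓ x
    i<x = ℕₚ.≤-reflexive (sym h)
  ... | inj₂ (inj₂ d) = subst (λ w → Conn τ₁ (above i) w z) (low-down P d) rest
    where rest = low⇒above ret real (trans (Low.ℓ-low ret x) h) c

  realised-pU : ∀ i → Realised pU i
  realised-pU i {x} u h = excursion returnU u h (subst (λ k → Conn τ₁ (above k) (τ₀ x) (τ₀ (pU x))) h (pU-conn u))

  above⇒face : ∀ {i x z} → Conn τ₁ (above i) x z → Conn τ₀ τ₁ x z
  above⇒face ε = ε
  above⇒face (inj₁ e ◅ c) = inj₂ e ◅ above⇒face c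
  above⇒face {i} {x} {z} (inj₂ refl ◅ c) with above-cases i x
  ... | inj₁ e       = subst (λ w → Conn τ₀ τ₁ w z) e (above⇒face c)
  ... | inj₂ (e , _) = inj₁ e ◅ above⇒face c

  face-equiv : IsEquivalence (Conn τ₀ τ₁)
  face-equiv = conn-equiv τ₀-inv τ₁-inv

  -- Chords of `pU` are stretches of contour, so every flag descends along its face, one exit and
  -- one level at a time, to level 1, where all flags are joined.
  desc⇒oneFace : Desc τ₁ pU → OneFace τ₁
  desc⇒oneFace (a , b) x y = let x′ , hx , cx = descend (ℕ.pred (ℓ x)) x (pos x) ; y′ , hy , cy = descend (ℕ.pred (ℓ y)) y (pos y) in
    cx ◅◅ level hx (a x′ y′ hx hy) ◅◅ IsEquivalence.sym face-equiv cy
    where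
    pos : ∀ x → ℓ x ≡ suc (ℕ.pred (ℓ x))
    pos x = sym (ℕₚ.suc-pred (ℓ x) {{ℕ.>-nonZero (positive x)}})
    level : ∀ {i x z} → ℓ x ≡ suc i → Conn τ₁ (low pU) x z → Conn τ₀ τ₁ x z
    level h c = above⇒face (low⇒above returnU (realised-pU _) h c)
    descend : ∀ k x → ℓ x ≡ suc k → ∃ λ z → ℓ z ≡ 1 × Conn τ₀ τ₁ x z
    descend zero    x h = x , h , ε
    descend (suc k) x h with b x (subst (2 ≤_) (sym h) (s≤s (s≤s z≤n)))
    ... | w , d , c with descend k (τ₀ w) (ℕₚ.suc-injective (trans d (trans (conn-level returnU c) h)))
    ...   | z , hz , c′ = z , hz , level h c ◅◅ inj₁ refl ◅ c′

  oneFace⇒desc : OneFace τ₁ → Desc τ₁ pU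
  oneFace⇒desc one = a , b
    where
    -- Following the face from x, either the level-ℓ x part of x is left downwards, or the current flag
    -- belongs to it or to an excursion above it.
    Down-from : Fin N → Set
    Down-from x = ∃ λ z → Down z × Conn τ₁ (low pU) x z
    Near : Fin N → Fin N → Set
    Near x w = Conn τ₁ (low pU) x w ⊎ (∃ λ y → Up y × Conn τ₁ (low pU) x y × Conn τ₁ (above (ℓ y)) (τ₀ y) w)
    follow : ∀ {x w z} → Near x w → Conn τ₀ τ₁ w z → Down-from x ⊎ Near x z
    follow n ε = inj₂ n
    follow (inj₁ c) (inj₂ refl ◅ p) = follow (inj₁ (c ◅◅ inj₁ refl ◅ ε)) p
    follow {w = w} (inj₁ c) (inj₁ refl ◅ p) with adjacent w
    ... | inj₁ u        = follow (inj₂ (w , u , c , ε)) p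
    ... | inj₂ (inj₁ f) = follow (inj₁ (c ◅◅ inj₂ (sym (low-flat pU f)) ◅ ε)) p
    ... | inj₂ (inj₂ d) = inj₁ (w , d , c)
    follow (inj₂ (y , u , c , e)) (inj₂ refl ◅ p) = follow (inj₂ (y , u , c , e ◅◅ inj₁ refl ◅ ε)) p
    follow {w = w} (inj₂ (y , u , c , e)) (inj₁ refl ◅ p) with above-cases (ℓ y) w
    ... | inj₂ (h , _) = follow (inj₂ (y , u , c , e ◅◅ inj₂ (sym h) ◅ ε)) p
    ... | inj₁ h with PU.pair-unique (ℓ y) (τ₀ y) (above-τ₀-up u) w h e
    ...   | inj₁ refl = follow (inj₁ (subst (Conn τ₁ (low pU) _) (sym (τ₀-inv y)) c)) p
    ...   | inj₂ refl = follow (inj₁ (c ◅◅ inj₂ (sym (low-up pU u)) ◅ ε)) p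
    near-level : ∀ {x w} → Near x w → ℓ x < ℓ w ⊎ Conn τ₁ (low pU) x w
    near-level (inj₁ c) = inj₂ c
    near-level {w = w} (inj₂ (y , u , c , e)) = inj₁ (subst (_< ℓ w) (conn-level returnU c)
      (conn-above (subst (ℓ y <_) (sym u) (ℕₚ.n<1+n _)) e))
    b : ∀ x → 2 ≤ ℓ x → Down-from x
    -- The face also visits a flag of level 1, below x, and no flag that is `Near x` lies there.
    b x h with follow (inj₁ ε) (one x (proj₁ lowest))
    ... | inj₁ d = d
    ... | inj₂ n with near-level n
    ...   | inj₁ l = contradiction (ℕₚ.≤-trans (s≤s h) l) (subst (λ k → ¬ 3 ≤ k) (sym (proj₂ lowest)) λ { (s≤s ()) })
    ...   | inj₂ c = contradiction (subst (2 ≤_) (trans (sym (conn-level returnU c)) (proj₂ lowest)) h) λ { (s≤s ()) }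
    a : ∀ x z → ℓ x ≡ 1 → ℓ z ≡ 1 → Conn τ₁ (low pU) x z
    a x z hx hz with follow (inj₁ ε) (one x z)
    ... | inj₁ (w , d , c) = contradiction (positive (τ₀ w))
            (subst (λ k → ¬ 1 ≤ k) (sym (ℕₚ.suc-injective (trans d (trans (conn-level returnU c) hx)))) λ ())
    ... | inj₂ n with near-level n
    ...   | inj₁ l = contradiction (trans hx (sym hz)) (ℕₚ.<⇒≢ l)
    ...   | inj₂ c = c

-- The two conjugations are mutually inverse

module ToQ {N : ℕ} {τ₀ τ₂ : Fin N → Fin N} {ℓ : Fin N → ℕ} (frame : Frame τ₀ τ₂ ℓ)
  {τ₁ : Fin N → Fin N} (gl : Gluing ℓ τ₁) {τ₁* : Fin N → Fin N} where
  open Framed frame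
  open Glued frame gl
  open Exchange frame returnU public
  module _ (conj : ∀ x → τ₁* x ≡ π (τ₁ (π x))) (gl* : Gluing ℓ τ₁*) where
    open Conjugate gl conj
    module G* = Glued frame gl*

    -- π carries the run of lower ends that defines `pQ` for the new gluing to a walk along `low pU`
    -- in the old one. Its chords are realised, so it is an excursion of the old contour, and the
    -- far end of a path is unique.
    pQ*≡pU : ∀ {y} → Up y → G*.pQ y ≡ pU y
    pQ*≡pU {y} u = sym (pU-unique u (above-exit (G*.ℓ-pQ u))
      (low⇒above returnU (realised-pU _) u (subst₂ (Conn τ₁ (low pU)) (π-down (up→down u)) (π-down (G*.pQ-exit u))
         (conn-from (subst (Conn τ₁* (low τ₂) (τ₀ y)) (τ₀-inv _) (G*.pQ-conn u)))))
      λ h → G*.pQ-fpf u (trans (cong τ₀ h) (τ₀-inv y)))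

module ToU {N : ℕ} {τ₀ τ₂ : Fin N → Fin N} {ℓ : Fin N → ℕ} (frame : Frame τ₀ τ₂ ℓ)
  {τ₁ : Fin N → Fin N} (gl : Gluing ℓ τ₁) {τ₁* : Fin N → Fin N} where
  open Framed frame
  open Glued frame gl
  open Exchange frame returnQ public
  module _ (conj : ∀ x → τ₁* x ≡ π (τ₁ (π x))) (gl* : Gluing ℓ τ₁*) where
    open Conjugate gl conj
    module G* = Glued frame gl*

    chord-path : ∀ {y} → Up y → Conn τ₁* (low pQ) (τ₀ y) (τ₀ (pQ y))
    chord-path {y} u = subst₂ (Conn τ₁* (low pQ)) (π-down (up→down u))
      (π-down (up→down (Return.P-up returnQ u))) (conn-to′ (pQ-conn u))

    -- Downward induction on the level: a chord at level `suc i` conjugates to a walk one level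
    -- higher, whose own chords must be realised before. Above level N there is no flag, which
    -- starts the induction.
    realised-pQ : ∀ fuel i → N ≤ fuel + i → G*.Realised pQ i
    realised-pQ zero i le {x} u h = contradiction (ℕₚ.≤-trans (bounded x) le) (subst (λ k → ¬ k ≤ i) (sym h) ℕₚ.1+n≰n)
    realised-pQ (suc fuel) i le {x} u h = G*.excursion returnQ u h
      (G*.low⇒above returnQ (realised-pQ fuel (suc i) (subst (N ≤_) (sym (ℕₚ.+-suc fuel i)) le)) (trans u (cong suc h)) (chord-path u))

    pU*≡pQ : ∀ {y} → Up y → G*.pU y ≡ pQ y
    pU*≡pQ {y} u = trans (G*.pU-unique u (G*.above-exit (trans (cong ℓ (τ₀-inv _)) (ℓ-pQ u)))
        (G*.low⇒above returnQ (realised-pQ N _ (ℕₚ.m≤m+n N _)) u (chord-path u))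
        λ h → pQ-fpf u (trans (sym (τ₀-inv _)) (trans (cong τ₀ h) (τ₀-inv y))))
      (τ₀-inv _)

-- From a layered gluing to a quadrangulation

-- The flag (x , true) is the upper end, and (x , false) the lower end, of a side x of a face;
-- ℓ x is the distance from the pointed vertex to the upper end.
module Sides {N : ℕ} (τ₀ τ₁ τ₂ : Fin N → Fin N) (ℓ : Fin N → ℕ) where

  open Directions τ₀ ℓ

  Flag : Set
  Flag = Fin N × Bool

  -- Around a square, a side x leading up is followed by `τ₀ x` at its upper end and by `τ₂ x` at
  -- its lower end; any other side has them the other way round. Crossing an edge of the
  -- quadrangulation is the gluing τ₁.
  T₀ T₁ T₂ : Flag → Flag
  T₀ (x , b) = x , not b
  T₂ (x , b) = τ₁ x , b
  T₁ (x , true) with up? x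
  ... | yes _ = τ₀ x , false
  ... | no _  = τ₂ x , true
  T₁ (x , false) with up? x | ℓ (τ₀ x) ℕ.≟ ℓ x
  ... | yes _ | _     = τ₂ x , false
  ... | no _  | yes _ = τ₀ x , false
  ... | no _  | no _  = τ₀ x , true

  ht : Flag → ℕ
  ht (x , true)  = ℓ x
  ht (x , false) = ℕ.pred (ℓ x)

  Vertex : Flag → Flag → Set
  Vertex = Conn T₁ T₂

module SideLaws {N : ℕ} {τ₀ τ₁ τ₂ : Fin N → Fin N} {ℓ : Fin N → ℕ} (frame : Frame τ₀ τ₂ ℓ) (gl : Gluing ℓ τ₁) where

  open Sides τ₀ τ₁ τ₂ ℓ public
  open Framed frame public
  open Gluing gl public
  open Glued frame gl using (pQ; pQ-conn; returnQ; low-τ₂-inv; ℓ-low-τ₂; conn-level; module PQ)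
  open Exchange frame returnQ using (κ)

  T₁-up-true : ∀ {x} → Up x → T₁ (x , true) ≡ (τ₀ x , false)
  T₁-up-true {x} u with up? x
  ... | yes _ = refl
  ... | no ¬u = contradiction u ¬u

  T₁-¬up-true : ∀ {x} → ¬ Up x → T₁ (x , true) ≡ (τ₂ x , true)
  T₁-¬up-true {x} ¬u with up? x
  ... | yes u = contradiction u ¬u
  ... | no _  = refl

  T₁-up-false : ∀ {x} → Up x → T₁ (x , false) ≡ (τ₂ x , false)
  T₁-up-false {x} u with up? x
  ... | yes _ = refl
  ... | no ¬u = contradiction u ¬u

  T₁-flat-false : ∀ {x} → ℓ (τ₀ x) ≡ ℓ x → T₁ (x , false) ≡ (τ₀ x , false)
  T₁-flat-false {x} f with up? x | ℓ (τ₀ x) ℕ.≟ ℓ x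
  ... | yes u | _     = contradiction u (¬flat-up f)
  ... | no _  | yes _ = refl
  ... | no _  | no ¬f = contradiction f ¬f

  T₁-down-false : ∀ {x} → Down x → T₁ (x , false) ≡ (τ₀ x , true)
  T₁-down-false {x} d with up? x | ℓ (τ₀ x) ℕ.≟ ℓ x
  ... | yes u | _     = contradiction u (¬up-down d)
  ... | no _  | yes f = contradiction d (¬flat-down f)
  ... | no _  | no _  = refl

  flat-τ₀ : ∀ {x} → ℓ (τ₀ x) ≡ ℓ x → ℓ (τ₀ (τ₀ x)) ≡ ℓ (τ₀ x)
  flat-τ₀ {x} f = trans (cong ℓ (τ₀-inv x)) (sym f)

  flat-τ₂ : ∀ {x} → ℓ (τ₀ x) ≡ ℓ x → ℓ (τ₀ (τ₂ x)) ≡ ℓ (τ₂ x)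
  flat-τ₂ {x} f = trans (cong ℓ (comm x)) (trans (ℓ-τ₂ _) (trans f (sym (ℓ-τ₂ x))))

  down-τ₂ : ∀ {x} → Down x → Down (τ₂ x)
  down-τ₂ {x} d = trans (cong (suc ∘ ℓ) (comm x)) (trans (cong suc (ℓ-τ₂ _)) (trans d (sym (ℓ-τ₂ x))))

  T₀-inv : ∀ a → T₀ (T₀ a) ≡ a
  T₀-inv (x , b) = cong (x ,_) (Boolₚ.not-involutive b)

  T₀-fpf : ∀ a → ¬ T₀ a ≡ a
  T₀-fpf (x , true)  ()
  T₀-fpf (x , false) ()

  T₂-inv : ∀ a → T₂ (T₂ a) ≡ a
  T₂-inv (x , b) = cong (_, b) (τ₁-inv x)

  T₂-fpf : ∀ a → ¬ T₂ a ≡ a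
  T₂-fpf (x , b) h = τ₁-fpf x (cong proj₁ h)

  T₀T₂-fpf : ∀ a → ¬ T₀ (T₂ a) ≡ a
  T₀T₂-fpf (x , true)  ()
  T₀T₂-fpf (x , false) ()

  T₁-inv : ∀ a → T₁ (T₁ a) ≡ a
  T₁-inv (x , true) = by-dir (adjacent x)
    where
    top : ¬ Up x → T₁ (T₁ (x , true)) ≡ (x , true)
    top ¬u = trans (cong T₁ (T₁-¬up-true ¬u)) (trans (T₁-¬up-true (¬up-τ₂ ¬u)) (cong (_, true) (τ₂-inv x)))
    by-dir : Up x ⊎ ℓ (τ₀ x) ≡ ℓ x ⊎ Down x → T₁ (T₁ (x , true)) ≡ (x , true)
    by-dir (inj₁ u)        = trans (cong T₁ (T₁-up-true u)) (trans (T₁-down-false (up→down u)) (cong (_, true) (τ₀-inv x)))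
    by-dir (inj₂ (inj₁ f)) = top (¬flat-up f)
    by-dir (inj₂ (inj₂ d)) = top (¬up-down d)
  T₁-inv (x , false) = by-dir (adjacent x)
    where
    by-dir : Up x ⊎ ℓ (τ₀ x) ≡ ℓ x ⊎ Down x → T₁ (T₁ (x , false)) ≡ (x , false)
    by-dir (inj₁ u)        = trans (cong T₁ (T₁-up-false u)) (trans (T₁-up-false (up-τ₂ u)) (cong (_, false) (τ₂-inv x)))
    by-dir (inj₂ (inj₁ f)) = trans (cong T₁ (T₁-flat-false f)) (trans (T₁-flat-false (flat-τ₀ f)) (cong (_, false) (τ₀-inv x)))
    by-dir (inj₂ (inj₂ d)) = trans (cong T₁ (T₁-down-false d)) (trans (T₁-up-true (down→up d)) (cong (_, false) (τ₀-inv x)))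

  T₁-fpf : ∀ a → ¬ T₁ a ≡ a
  T₁-fpf (x , true) h with adjacent x
  ... | inj₁ u        = contradiction (trans (sym (cong proj₂ (T₁-up-true u))) (cong proj₂ h)) λ ()
  ... | inj₂ (inj₁ f) = τ₂-fpf x (trans (sym (cong proj₁ (T₁-¬up-true (¬flat-up f)))) (cong proj₁ h))
  ... | inj₂ (inj₂ d) = τ₂-fpf x (trans (sym (cong proj₁ (T₁-¬up-true (¬up-down d)))) (cong proj₁ h))
  T₁-fpf (x , false) h with adjacent x
  ... | inj₁ u        = τ₂-fpf x (trans (sym (cong proj₁ (T₁-up-false u))) (cong proj₁ h))
  ... | inj₂ (inj₁ f) = τ₀-fpf x (trans (sym (cong proj₁ (T₁-flat-false f))) (cong proj₁ h))
  ... | inj₂ (inj₂ d) = τ₀-fpf x (trans (sym (cong proj₁ (T₁-down-false d))) (cong proj₁ h))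

  suc-pred-ℓ : ∀ x → suc (ℕ.pred (ℓ x)) ≡ ℓ x
  suc-pred-ℓ x = ℕₚ.suc-pred (ℓ x) {{ℕ.>-nonZero (positive x)}}

  ht-T₁ : ∀ a → ht (T₁ a) ≡ ht a
  ht-T₁ (x , true) with adjacent x
  ... | inj₁ u        = trans (cong ht (T₁-up-true u)) (cong ℕ.pred u)
  ... | inj₂ (inj₁ f) = trans (cong ht (T₁-¬up-true (¬flat-up f))) (ℓ-τ₂ x)
  ... | inj₂ (inj₂ d) = trans (cong ht (T₁-¬up-true (¬up-down d))) (ℓ-τ₂ x)
  ht-T₁ (x , false) with adjacent x
  ... | inj₁ u        = trans (cong ht (T₁-up-false u)) (cong ℕ.pred (ℓ-τ₂ x))
  ... | inj₂ (inj₁ f) = trans (cong ht (T₁-flat-false f)) (cong ℕ.pred f)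
  ... | inj₂ (inj₂ d) = trans (cong ht (T₁-down-false d)) (cong ℕ.pred d)

  ht-T₂ : ∀ a → ht (T₂ a) ≡ ht a
  ht-T₂ (x , true)  = ℓ-τ₁ x
  ht-T₂ (x , false) = cong ℕ.pred (ℓ-τ₁ x)

  ht-vertex : ∀ {a b} → Vertex a b → ht b ≡ ht a
  ht-vertex ε = refl
  ht-vertex {a} (inj₁ refl ◅ c) = trans (ht-vertex c) (ht-T₁ a)
  ht-vertex {a} (inj₂ refl ◅ c) = trans (ht-vertex c) (ht-T₂ a)

  vertex-equiv : IsEquivalence Vertex
  vertex-equiv = conn-equiv T₁-inv T₂-inv

  low⇒vertex : ∀ {x y} → Conn τ₁ (low τ₂) x y → Vertex (x , false) (y , false)
  low⇒vertex ε = ε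
  low⇒vertex (inj₁ refl ◅ c) = inj₂ refl ◅ low⇒vertex c
  low⇒vertex {x} {y} (inj₂ refl ◅ c) with adjacent x
  ... | inj₁ u        = inj₁ (trans (cong (_, false) (low-up τ₂ u)) (sym (T₁-up-false u))) ◅ low⇒vertex c
  ... | inj₂ (inj₁ f) = inj₁ (trans (cong (_, false) (low-flat τ₂ f)) (sym (T₁-flat-false f))) ◅ low⇒vertex c
  ... | inj₂ (inj₂ d) = subst (λ z → Vertex (z , false) (y , false)) (low-down τ₂ d) (low⇒vertex c)

  -- T₁ takes a lower end to an upper end exactly at a flag leading down. A turn around a vertex
  -- thus stays among lower ends or passes such a flag.
  vertex⇒low : ∀ {x w a b} → Conn τ₁ (low τ₂) x w → b ≡ (w , false) → Vertex b a →
    (∃ λ z → Down z × Conn τ₁ (low τ₂) x z) ⊎ (∃ λ z → a ≡ (z , false) × Conn τ₁ (low τ₂) x z)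
  vertex⇒low c refl ε = inj₂ (_ , refl , c)
  vertex⇒low c refl (inj₂ refl ◅ v) = vertex⇒low (c ◅◅ inj₁ refl ◅ ε) refl v
  vertex⇒low {w = w} c refl (inj₁ refl ◅ v) with adjacent w
  ... | inj₁ u        = vertex⇒low (c ◅◅ inj₂ (sym (low-up τ₂ u)) ◅ ε) (T₁-up-false u) v
  ... | inj₂ (inj₁ f) = vertex⇒low (c ◅◅ inj₂ (sym (low-flat τ₂ f)) ◅ ε) (T₁-flat-false f) v
  ... | inj₂ (inj₂ d) = inj₁ (w , d , c)

  -- Between upper ends T₁ is τ₂, except at a side leading up, where a run of lower ends intervenes;
  -- `pQ` jumps over that run.
  κ⇒vertex : ∀ {x y} → Conn τ₁ κ x y → Vertex (x , true) (y , true)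
  κ⇒vertex ε = ε
  κ⇒vertex (inj₁ refl ◅ c) = inj₂ refl ◅ κ⇒vertex c
  κ⇒vertex {x} {y} (inj₂ refl ◅ c) with κ⇒vertex c
  ... | v with adjacent x
  ...   | inj₁ u = inj₁ (sym (T₁-up-true u)) ◅ low⇒vertex (pQ-conn u) ◅◅
            inj₁ (sym (trans (T₁-down-false (up→down (Return.P-up returnQ u))) (cong (_, true) (τ₀-inv _)))) ◅
            subst (λ z → Vertex (z , true) (y , true)) (turn-up-up pQ u) v
  ...   | inj₂ (inj₁ f) = inj₁ (trans (cong (_, true) (turn-up-¬up pQ (¬flat-up f))) (sym (T₁-¬up-true (¬flat-up f)))) ◅ v
  ...   | inj₂ (inj₂ d) = inj₁ (trans (cong (_, true) (turn-up-¬up pQ (¬up-down d))) (sym (T₁-¬up-true (¬up-down d)))) ◅ v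

  -- Walking around a vertex, the lower ends met between two upper ends form a path of (τ₁ , low τ₂).
  Around : Fin N → Flag → Set
  Around x (w , true)  = Conn τ₁ κ x w
  Around x (w , false) = ∃ λ y → Up y × Conn τ₁ κ x y × Conn τ₁ (low τ₂) (τ₀ y) w

  around-T₁ : ∀ {x} a → Around x a → Around x (T₁ a)
  around-T₁ {x} (w , true) c = by-dir (adjacent w)
    where
    top : ¬ Up w → Around x (T₁ (w , true))
    top ¬u = subst (Around x) (sym (T₁-¬up-true ¬u)) (c ◅◅ inj₂ (sym (turn-up-¬up pQ ¬u)) ◅ ε)
    by-dir : Up w ⊎ ℓ (τ₀ w) ≡ ℓ w ⊎ Down w → Around x (T₁ (w , true))
    by-dir (inj₁ u)        = subst (Around x) (sym (T₁-up-true u)) (w , u , c , ε)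
    by-dir (inj₂ (inj₁ f)) = top (¬flat-up f)
    by-dir (inj₂ (inj₂ d)) = top (¬up-down d)
  around-T₁ {x} (w , false) (y , u , c , e) with adjacent w
  ... | inj₁ uw       = subst (Around x) (sym (T₁-up-false uw)) (y , u , c , e ◅◅ inj₂ (sym (low-up τ₂ uw)) ◅ ε)
  ... | inj₂ (inj₁ f) = subst (Around x) (sym (T₁-flat-false f)) (y , u , c , e ◅◅ inj₂ (sym (low-flat τ₂ f)) ◅ ε)
  ... | inj₂ (inj₂ d) with PQ.pair-unique (τ₀ y) (low-down τ₂ (up→down u)) w (low-down τ₂ d) e
  ...   | inj₁ refl = subst (Around x) (sym (T₁-down-false d)) (subst (Conn τ₁ κ x) (sym (τ₀-inv y)) c)
  ...   | inj₂ refl = subst (Around x) (sym (T₁-down-false d)) (c ◅◅ inj₂ (sym (turn-up-up pQ u)) ◅ ε)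

  vertex⇒κ : ∀ {x y} → Vertex (x , true) (y , true) → Conn τ₁ κ x y
  vertex⇒κ {x} = go ε
    where
    go : ∀ {a b} → Around x a → Vertex a b → Around x b
    go r ε = r
    go {a} r (inj₁ refl ◅ v) = go (around-T₁ a r) v
    go {w , true}  r (inj₂ refl ◅ v) = go (r ◅◅ inj₁ refl ◅ ε) v
    go {w , false} (y , u , c , e) (inj₂ refl ◅ v) = go (y , u , c , e ◅◅ inj₁ refl ◅ ε) v

  module Descending (desc : Desc τ₁ τ₂) where

    top : ∀ a → 1 ≤ ht a → ∃ λ y → Vertex a (y , true)
    top (x , true)  _ = x , ε
    top (x , false) h with proj₂ desc x (subst (2 ≤_) (suc-pred-ℓ x) (s≤s h))
    ... | z , d , c = τ₀ z , low⇒vertex c ◅◅ inj₁ (sym (T₁-down-false d)) ◅ ε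

    bottom : ∀ a b → ht a ≡ 0 → ht b ≡ 0 → Vertex a b
    bottom (x , true)  _ h _ = contradiction (positive x) (subst (λ k → ¬ 1 ≤ k) (sym h) λ ())
    bottom (x , false) (y , true) _ h = contradiction (positive y) (subst (λ k → ¬ 1 ≤ k) (sym h) λ ())
    bottom (x , false) (y , false) h h′ = low⇒vertex
      (proj₁ desc x y (trans (sym (suc-pred-ℓ x)) (cong suc h)) (trans (sym (suc-pred-ℓ y)) (cong suc h′)))

  rotF : Flag → Flag
  rotF a = T₁ (T₀ a)

  rotF-inj : ∀ {a b} → rotF a ≡ rotF b → a ≡ b
  rotF-inj {a} {b} h = trans (sym (back a)) (trans (cong (T₀ ∘ T₁) h) (back b))
    where
    back : ∀ a → T₀ (T₁ (rotF a)) ≡ a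
    back a = trans (cong T₀ (T₁-inv (T₀ a))) (T₀-inv a)

  four-steps : ∀ {a b c d} → rotF a ≡ b → rotF b ≡ c → rotF c ≡ d → rotF d ≡ a → ¬ c ≡ a →
    iter rotF 4 a ≡ a × ¬ iter rotF 2 a ≡ a
  four-steps refl refl refl h ≢ = h , ≢

  four-shift : ∀ {a} → iter rotF 4 a ≡ a × ¬ iter rotF 2 a ≡ a → iter rotF 4 (rotF a) ≡ rotF a × ¬ iter rotF 2 (rotF a) ≡ rotF a
  four-shift (h , ≢) = cong rotF h , λ h′ → ≢ (rotF-inj h′)

  module _ {x : Fin N} (u : Up x) where

    private
      r₁ : rotF (x , true) ≡ (τ₂ x , false)
      r₁ = T₁-up-false u
      r₂ : rotF (τ₂ x , false) ≡ (τ₀ (τ₂ x) , false)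
      r₂ = T₁-up-true (up-τ₂ u)
      r₃ : rotF (τ₀ (τ₂ x) , false) ≡ (τ₀ x , true)
      r₃ = trans (T₁-¬up-true (¬up-down (up→down (up-τ₂ u))))
             (cong (_, true) (trans (cong τ₂ (comm x)) (τ₂-inv _)))
      r₄ : rotF (τ₀ x , true) ≡ (x , true)
      r₄ = trans (T₁-down-false (up→down u)) (cong (_, true) (τ₀-inv x))
      s₁ : rotF (x , false) ≡ (τ₀ x , false)
      s₁ = T₁-up-true u
      s₂ : rotF (τ₀ x , false) ≡ (τ₂ (τ₀ x) , true)
      s₂ = T₁-¬up-true (¬up-down (up→down u))
      s₃ : rotF (τ₂ (τ₀ x) , true) ≡ (τ₂ x , true)
      s₃ = trans (T₁-down-false (down-τ₂ (up→down u))) (cong (_, true) (trans (comm _) (cong τ₂ (τ₀-inv x))))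
      s₄ : rotF (τ₂ x , true) ≡ (x , false)
      s₄ = trans (T₁-up-false (up-τ₂ u)) (cong (_, false) (τ₂-inv x))

    square-up : ∀ b → iter rotF 4 (x , b) ≡ (x , b) × ¬ iter rotF 2 (x , b) ≡ (x , b)
    square-up true  = four-steps r₁ r₂ r₃ r₄ λ ()
    square-up false = four-steps s₁ s₂ s₃ s₄ λ ()

    square-τ₀-up : ∀ b → iter rotF 4 (τ₀ x , b) ≡ (τ₀ x , b) × ¬ iter rotF 2 (τ₀ x , b) ≡ (τ₀ x , b)
    square-τ₀-up true  = subst (λ a → iter rotF 4 a ≡ a × ¬ iter rotF 2 a ≡ a)
      (trans (cong (rotF ∘ rotF) r₁) (trans (cong rotF r₂) r₃)) (four-shift (four-shift (four-shift (square-up true))))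
    square-τ₀-up false = subst (λ a → iter rotF 4 a ≡ a × ¬ iter rotF 2 a ≡ a) s₁ (four-shift (square-up false))

  -- The period of `rotF` at a divides 4 but not 2, so it is exactly 4: this is face degree 4.
  square : ∀ a → iter rotF 4 a ≡ a × ¬ iter rotF 2 a ≡ a
  square (x , b) with adjacent x
  ... | inj₁ u        = square-up u b
  ... | inj₂ (inj₂ d) = subst (λ y → iter rotF 4 (y , b) ≡ (y , b) × ¬ iter rotF 2 (y , b) ≡ (y , b)) (τ₀-inv x) (square-τ₀-up (down→up d) b)
  square (x , true) | inj₂ (inj₁ f) = four-steps {c = τ₂ (τ₀ x) , true} (T₁-flat-false f) (T₁-¬up-true (¬flat-up (flat-τ₀ f)))
      (T₁-flat-false (flat-τ₂ (flat-τ₀ f)))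
      (trans (T₁-¬up-true (subst (λ y → ¬ Up y) (sym e) (¬up-τ₂ (¬flat-up f)))) (cong (_, true) (trans (cong τ₂ e) (τ₂-inv x))))
      (λ h → τ₀τ₂-fpf x (trans (comm x) (cong proj₁ h)))
    where
    e : τ₀ (τ₂ (τ₀ x)) ≡ τ₂ x
    e = trans (comm _) (cong τ₂ (τ₀-inv x))
  square (x , false) | inj₂ (inj₁ f) = four-steps {c = τ₀ (τ₂ x) , false} (T₁-¬up-true (¬flat-up f)) (T₁-flat-false (flat-τ₂ f))
      (trans (T₁-¬up-true (¬flat-up (flat-τ₀ (flat-τ₂ f)))) (cong (_, true) e))
      (trans (T₁-flat-false (flat-τ₀ f)) (cong (_, false) (τ₀-inv x)))
      (λ h → τ₀τ₂-fpf x (cong proj₁ h))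
    where
    e : τ₂ (τ₀ (τ₂ x)) ≡ τ₀ x
    e = trans (cong τ₂ (comm x)) (τ₂-inv _)

  Face : Flag → Flag → Set
  Face = Conn T₀ T₁

  face⇒edge : ∀ {a b} → Face a b → Conn τ₀ τ₂ (proj₁ a) (proj₁ b)
  face⇒edge ε = ε
  face⇒edge (inj₁ refl ◅ c) = face⇒edge c
  face⇒edge {x , true} {b} (inj₂ refl ◅ c) with up? x
  ... | yes _ = inj₁ refl ◅ face⇒edge c
  ... | no _  = inj₂ refl ◅ face⇒edge c
  face⇒edge {x , false} (inj₂ refl ◅ c) with up? x | ℓ (τ₀ x) ℕ.≟ ℓ x
  ... | yes _ | _     = inj₂ refl ◅ face⇒edge c
  ... | no _  | yes _ = inj₁ refl ◅ face⇒edge c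
  ... | no _  | no _  = inj₁ refl ◅ face⇒edge c

  edge⇒face : ∀ {x y} → Conn τ₀ τ₂ x y → Face (x , true) (y , true)
  edge⇒face ε = ε
  edge⇒face {x} {y} (inj₁ refl ◅ c) = hop (adjacent x) ◅◅ edge⇒face c
    where
    hop : Up x ⊎ ℓ (τ₀ x) ≡ ℓ x ⊎ Down x → Face (x , true) (τ₀ x , true)
    hop (inj₁ u)        = inj₂ (sym (T₁-up-true u)) ◅ inj₁ refl ◅ ε
    hop (inj₂ (inj₁ f)) = inj₁ refl ◅ inj₂ (sym (T₁-flat-false f)) ◅ inj₁ refl ◅ ε
    hop (inj₂ (inj₂ d)) = inj₁ refl ◅ inj₂ (sym (T₁-down-false d)) ◅ ε
  edge⇒face {x} {y} (inj₂ refl ◅ c) = hop (up? x) ◅◅ edge⇒face c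
    where
    hop : Dec (Up x) → Face (x , true) (τ₂ x , true)
    hop (yes u) = inj₁ refl ◅ inj₂ (sym (T₁-up-false u)) ◅ inj₁ refl ◅ ε
    hop (no ¬u) = inj₂ (sym (T₁-¬up-true ¬u)) ◅ ε

-- Labelled structures on Fin N

module _ {N : ℕ} {τ₀ τ₂ : Fin N → Fin N} {ℓ : Fin N → ℕ} (frame frame′ : Frame τ₀ τ₂ ℓ) where

  private
    module A = Framed frame
    module B = Framed frame′

  turn-up-cong : ∀ {P P′} → (∀ {y} → A.Up y → P y ≡ P′ y) → ∀ x → A.turn-up P τ₂ x ≡ A.turn-up P′ τ₂ x
  turn-up-cong e x with A.up? x
  ... | yes u = e u
  ... | no _  = refl

  -- `turn-up` consults P on flags leading up only. Agreement there gives equal tables, hence the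
  -- same π.
  exchange-cong : ∀ {P P′} (ret : Return τ₀ τ₂ ℓ P) (ret′ : Return τ₀ τ₂ ℓ P′) → (∀ {y} → A.Up y → P y ≡ P′ y) →
    ∀ x → Exchange.π frame ret x ≡ Exchange.π frame′ ret′ x
  exchange-cong ret ret′ e = swap-cong (Vecₚ.tabulate-cong (turn-up-cong e)) _ _ _ _ _ _ _ _

  module _ {τ₁ : Fin N → Fin N} (gl gl′ : Gluing ℓ τ₁) where

    private
      module C = Glued frame gl
      module D = Glued frame′ gl′

    -- `pair` is computed from proofs of the laws, but a path has only one other end, whichever
    -- proofs were used to find it.
    pU-irrelevant : ∀ {y} → A.Up y → C.pU y ≡ D.pU y
    pU-irrelevant {y} u = trans (C.pU-unique u (A.above-out (subst (λ z → ¬ ℓ y < z) (sym (trans (cong ℓ (A.τ₀-inv _)) (Return.ℓ-P D.returnU u))) (ℕₚ.<-irrefl refl)))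
      (D.pU-conn u) λ h → D.pU-fpf u (trans (sym (A.τ₀-inv _)) (trans (cong τ₀ h) (A.τ₀-inv y)))) (A.τ₀-inv _)

    pQ-irrelevant : ∀ {y} → A.Up y → C.pQ y ≡ D.pQ y
    pQ-irrelevant {y} u = trans (C.pQ-unique u (A.up→down (Return.P-up D.returnQ u)) (D.pQ-conn u)
      λ h → D.pQ-fpf u (trans (sym (A.τ₀-inv _)) (trans (cong τ₀ h) (A.τ₀-inv y)))) (A.τ₀-inv _)

vec-ext : ∀ {A : Set} {n} {x y : Vec A n} → (∀ i → lookup x i ≡ lookup y i) → x ≡ y
vec-ext {x = x} {y} h = trans (sym (Vecₚ.tabulate∘lookup x)) (trans (Vecₚ.tabulate-cong h) (Vecₚ.tabulate∘lookup y))

-- Tables rather than functions: equality is decidable and all structures of a given size can be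
-- listed.
record Str (N : ℕ) : Set where
  constructor mk
  field
    v₀ v₁ v₂ : Vec (Fin N) N
    lv       : Vec (Fin (suc N)) N
    root     : Fin N
  τ₀ τ₁ τ₂ : Fin N → Fin N
  τ₀ = lookup v₀
  τ₁ = lookup v₁
  τ₂ = lookup v₂
  ℓ : Fin N → ℕ
  ℓ x = toℕ (lookup lv x)

module _ {N : ℕ} where

  open Str

  IsFramed IsGlued Pre : Str N → Set
  IsFramed s = Frame (τ₀ s) (τ₂ s) (ℓ s)
  IsGlued s  = Gluing (ℓ s) (τ₁ s)
  Pre s      = IsFramed s × IsGlued s

  str-ext : ∀ {s s′ : Str N} → (∀ x → τ₀ s x ≡ τ₀ s′ x) → (∀ x → τ₁ s x ≡ τ₁ s′ x) → (∀ x → τ₂ s x ≡ τ₂ s′ x) →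
    (∀ x → ℓ s x ≡ ℓ s′ x) → root s ≡ root s′ → s ≡ s′
  str-ext {mk a b c d r} {mk a′ b′ c′ d′ r′} e₀ e₁ e₂ eℓ refl
    with refl ← vec-ext {x = a} {a′} e₀ | refl ← vec-ext {x = b} {b′} e₁ | refl ← vec-ext {x = c} {c′} e₂
       | refl ← vec-ext {x = d} {d′} (λ x → Finₚ.toℕ-injective (eℓ x)) = refl

  frame? : ∀ s → Dec (IsFramed s)
  frame? s = map′
    (λ (a , b , c , d , e , f , g , h , i , j) → record
      { τ₀-inv = a ; τ₂-inv = b ; τ₀-fpf = c ; τ₂-fpf = d ; comm = e ; τ₀τ₂-fpf = f ; ℓ-τ₂ = g ; adjacent = h
      ; positive = i ; bounded = λ x → ℕₚ.≤-pred (Finₚ.toℕ<n (lookup (lv s) x)) ; lowest = j })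
    (λ fr → let open Frame fr in τ₀-inv , τ₂-inv , τ₀-fpf , τ₂-fpf , comm , τ₀τ₂-fpf , ℓ-τ₂ , adjacent , positive , lowest)
    (Finₚ.all? (λ x → τ₀ s (τ₀ s x) Finₚ.≟ x) ×-dec
     Finₚ.all? (λ x → τ₂ s (τ₂ s x) Finₚ.≟ x) ×-dec
     Finₚ.all? (λ x → ¬? (τ₀ s x Finₚ.≟ x)) ×-dec
     Finₚ.all? (λ x → ¬? (τ₂ s x Finₚ.≟ x)) ×-dec
     Finₚ.all? (λ x → τ₀ s (τ₂ s x) Finₚ.≟ τ₂ s (τ₀ s x)) ×-dec
     Finₚ.all? (λ x → ¬? (τ₀ s (τ₂ s x) Finₚ.≟ x)) ×-dec
     Finₚ.all? (λ x → ℓ s (τ₂ s x) ℕ.≟ ℓ s x) ×-dec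
     Finₚ.all? (λ x → (ℓ s (τ₀ s x) ℕ.≟ suc (ℓ s x)) ⊎-dec (ℓ s (τ₀ s x) ℕ.≟ ℓ s x) ⊎-dec (suc (ℓ s (τ₀ s x)) ℕ.≟ ℓ s x)) ×-dec
     Finₚ.all? (λ x → 1 ℕ.≤? ℓ s x) ×-dec
     Finₚ.any? (λ x → ℓ s x ℕ.≟ 1))

  gluing? : ∀ s → Dec (IsGlued s)
  gluing? s = map′
    (λ (a , b , c) → record { τ₁-inv = a ; τ₁-fpf = b ; ℓ-τ₁ = c })
    (λ gl → let open Gluing gl in τ₁-inv , τ₁-fpf , ℓ-τ₁)
    (Finₚ.all? (λ x → τ₁ s (τ₁ s x) Finₚ.≟ x) ×-dec
     Finₚ.all? (λ x → ¬? (τ₁ s x Finₚ.≟ x)) ×-dec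
     Finₚ.all? (λ x → ℓ s (τ₁ s x) ℕ.≟ ℓ s x))

  opaque
    pre? : ∀ s → Dec (Pre s)
    pre? s = frame? s ×-dec gluing? s

  reglue : (Fin N → Fin N) → Str N → Str N
  reglue π s = record s { v₁ = tabulate (π ∘ τ₁ s ∘ π) }

  πU πQ : ∀ s → Pre s → Fin N → Fin N
  πU s (fr , gl) = ToQ.π fr gl {τ₁ s}
  πQ s (fr , gl) = ToU.π fr gl {τ₁ s}

  F₀ G₀ : ∀ s → Dec (Pre s) → Str N
  F₀ s (yes p) = reglue (πU s p) s
  F₀ s (no _)  = s
  G₀ s (yes p) = reglue (πQ s p) s
  G₀ s (no _)  = s

  -- F turns one-face structures into quadrangulations with a single local minimum; G is its inverse.
  F G : Str N → Str N
  F s = F₀ s (pre? s)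
  G s = G₀ s (pre? s)

  module _ (s : Str N) (p : Pre s) where

    open Framed (proj₁ p)

    conjU : ∀ x → lookup (tabulate (πU s p ∘ τ₁ s ∘ πU s p)) x ≡ πU s p (τ₁ s (πU s p x))
    conjU = Vecₚ.lookup∘tabulate _

    conjQ : ∀ x → lookup (tabulate (πQ s p ∘ τ₁ s ∘ πQ s p)) x ≡ πQ s p (τ₁ s (πQ s p x))
    conjQ = Vecₚ.lookup∘tabulate _

    preU : Pre (reglue (πU s p) s)
    preU = proj₁ p , Exchange.Conjugate.gluing* (proj₁ p) (Glued.returnU (proj₁ p) (proj₂ p)) (proj₂ p) conjU

    preQ : Pre (reglue (πQ s p) s)
    preQ = proj₁ p , Exchange.Conjugate.gluing* (proj₁ p) (Glued.returnQ (proj₁ p) (proj₂ p)) (proj₂ p) conjQ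

  reglue-inverse : ∀ s {π π′} → (∀ x → π (π x) ≡ x) → (∀ x → π′ x ≡ π x) → reglue π′ (reglue π s) ≡ s
  reglue-inverse s {π} {π′} ππ e = str-ext (λ _ → refl)
    (λ x → trans (Vecₚ.lookup∘tabulate _ x) (trans (e _) (trans (cong π (trans (Vecₚ.lookup∘tabulate (π ∘ τ₁ s ∘ π) (π′ x))
       (cong (π ∘ τ₁ s) (trans (cong π (e x)) (ππ x))))) (ππ _))))
    (λ _ → refl) (λ _ → refl) refl

  -- The matching `pQ` of the reglued structure is the `pU` that produced it. Both exchanges are
  -- therefore the same involution, and applying it twice restores τ₁.
  πQ-reglue : ∀ s p q x → πQ (reglue (πU s p) s) q x ≡ πU s p x
  πQ-reglue s p q = exchange-cong (proj₁ q) (proj₁ p) (Glued.returnQ (proj₁ q) (proj₂ q)) (Glued.returnU (proj₁ p) (proj₂ p))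
    λ u → trans (pQ-irrelevant (proj₁ q) (proj₁ p) (proj₂ q) (proj₂ (preU s p)) u)
            (ToQ.pQ*≡pU (proj₁ p) (proj₂ p) (conjU s p) (proj₂ (preU s p)) u)

  πU-reglue : ∀ s p q x → πU (reglue (πQ s p) s) q x ≡ πQ s p x
  πU-reglue s p q = exchange-cong (proj₁ q) (proj₁ p) (Glued.returnU (proj₁ q) (proj₂ q)) (Glued.returnQ (proj₁ p) (proj₂ p))
    λ u → trans (pU-irrelevant (proj₁ q) (proj₁ p) (proj₂ q) (proj₂ (preQ s p)) u)
            (ToU.pU*≡pQ (proj₁ p) (proj₂ p) (conjQ s p) (proj₂ (preQ s p)) u)

  G₀F₀ : ∀ s p d → G₀ (reglue (πU s p) s) d ≡ s
  G₀F₀ s p (yes q) = reglue-inverse s (ToQ.π-inv (proj₁ p) (proj₂ p) {τ₁ s}) (πQ-reglue s p q)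
  G₀F₀ s p (no ¬q) = contradiction (preU s p) ¬q

  F₀G₀ : ∀ s p d → F₀ (reglue (πQ s p) s) d ≡ s
  F₀G₀ s p (yes q) = reglue-inverse s (ToU.π-inv (proj₁ p) (proj₂ p) {τ₁ s}) (πU-reglue s p q)
  F₀G₀ s p (no ¬q) = contradiction (preQ s p) ¬q

  GF≡ : ∀ s → Pre s → G (F s) ≡ s
  GF≡ s p = go (pre? s)
    where
    go : ∀ d → G (F₀ s d) ≡ s
    go (yes q) = G₀F₀ s q (pre? (reglue (πU s q) s))
    go (no ¬p) = contradiction p ¬p

  FG≡ : ∀ s → Pre s → F (G s) ≡ s
  FG≡ s p = go (pre? s)
    where
    go : ∀ d → F (G₀ s d) ≡ s
    go (yes q) = F₀G₀ s q (pre? (reglue (πQ s q) s))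
    go (no ¬p) = contradiction p ¬p

  F-spec : ∀ s → Pre s → Σ (Pre s) λ q → F s ≡ reglue (πU s q) s
  F-spec s p = go (pre? s)
    where
    go : ∀ d → Σ (Pre s) λ q → F₀ s d ≡ reglue (πU s q) s
    go (yes q) = q , refl
    go (no ¬p) = contradiction p ¬p

  G-spec : ∀ s → Pre s → Σ (Pre s) λ q → G s ≡ reglue (πQ s q) s
  G-spec s p = go (pre? s)
    where
    go : ∀ d → Σ (Pre s) λ q → G₀ s d ≡ reglue (πQ s q) s
    go (yes q) = q , refl
    go (no ¬p) = contradiction p ¬p

  F-pre : ∀ s → Pre s → Pre (F s)
  F-pre s p = let q , e = F-spec s p in subst Pre (sym e) (preU s q)

  G-pre : ∀ s → Pre s → Pre (G s)
  G-pre s p = let q , e = G-spec s p in subst Pre (sym e) (preQ s q)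

  -- Isomorphisms and relabelings

  record Iso (s s′ : Str N) : Set where
    field
      to from : Fin N → Fin N
      from-to : ∀ x → from (to x) ≡ x
      to-from : ∀ x → to (from x) ≡ x
      iso₀    : ∀ x → to (τ₀ s x) ≡ τ₀ s′ (to x)
      iso₁    : ∀ x → to (τ₁ s x) ≡ τ₁ s′ (to x)
      iso₂    : ∀ x → to (τ₂ s x) ≡ τ₂ s′ (to x)
      iso-ℓ   : ∀ x → ℓ s′ (to x) ≡ ℓ s x
      iso-r   : to (root s) ≡ root s′

  iso-refl : ∀ {s} → Iso s s
  iso-refl = record
    { to = id ; from = id ; from-to = λ _ → refl ; to-from = λ _ → refl ; iso₀ = λ _ → refl
    ; iso₁ = λ _ → refl ; iso₂ = λ _ → refl ; iso-ℓ = λ _ → refl ; iso-r = refl }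

  iso-sym : ∀ {s s′} → Iso s s′ → Iso s′ s
  iso-sym {s} {s′} f = record
    { to = from ; from = to ; from-to = to-from ; to-from = from-to
    ; iso₀ = back iso₀ ; iso₁ = back iso₁ ; iso₂ = back iso₂
    ; iso-ℓ = λ x → trans (sym (iso-ℓ (from x))) (cong (ℓ s′) (to-from x))
    ; iso-r = trans (cong from (sym iso-r)) (from-to _) }
    where
    open Iso f
    back : ∀ {t t′ : Fin N → Fin N} → (∀ x → to (t x) ≡ t′ (to x)) → ∀ x → from (t′ x) ≡ t (from x)
    back {t} {t′} h x = trans (cong (from ∘ t′) (sym (to-from x))) (trans (cong from (sym (h (from x)))) (from-to _))

  iso-trans : ∀ {s s′ s″} → Iso s s′ → Iso s′ s″ → Iso s s″
  iso-trans f g = record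
    { to = g.to ∘ f.to ; from = f.from ∘ g.from
    ; from-to = λ x → trans (cong f.from (g.from-to _)) (f.from-to x)
    ; to-from = λ x → trans (cong g.to (f.to-from _)) (g.to-from x)
    ; iso₀ = λ x → trans (cong g.to (f.iso₀ x)) (g.iso₀ _)
    ; iso₁ = λ x → trans (cong g.to (f.iso₁ x)) (g.iso₁ _)
    ; iso₂ = λ x → trans (cong g.to (f.iso₂ x)) (g.iso₂ _)
    ; iso-ℓ = λ x → trans (g.iso-ℓ _) (f.iso-ℓ x)
    ; iso-r = trans (cong g.to f.iso-r) g.iso-r }
    where
    module f = Iso f
    module g = Iso g

  iso-equiv : IsEquivalence Iso
  iso-equiv = record { refl = iso-refl ; sym = iso-sym ; trans = iso-trans }

  -- A permutation with its inverse. The inverse is determined, so the tables satisfying `IsPerm`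
  -- list each permutation once.
  Table : Set
  Table = Vec (Fin N) N × Vec (Fin N) N

  IsPerm : Table → Set
  IsPerm (v , w) = (∀ x → lookup w (lookup v x) ≡ x) × (∀ x → lookup v (lookup w x) ≡ x)

  vecs : List (Vec (Fin N) N)
  vecs = vectors (List.allFin N) N

  tables : List Table
  tables = List.cartesianProductWith _,_ vecs vecs

  ∈-tables : ∀ t → t ∈ tables
  ∈-tables (v , w) = ∈-cartesianProductWith⁺ _,_ (∈-vectors ∈-allFin v) (∈-vectors ∈-allFin w)

  isPerm? : ∀ t → Dec (IsPerm t)
  isPerm? (v , w) = Finₚ.all? (λ x → lookup w (lookup v x) Finₚ.≟ x) ×-dec Finₚ.all? (λ x → lookup v (lookup w x) Finₚ.≟ x)

  opaque
    perms : ∃ (Transversal _≡_ IsPerm (_∈ tables))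
    perms = transversal isEquivalence (Productₚ.≡-dec vec≟ vec≟) isPerm? tables
      where
      vec≟ : (v w : Vec (Fin N) N) → Dec (v ≡ w)
      vec≟ = Vecₚ.≡-dec Finₚ._≟_

  #perms : ℕ
  #perms = proj₁ perms

  perm : Fin #perms → Table
  perm = proj₁ (proj₂ perms)

  perm-good : ∀ σ → IsPerm (perm σ)
  perm-good = proj₁ (proj₂ (proj₂ perms))

  find-perm : ∀ t → IsPerm t → ∃ λ σ → t ≡ perm σ
  find-perm t = proj₂ (proj₂ (proj₂ (proj₂ perms))) t (∈-tables t)

  relabel : Table → Str N → Str N
  relabel (v , w) s = mk (tab (τ₀ s)) (tab (τ₁ s)) (tab (τ₂ s)) (tabulate (λ x → lookup (lv s) (lookup w x))) (lookup v (root s))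
    where
    tab : (Fin N → Fin N) → Vec (Fin N) N
    tab t = tabulate (λ x → lookup v (t (lookup w x)))

  act : Fin #perms → Str N → Str N
  act σ = relabel (perm σ)

  relabel-iso : ∀ t → IsPerm t → ∀ s → Iso s (relabel t s)
  relabel-iso (v , w) (wv , vw) s = record
    { to = lookup v ; from = lookup w ; from-to = wv ; to-from = vw
    ; iso₀ = tab (τ₀ s) ; iso₁ = tab (τ₁ s) ; iso₂ = tab (τ₂ s)
    ; iso-ℓ = λ x → cong toℕ (trans (Vecₚ.lookup∘tabulate _ (lookup v x)) (cong (lookup (lv s)) (wv x)))
    ; iso-r = refl }
    where
    tab : ∀ (t : Fin N → Fin N) x → lookup v (t x) ≡ lookup (tabulate (λ y → lookup v (t (lookup w y)))) (lookup v x)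
    tab t x = sym (trans (Vecₚ.lookup∘tabulate _ (lookup v x)) (cong (lookup v ∘ t) (wv x)))

  act-iso : ∀ σ s → Iso s (act σ s)
  act-iso σ = relabel-iso (perm σ) (perm-good σ)

  iso-act : ∀ {s s′} → Iso s s′ → ∃ λ σ → act σ s ≡ s′
  iso-act {s} {s′} f = proj₁ hit , trans (cong (λ t → relabel t s) (sym (proj₂ hit)))
      (str-ext (tab iso₀) (tab iso₁) (tab iso₂)
        (λ x → trans (cong toℕ (trans (Vecₚ.lookup∘tabulate _ x) (cong (lookup (lv s)) (Vecₚ.lookup∘tabulate from x))))
                 (trans (sym (iso-ℓ _)) (cong (ℓ s′) (to-from x))))
        (trans (Vecₚ.lookup∘tabulate to _) iso-r))
    where
    open Iso f
    table : Table
    table = tabulate to , tabulate from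
    good : IsPerm table
    good = (λ x → trans (Vecₚ.lookup∘tabulate from _) (trans (cong from (Vecₚ.lookup∘tabulate to x)) (from-to x))) ,
           (λ x → trans (Vecₚ.lookup∘tabulate to _) (trans (cong to (Vecₚ.lookup∘tabulate from x)) (to-from x)))
    hit = find-perm table good
    tab : ∀ {t t′ : Fin N → Fin N} → (∀ x → to (t x) ≡ t′ (to x)) → ∀ x →
      lookup (tabulate (λ y → lookup (tabulate to) (t (lookup (tabulate from) y)))) x ≡ t′ x
    tab {t} {t′} h x = trans (Vecₚ.lookup∘tabulate _ x) (trans (Vecₚ.lookup∘tabulate to _)
      (trans (cong (to ∘ t) (Vecₚ.lookup∘tabulate from x)) (trans (h _) (cong t′ (to-from x)))))

  Step₃ : Str N → Fin N → Fin N → Set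
  Step₃ s x y = (y ≡ τ₀ s x ⊎ y ≡ τ₁ s x) ⊎ y ≡ τ₂ s x

  Connected : Str N → Set
  Connected s = ∀ x y → Star (Step₃ s) x y

  -- Agreement at the root spreads along τ₀, τ₁ and τ₂ to everything connected to it.
  iso-unique : ∀ {s s′} → Connected s → (f g : Iso s s′) → ∀ x → Iso.to f x ≡ Iso.to g x
  iso-unique {s} {s′} conn f g x = go (trans f.iso-r (sym g.iso-r)) (conn (root s) x)
    where
    module f = Iso f
    module g = Iso g
    go : ∀ {x y} → f.to x ≡ g.to x → Star (Step₃ s) x y → f.to y ≡ g.to y
    go h ε = h
    go h (inj₁ (inj₁ refl) ◅ c) = go (trans (f.iso₀ _) (trans (cong (τ₀ s′) h) (sym (g.iso₀ _)))) c
    go h (inj₁ (inj₂ refl) ◅ c) = go (trans (f.iso₁ _) (trans (cong (τ₁ s′) h) (sym (g.iso₁ _)))) c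
    go h (inj₂ refl ◅ c)        = go (trans (f.iso₂ _) (trans (cong (τ₂ s′) h) (sym (g.iso₂ _)))) c

  act-free : ∀ s → Connected s → ∀ σ σ′ → act σ s ≡ act σ′ s → σ ≡ σ′
  act-free s conn σ σ′ e = proj₁ (proj₂ (proj₂ (proj₂ perms))) σ σ′ (tables≡ (perm σ) (perm σ′) (perm-good σ) (perm-good σ′) to≡)
    where
    to≡ : ∀ x → lookup (proj₁ (perm σ)) x ≡ lookup (proj₁ (perm σ′)) x
    to≡ x = trans (iso-unique conn (act-iso σ s) (subst (Iso s) (sym e) (act-iso σ′ s)) x) (lem e (act-iso σ′ s))
      where
      lem : ∀ {t t′} (e : t ≡ t′) (f : Iso s t′) → Iso.to (subst (Iso s) (sym e) f) x ≡ Iso.to f x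
      lem refl f = refl
    tables≡ : ∀ t t′ → IsPerm t → IsPerm t′ → (∀ x → lookup (proj₁ t) x ≡ lookup (proj₁ t′) x) → t ≡ t′
    tables≡ (v , w) (v′ , w′) (_ , vw) (wv′ , _) h = cong₂ _,_ (vec-ext h)
      (vec-ext λ x → trans (sym (wv′ _)) (cong (lookup w′) (trans (sym (h _)) (vw x))))

  iso? : ∀ s s′ → Dec (Iso s s′)
  iso? s s′ = map′ (λ (σ , e) → subst (Iso s) e (act-iso σ s)) iso-act (Finₚ.any? λ σ → str≟ (act σ s) s′)
    where
    str≟ : ∀ s s′ → Dec (s ≡ s′)
    str≟ (mk a b c d r) (mk a′ b′ c′ d′ r′) = map′ (λ { (refl , refl , refl , refl , refl) → refl })
      (λ { refl → refl , refl , refl , refl , refl })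
      (Vecₚ.≡-dec Finₚ._≟_ a a′ ×-dec Vecₚ.≡-dec Finₚ._≟_ b b′ ×-dec Vecₚ.≡-dec Finₚ._≟_ c c′ ×-dec
       Vecₚ.≡-dec Finₚ._≟_ d d′ ×-dec r Finₚ.≟ r′)

  structures : List (Str N)
  structures = List.cartesianProductWith (λ f r → f r) (List.cartesianProductWith (λ f d → f d)
    (List.cartesianProductWith (λ f c → f c) (List.cartesianProductWith mk vecs vecs) vecs)
    (vectors (List.allFin (suc N)) N)) (List.allFin N)

  ∈-structures : ∀ s → s ∈ structures
  ∈-structures (mk a b c d r) = ∈-cartesianProductWith⁺ _ (∈-cartesianProductWith⁺ _ (∈-cartesianProductWith⁺ _
    (∈-cartesianProductWith⁺ mk (∈-vectors ∈-allFin a) (∈-vectors ∈-allFin b)) (∈-vectors ∈-allFin c))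
    (∈-vectors ∈-allFin d)) (∈-allFin r)

  #perms-nonZero : ℕ.NonZero #perms
  #perms-nonZero = ℕ.>-nonZero (ℕₚ.≤-trans (s≤s z≤n) (Finₚ.toℕ<n (proj₁ (find-perm (tabulate id , tabulate id) (good , good)))))
    where
    good : ∀ x → lookup (tabulate id) (lookup (tabulate id) x) ≡ x
    good x = trans (Vecₚ.lookup∘tabulate id _) (Vecₚ.lookup∘tabulate id x)

-- Invariants and surfaces

-- The words `w i` list the class of x without repetition, so all classes have k elements. Applied
-- to the two flags at a corner and to the four flags of an edge.
sum-blocks : ∀ {N k c} {R : Fin N → Fin N → Set} → IsEquivalence R → (w : Fin k → Fin N → Fin N) →
  (∀ i x → R x (w i x)) → (∀ {x y} → R x y → ∃ λ i → y ≡ w i x) → (∀ x i j → w i x ≡ w j x → i ≡ j) →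
  HasClassCount R (λ _ → ⊤) c → N ≡ c * k
sum-blocks {N} {k} {c} {R} eq w w-R R-w w-inj (e , _ , inj , sur) = ℕₚ.≤-antisym
    (injection⇒≤ code λ x y h → trans (sym (code-pt x)) (trans (cong pt h) (code-pt y)))
    (injection⇒≤ pt pt-inj)
  where
  open IsEquivalence eq using () renaming (refl to ~refl; sym to ~sym; trans to ~trans)
  pt : Fin (c * k) → Fin N
  pt z = let i , j = remQuot {c} k z in w j (e i)
  word : ∀ x → ∃ λ j → x ≡ w j (e (proj₁ (sur x tt)))
  word x = R-w (~sym (proj₂ (sur x tt)))
  code : Fin N → Fin (c * k)
  code x = combine (proj₁ (sur x tt)) (proj₁ (word x))
  code-pt : ∀ x → pt (code x) ≡ x
  code-pt x = trans (cong (λ (i , j) → w j (e i)) (Finₚ.remQuot-combine {c} {k} (proj₁ (sur x tt)) (proj₁ (word x))))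
                (sym (proj₂ (word x)))
  pair-inj : ∀ a b → w (proj₂ a) (e (proj₁ a)) ≡ w (proj₂ b) (e (proj₁ b)) → a ≡ b
  pair-inj (i , j) (i′ , j′) h = fin (inj i i′ (~trans (w-R j (e i)) (subst (λ z → R z (e i′)) (sym h) (~sym (w-R j′ (e i′))))))
    where
    fin : i ≡ i′ → (i , j) ≡ (i′ , j′)
    fin refl = cong (i ,_) (w-inj (e i) j j′ h)
  pt-inj : ∀ y z → pt y ≡ pt z → y ≡ z
  pt-inj y z h = trans (sym (Finₚ.combine-remQuot {c} k y)) (trans (cong (uncurry combine) (pair-inj (remQuot k y) (remQuot k z) h)) (Finₚ.combine-remQuot {c} k z))

involution-blocks : ∀ {N c} {f : Fin N → Fin N} → (∀ x → f (f x) ≡ x) → (∀ x → ¬ f x ≡ x) →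
  HasClassCount (Star (λ x y → y ≡ f x)) (λ _ → ⊤) c → N ≡ c * 2
involution-blocks {N} {c} {f} ff f-fpf = sum-blocks (star-isEquiv (flip-involution ff)) w w-R (R-w zero refl) w-inj
  where
  w : Fin 2 → Fin N → Fin N
  w zero       x = x
  w (suc zero) x = f x
  w-R : ∀ i x → Star (λ x y → y ≡ f x) x (w i x)
  w-R zero       x = ε
  w-R (suc zero) x = refl ◅ ε
  R-w : ∀ i {x z y} → z ≡ w i x → Star (λ x y → y ≡ f x) z y → ∃ λ j → y ≡ w j x
  R-w i h ε = i , h
  R-w zero       refl (refl ◅ c) = R-w (suc zero) refl c
  R-w (suc zero) refl (refl ◅ c) = R-w zero (ff _) c
  w-inj : ∀ x i j → w i x ≡ w j x → i ≡ j
  w-inj x zero       zero       h = refl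
  w-inj x zero       (suc zero) h = contradiction (sym h) (f-fpf x)
  w-inj x (suc zero) zero       h = contradiction h (f-fpf x)
  w-inj x (suc zero) (suc zero) h = refl

klein-blocks : ∀ {N c} {f g : Fin N → Fin N} → (∀ x → f (f x) ≡ x) → (∀ x → g (g x) ≡ x) →
  (∀ x → ¬ f x ≡ x) → (∀ x → ¬ g x ≡ x) → (∀ x → f (g x) ≡ g (f x)) → (∀ x → ¬ f (g x) ≡ x) →
  HasClassCount (Conn f g) (λ _ → ⊤) c → N ≡ c * 4
klein-blocks {N} {c} {f} {g} ff gg f-fpf g-fpf comm fg-fpf = sum-blocks (conn-equiv ff gg) w w-R (R-w zero refl) w-inj
  where
  w : Fin 4 → Fin N → Fin N
  w zero                   x = x
  w (suc zero)             x = f x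
  w (suc (suc zero))       x = g x
  w (suc (suc (suc zero))) x = f (g x)
  w-R : ∀ i x → Conn f g x (w i x)
  w-R zero                   x = ε
  w-R (suc zero)             x = inj₁ refl ◅ ε
  w-R (suc (suc zero))       x = inj₂ refl ◅ ε
  w-R (suc (suc (suc zero))) x = inj₂ refl ◅ inj₁ refl ◅ ε
  wf : ∀ i x → ∃ λ j → f (w i x) ≡ w j x
  wf zero                   x = suc zero , refl
  wf (suc zero)             x = zero , ff x
  wf (suc (suc zero))       x = suc (suc (suc zero)) , refl
  wf (suc (suc (suc zero))) x = suc (suc zero) , ff _
  wg : ∀ i x → ∃ λ j → g (w i x) ≡ w j x
  wg zero                   x = suc (suc zero) , refl
  wg (suc zero)             x = suc (suc (suc zero)) , sym (comm x)
  wg (suc (suc zero))       x = zero , gg x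
  wg (suc (suc (suc zero))) x = suc zero , trans (sym (comm _)) (cong f (gg x))
  R-w : ∀ i {x z y} → z ≡ w i x → Conn f g z y → ∃ λ j → y ≡ w j x
  R-w i h ε = i , h
  R-w i {x} refl (inj₁ refl ◅ c) = let j , h = wf i x in R-w j h c
  R-w i {x} refl (inj₂ refl ◅ c) = let j , h = wg i x in R-w j h c
  f≢g : ∀ x → ¬ f x ≡ g x
  f≢g x h = fg-fpf x (trans (cong f (sym h)) (ff x))
  w-inj : ∀ x i j → w i x ≡ w j x → i ≡ j
  w-inj x zero zero h = refl
  w-inj x zero (suc zero) h = contradiction (sym h) (f-fpf x)
  w-inj x zero (suc (suc zero)) h = contradiction (sym h) (g-fpf x)
  w-inj x zero (suc (suc (suc zero))) h = contradiction (sym h) (fg-fpf x)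
  w-inj x (suc zero) zero h = contradiction h (f-fpf x)
  w-inj x (suc zero) (suc zero) h = refl
  w-inj x (suc zero) (suc (suc zero)) h = contradiction h (f≢g x)
  w-inj x (suc zero) (suc (suc (suc zero))) h = contradiction (trans (sym (comm x)) (sym h)) (g-fpf (f x))
  w-inj x (suc (suc zero)) zero h = contradiction h (g-fpf x)
  w-inj x (suc (suc zero)) (suc zero) h = contradiction (sym h) (f≢g x)
  w-inj x (suc (suc zero)) (suc (suc zero)) h = refl
  w-inj x (suc (suc zero)) (suc (suc (suc zero))) h = contradiction (sym h) (f-fpf (g x))
  w-inj x (suc (suc (suc zero))) zero h = contradiction h (fg-fpf x)
  w-inj x (suc (suc (suc zero))) (suc zero) h = contradiction (trans (sym (comm x)) h) (g-fpf (f x))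
  w-inj x (suc (suc (suc zero))) (suc (suc zero)) h = contradiction h (f-fpf (g x))
  w-inj x (suc (suc (suc zero))) (suc (suc (suc zero))) h = refl

module Transfer {k k′ : ℕ} {R : Fin k → Fin k → Set} {R′ : Fin k′ → Fin k′ → Set}
  (R-sym : ∀ {x y} → R x y → R y x) (R′-sym : ∀ {x y} → R′ x y → R′ y x)
  (θ : Fin k → Fin k′) (θ⁻¹ : Fin k′ → Fin k) (θ⁻¹-θ : ∀ x → θ⁻¹ (θ x) ≡ x) (θ-θ⁻¹ : ∀ y → θ (θ⁻¹ y) ≡ y)
  (R-to : ∀ {x y} → R x y → R′ (θ x) (θ y)) (R-from : ∀ {x y} → R′ x y → R (θ⁻¹ x) (θ⁻¹ y)) where

  star-to : ∀ {x y} → Star R x y → Star R′ (θ x) (θ y)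
  star-to = Star.gmap θ R-to

  star-from : ∀ {x y} → Star R′ x y → Star R (θ⁻¹ x) (θ⁻¹ y)
  star-from = Star.gmap θ⁻¹ R-from

  count-to : ∀ {P : Fin k → Set} {P′ : Fin k′ → Set} → (∀ {x} → P x → P′ (θ x)) → (∀ {y} → P′ y → P (θ⁻¹ y)) →
    ∀ {m} → HasClassCount (Star R) P m → HasClassCount (Closure R′) P′ m
  count-to to from = transportCount (closure-isEquiv R′-sym) θ (Star⇒Closure ∘ star-to)
    (λ c → subst₂ (Star R) (θ⁻¹-θ _) (θ⁻¹-θ _) (star-from (Closure⇒Star c))) to
    λ y py → θ⁻¹ y , from py , subst (Closure R′ y) (sym (θ-θ⁻¹ y)) here

  count-from : ∀ {P : Fin k → Set} {P′ : Fin k′ → Set} → (∀ {x} → P x → P′ (θ x)) → (∀ {y} → P′ y → P (θ⁻¹ y)) →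
    ∀ {m} → HasClassCount (Closure R′) P′ m → HasClassCount (Star R) P m
  count-from to from = transportCount (star-isEquiv R-sym) θ⁻¹ (star-from ∘ Closure⇒Star)
    (λ {x} {y} c → Star⇒Closure (subst₂ (Star R′) (θ-θ⁻¹ x) (θ-θ⁻¹ y) (star-to c))) from
    λ x px → θ x , to px , subst (Star R x) (sym (θ⁻¹-θ x)) ε

step₂-sym : {A : Set} {f g : A → A} → (∀ x → f (f x) ≡ x) → (∀ x → g (g x) ≡ x) → ∀ {x y} → Step₂ f g x y → Step₂ f g y x
step₂-sym ff gg (inj₁ e) = inj₁ (flip-involution ff e)
step₂-sym ff gg (inj₂ e) = inj₂ (flip-involution gg e)

¬≡⇒not : ∀ {a b : Bool} → ¬ a ≡ b → a ≡ not b
¬≡⇒not {a} {b} h = Boolₚ.¬-not h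

not⇒¬≡ : ∀ {a b : Bool} → a ≡ not b → ¬ a ≡ b
not⇒¬≡ {b = b} refl e = Boolₚ.not-¬ {b} refl (sym e)

χ : Surface → ℤ
χ (orientable g)    = + 2 ℤ.- (+ g ℤ.+ + g)
χ (nonorientable h) = + 2 ℤ.- + suc h

OrientedAs : Surface → Set → Set
OrientedAs (orientable _)    O = O
OrientedAs (nonorientable _) O = ¬ O

onSurface⇒ : ∀ {M} S → OnSurface M S → OrientedAs S (Map.Orientable M) × Map.EulerChar M (χ S)
onSurface⇒ (orientable _)    h = h
onSurface⇒ (nonorientable _) h = h

⇒onSurface : ∀ {M} S → OrientedAs S (Map.Orientable M) → Map.EulerChar M (χ S) → OnSurface M S
⇒onSurface (orientable _)    o e = o , e
⇒onSurface (nonorientable _) o e = o , e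

orientedAs-map : ∀ S {O O′ : Set} → (O → O′) → (O′ → O) → OrientedAs S O → OrientedAs S O′
orientedAs-map (orientable _)    to from o = to o
orientedAs-map (nonorientable _) to from o = o ∘ from

-- Total number of vertices, and for each level the numbers of vertices and of corners.
Inv : ℕ → Set
Inv N = ℕ × Vec (ℕ × ℕ) (suc N)

inv≟ : ∀ {N} (ι ι′ : Inv N) → Dec (ι ≡ ι′)
inv≟ = Productₚ.≡-dec ℕ._≟_ (Vecₚ.≡-dec (Productₚ.≡-dec ℕ._≟_ ℕ._≟_))

-- No flag has a level above N, hence the default 0.
at-level : ∀ {N} → Inv N → ℕ → ℕ × ℕ
at-level {N} (_ , v) i with i ℕ.<? suc N
... | yes p = lookup v (fromℕ< p)
... | no _  = 0 , 0

-- Counts per level and the two classes of structures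

module _ {N : ℕ} where

  open Str

  SameVertex SameCorner : Str N → Fin N → Fin N → Set
  SameVertex s = Conn (τ₁ s) (τ₂ s)
  SameCorner s = Star λ x y → y ≡ τ₁ s x

  -- `V` is a parameter because vertices are counted in two ways: as orbits of τ₁ and τ₂ on the map,
  -- and through upper ends (`TopVertex`) on the quadrangulation. Corners of the map and edges of
  -- the quadrangulation are both orbits of τ₁.
  HasCounts : Str N → (Fin N → Fin N → Set) → Inv N → Set
  HasCounts s V ι = HasClassCount V (λ _ → ⊤) (proj₁ ι) ×
    (∀ i → HasClassCount V (λ x → ℓ s x ≡ i) (proj₁ (at-level ι i)) ×
           HasClassCount (SameCorner s) (λ x → ℓ s x ≡ i) (proj₂ (at-level ι i)))

  HasInv : Str N → Inv N → Set
  HasInv s = HasCounts s (SameVertex s)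

  inv-ext : ∀ {ι ι′ : Inv N} → proj₁ ι ≡ proj₁ ι′ → (∀ i → at-level ι i ≡ at-level ι′ i) → ι ≡ ι′
  inv-ext {t , v} {t′ , v′} refl h = cong (t ,_) (vec-ext λ j → trans (sym (at≡ v j)) (trans (h (toℕ j)) (at≡ v′ j)))
    where
    at≡ : ∀ (v : Vec (ℕ × ℕ) (suc N)) (j : Fin (suc N)) → at-level (t , v) (toℕ j) ≡ lookup v j
    at≡ v j with toℕ j ℕ.<? suc N
    ... | yes q = cong (lookup v) (Finₚ.fromℕ<-toℕ j q)
    ... | no ¬q = contradiction (Finₚ.toℕ<n j) ¬q

  counts-unique : ∀ s → Pre s → ∀ {V} → IsEquivalence V → ∀ {ι ι′} → HasCounts s V ι → HasCounts s V ι′ → ι ≡ ι′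
  counts-unique s (_ , gl) V-equiv (t , l) (t′ , l′) = inv-ext (classCount-unique V-equiv t t′)
    λ i → cong₂ _,_ (classCount-unique V-equiv (proj₁ (l i)) (proj₁ (l′ i)))
      (classCount-unique (star-isEquiv (flip-involution (Gluing.τ₁-inv gl))) (proj₂ (l i)) (proj₂ (l′ i)))

  module _ (s : Str N) (p : Pre s) where

    open Frame (proj₁ p)
    open Gluing (proj₂ p)

    private
      V-equiv : IsEquivalence (SameVertex s)
      V-equiv = conn-equiv τ₁-inv τ₂-inv
      C-equiv : IsEquivalence (SameCorner s)
      C-equiv = star-isEquiv (flip-involution τ₁-inv)
      V? : ∀ x y → Dec (SameVertex s x y)
      V? = Warshall.star? _ λ x y → (y Finₚ.≟ τ₁ s x) ⊎-dec (y Finₚ.≟ τ₂ s x)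
      C? : ∀ x y → Dec (SameCorner s x y)
      C? = Warshall.star? _ λ x y → y Finₚ.≟ τ₁ s x

    countV : ∀ i → ∃ (HasClassCount (SameVertex s) (λ x → ℓ s x ≡ i))
    countV i = classCount V-equiv V? (λ x → ℓ s x ℕ.≟ i)

    countC : ∀ i → ∃ (HasClassCount (SameCorner s) (λ x → ℓ s x ≡ i))
    countC i = classCount C-equiv C? (λ x → ℓ s x ℕ.≟ i)

    levels : Vec (ℕ × ℕ) (suc N)
    levels = tabulate (λ i → proj₁ (countV (toℕ i)) , proj₁ (countC (toℕ i)))

    pre-inv : Inv N
    pre-inv = proj₁ (classCount V-equiv V? {λ _ → ⊤} (λ _ → yes tt)) , levels

    pre-inv-spec : HasInv s pre-inv
    pre-inv-spec = proj₂ (classCount V-equiv V? (λ _ → yes tt)) , at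
      where
      at : ∀ i → HasClassCount (SameVertex s) (λ x → ℓ s x ≡ i) (proj₁ (at-level pre-inv i)) ×
                 HasClassCount (SameCorner s) (λ x → ℓ s x ≡ i) (proj₂ (at-level pre-inv i))
      at i with i ℕ.<? suc N
      ... | yes i< = subst (λ e → HasClassCount (SameVertex s) (λ x → ℓ s x ≡ i) (proj₁ e) × HasClassCount (SameCorner s) (λ x → ℓ s x ≡ i) (proj₂ e))
              (sym (Vecₚ.lookup∘tabulate (λ i → proj₁ (countV (toℕ i)) , proj₁ (countC (toℕ i))) (fromℕ< i<)))
              (subst (λ j → HasClassCount (SameVertex s) (λ x → ℓ s x ≡ i) (proj₁ (countV j)) × HasClassCount (SameCorner s) (λ x → ℓ s x ≡ i) (proj₁ (countC j)))
                 (sym (Finₚ.toℕ-fromℕ< i<)) (proj₂ (countV i) , proj₂ (countC i)))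
      ... | no i≮ = empty-count {R = SameVertex s} none , empty-count {R = SameCorner s} none
        where
        none : ∀ x → ¬ ℓ s x ≡ i
        none x refl = i≮ (s≤s (bounded x))

  inv₀ : ∀ s → Dec (Pre s) → Inv N
  inv₀ s (yes p) = pre-inv s p
  inv₀ s (no _)  = 0 , Vec.replicate (suc N) (0 , 0)

  inv : Str N → Inv N
  inv s = inv₀ s (pre? s)

  inv-spec : ∀ s → Pre s → HasInv s (inv s)
  inv-spec s p = go (pre? s)
    where
    go : ∀ d → HasInv s (inv₀ s d)
    go (yes q) = pre-inv-spec s q
    go (no ¬p) = contradiction p ¬p

  Orientation : Str N → Set
  Orientation s = ∃ λ c → Orients c (τ₀ s) × Orients c (τ₁ s) × Orients c (τ₂ s)

  orientation? : ∀ s → Dec (Orientation s)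
  orientation? s = map′ (λ h → let v , _ , a , b , c = find {P = Ok} h in lookup v , a , b , c)
      (λ (c , h₀ , h₁ , h₂) → lose {P = Ok} (∈-vectors ∈-bools (tabulate c)) (tab c h₀ , tab c h₁ , tab c h₂))
      (Any.any? (λ v → ok? (lookup v) (τ₀ s) ×-dec ok? (lookup v) (τ₁ s) ×-dec ok? (lookup v) (τ₂ s)) (vectors bools N))
    where
    Ok : Vec Bool N → Set
    Ok v = Orients (lookup v) (τ₀ s) × Orients (lookup v) (τ₁ s) × Orients (lookup v) (τ₂ s)
    bools : List Bool
    bools = true ∷ false ∷ []
    ∈-bools : ∀ b → b ∈ bools
    ∈-bools true  = here refl
    ∈-bools false = there (here refl)
    ok? : ∀ c f → Dec (Orients {N} c f)
    ok? c f = Finₚ.all? λ x → c (f x) Boolₚ.≟ not (c x)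
    tab : ∀ c {f} → Orients c f → Orients (lookup (tabulate c)) f
    tab c {f} h x = trans (Vecₚ.lookup∘tabulate c (f x)) (trans (h x) (cong not (sym (Vecₚ.lookup∘tabulate c x))))

  orientedAs? : ∀ S s → Dec (OrientedAs S (Orientation s))
  orientedAs? (orientable _)    s = orientation? s
  orientedAs? (nonorientable _) s = ¬? (orientation? s)

  OneFaced : Str N → Set
  OneFaced s = ∀ x y → Conn (τ₀ s) (τ₁ s) x y

  GoodU : Surface → ℕ → Str N → Set
  GoodU S n s = Pre s × OneFaced s × OrientedAs S (Orientation s) × χ S ≡ (+ proj₁ (inv s) ℤ.- + n) ℤ.+ + 1

  goodU? : ∀ S n s → Dec (GoodU S n s)
  goodU? S n s = pre? s ×-dec
    Finₚ.all? (λ x → Finₚ.all? λ y → Warshall.star? _ (λ x y → (y Finₚ.≟ τ₀ s x) ⊎-dec (y Finₚ.≟ τ₁ s x)) x y) ×-dec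
    orientedAs? S s ×-dec (χ S ℤₚ.≟ _)

  -- Pulled back along `G`, so that `F` and `G` are inverse bijections between the two classes by
  -- construction. That these structures are the pointed quadrangulations on `S` is the content of
  -- `onSurface-to` and `onSurface-from`.
  GoodQ : Surface → ℕ → Str N → Set
  GoodQ S n s = Pre s × GoodU S n (G s)

  goodQ? : ∀ S n s → Dec (GoodQ S n s)
  goodQ? S n s = pre? s ×-dec goodU? S n (G s)

  module _ (s : Str N) (p : Pre s) where

    open Framed (proj₁ p)
    private
      fr = proj₁ p
      gl = proj₂ p
      module C = Exchange.Conjugate fr (Glued.returnQ fr gl) gl {τ₁ (reglue (πQ s p) s)} (conjQ s p)
      gl* = proj₂ (preQ s p)

    low-cong : ∀ {T T′} → (∀ {y} → Up y → T y ≡ T′ y) → ∀ x → low T x ≡ low T′ x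
    low-cong {T} {T′} e x with adjacent x
    ... | inj₁ u        = trans (low-up T u) (trans (e u) (sym (low-up T′ u)))
    ... | inj₂ (inj₁ f) = trans (low-flat T f) (sym (low-flat T′ f))
    ... | inj₂ (inj₂ d) = trans (low-down T d) (sym (low-down T′ d))

    desc-cong : ∀ {σ T T′} → (∀ {y} → Up y → T y ≡ T′ y) → Desc σ T → Desc σ T′
    desc-cong {σ} {T} {T′} e (a , b) = (λ x z hx hz → conv (a x z hx hz)) , λ x h → let z , d , c = b x h in z , d , conv c
      where
      conv : ∀ {x y} → Conn σ (low T) x y → Conn σ (low T′) x y
      conv = Star.map λ { (inj₁ h) → inj₁ h ; (inj₂ h) → inj₂ (trans h (low-cong e _)) }

    private
      σ* : Fin N → Fin N
      σ* = τ₁ (reglue (πQ s p) s)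

      pU* pQ′ : Fin N → Fin N
      pU* = Glued.pU fr gl*
      pQ′ = Glued.pQ fr gl

      pU*≡ : ∀ {y} → Up y → pU* y ≡ pQ′ y
      pU*≡ = ToU.pU*≡pQ fr gl (conjQ s p) gl*

    -- π is an involution, so the old gluing is in turn the conjugate of the new one, and every
    -- transfer along π also runs backwards.
    conj-back : ∀ x → τ₁ s x ≡ πQ s p (τ₁ (reglue (πQ s p) s) (πQ s p x))
    conj-back x = sym (trans (C.π-τ₁* (πQ s p x)) (cong (τ₁ s) (ToU.π-inv fr gl {τ₁ s} x)))

    desc⇒oneFaced : Desc (τ₁ s) (τ₂ s) → OneFaced (reglue (πQ s p) s)
    desc⇒oneFaced d = Glued.desc⇒oneFace fr gl* (desc-cong {σ*} {pQ′} {pU*} (λ u → sym (pU*≡ u)) (C.desc-to′ d))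

    oneFaced⇒desc : OneFaced (reglue (πQ s p) s) → Desc (τ₁ s) (τ₂ s)
    oneFaced⇒desc one = Exchange.Conjugate.desc-to fr (Glued.returnQ fr gl) gl* {τ₁ s} conj-back
      (desc-cong {σ*} {pU*} {pQ′} pU*≡ (Glued.oneFace⇒desc fr gl* one))

    orientation-G : Orientation s → Orientation (reglue (πQ s p) s)
    orientation-G (c , c₀ , c₁ , c₂) = c , c₀ , C.orients* c (λ u → Glued.pQ-colour fr gl u c c₀ c₁ c₂) c₁ c₂ , c₂

    orientation-F : Orientation s → Orientation (reglue (πU s p) s)
    orientation-F (c , c₀ , c₁ , c₂) = c , c₀ ,
      Exchange.Conjugate.orients* fr (Glued.returnU fr gl) gl {τ₁ (reglue (πU s p) s)} (conjU s p) c (λ u → Glued.pU-colour fr gl u c c₀ c₁) c₁ c₂ , c₂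

module _ {N : ℕ} where

  open Str

  TopVertex : Str N → Fin N → Fin N → Set
  TopVertex s x y = Sides.Vertex (τ₀ s) (τ₁ s) (τ₂ s) (ℓ s) (x , true) (y , true)

  HasInvQ : Str N → Inv N → Set
  HasInvQ s = HasCounts s (TopVertex s)

  topVertex-equiv : ∀ s → Pre s → IsEquivalence (TopVertex s)
  topVertex-equiv s (fr , gl) = record { refl = ~refl ; sym = ~sym ; trans = ~trans }
    where open IsEquivalence (SideLaws.vertex-equiv fr gl) using () renaming (refl to ~refl; sym to ~sym; trans to ~trans)

  -- π carries orbits of τ₁ and τ₂ in the reglued structure to orbits of τ₁ and κ in s, which are
  -- the vertices met through upper ends. It preserves levels and carries τ₁-orbits to τ₁-orbits, so
  -- all counts move together.
  reglue-inv : ∀ s (p : Pre s) {ι} → HasInv (reglue (πQ s p) s) ι → HasInvQ s ι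
  reglue-inv s p@(fr , gl) {ι} = moved
    where
    open SideLaws fr gl using (κ⇒vertex; vertex⇒κ)
    module E = Exchange fr (Glued.returnQ fr gl)
    π : Fin N → Fin N
    π = E.π
    s* : Str N
    s* = reglue (πQ s p) s
    module C = E.Conjugate gl {τ₁ s*} (conjQ s p)
    module B = E.Conjugate (proj₂ (preQ s p)) {τ₁ s} (conj-back s p)
    top-to : ∀ {x y} → SameVertex s* x y → TopVertex s (π x) (π y)
    top-to c = κ⇒vertex (B.conn-to-V c)
    top-from : ∀ {x y} → TopVertex s (π x) (π y) → SameVertex s* x y
    top-from {x} {y} c = subst₂ (SameVertex s*) (E.π-inv x) (E.π-inv y) (C.conn-to-V′ (vertex⇒κ c))
    corner-to : ∀ {x y} → SameCorner s* x y → SameCorner s (π x) (π y)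
    corner-to = Star.gmap π λ { refl → C.π-τ₁* _ }
    corner-from : ∀ {x y} → SameCorner s (π x) (π y) → SameCorner s* x y
    corner-from {x} {y} c = subst₂ (SameCorner s*) (E.π-inv x) (E.π-inv y) (Star.gmap π (λ { refl → C.π-τ₁ _ }) c)
    level : ∀ {i x} → ℓ s x ≡ i → ℓ s (π x) ≡ i
    level {x = x} h = trans (E.ℓ-π x) h
    moved : HasInv s* ι → HasInvQ s ι
    moved (t , l) =
      transportCount (topVertex-equiv s p) π top-to top-from (λ _ → tt) (λ y _ → π y , tt , subst (TopVertex s y) (sym (E.π-inv y)) ε) t ,
      λ i → transportCount (topVertex-equiv s p) π top-to top-from level
              (λ y h → π y , level h , subst (TopVertex s y) (sym (E.π-inv y)) ε) (proj₁ (l i)) ,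
            transportCount (star-isEquiv (flip-involution (Gluing.τ₁-inv gl))) π corner-to corner-from level
              (λ y h → π y , level h , subst (SameCorner s y) (sym (E.π-inv y)) ε) (proj₂ (l i))

  invQ-spec : ∀ s → Pre s → HasInvQ s (inv (G s))
  invQ-spec s p = let q , e = G-spec s p in reglue-inv s q (subst (λ t → HasInv t (inv (G s))) e (inv-spec (G s) (G-pre s p)))

  iso-pre : ∀ {s s′ : Str N} → Iso s s′ → Pre s → Pre s′
  iso-pre {s} {s′} f (fr , gl) = record
    { τ₀-inv = all λ x → trans (cong (τ₀ s′) (sym (iso₀ x))) (trans (sym (iso₀ _)) (cong to (τ₀-inv x)))
    ; τ₂-inv = all λ x → trans (cong (τ₂ s′) (sym (iso₂ x))) (trans (sym (iso₂ _)) (cong to (τ₂-inv x)))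
    ; τ₀-fpf = all λ x h → τ₀-fpf x (to-inj (trans (iso₀ x) h))
    ; τ₂-fpf = all λ x h → τ₂-fpf x (to-inj (trans (iso₂ x) h))
    ; comm = all λ x → trans (sym (iso₀₂ x)) (trans (cong to (comm x)) (trans (iso₂ _) (cong (τ₂ s′) (iso₀ x))))
    ; τ₀τ₂-fpf = all λ x h → τ₀τ₂-fpf x (to-inj (trans (iso₀₂ x) h))
    ; ℓ-τ₂ = all λ x → trans (cong (ℓ s′) (sym (iso₂ x))) (trans (iso-ℓ _) (trans (ℓ-τ₂ x) (sym (iso-ℓ x))))
    ; adjacent = all λ x → subst₂ (λ a b → a ≡ suc b ⊎ a ≡ b ⊎ suc a ≡ b)
        (trans (sym (iso-ℓ _)) (cong (ℓ s′) (iso₀ x))) (sym (iso-ℓ x)) (adjacent x)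
    ; positive = all λ x → subst (1 ≤_) (sym (iso-ℓ x)) (positive x)
    ; bounded = λ x → ℕₚ.≤-pred (Finₚ.toℕ<n (lookup (lv s′) x))
    ; lowest = to (proj₁ lowest) , trans (iso-ℓ _) (proj₂ lowest) } , record
    { τ₁-inv = all λ x → trans (cong (τ₁ s′) (sym (iso₁ x))) (trans (sym (iso₁ _)) (cong to (τ₁-inv x)))
    ; τ₁-fpf = all λ x h → τ₁-fpf x (to-inj (trans (iso₁ x) h))
    ; ℓ-τ₁ = all λ x → trans (cong (ℓ s′) (sym (iso₁ x))) (trans (iso-ℓ _) (trans (ℓ-τ₁ x) (sym (iso-ℓ x)))) }
    where
    open Iso f
    open Frame fr
    open Gluing gl
    all : ∀ {P : Fin N → Set} → (∀ x → P (to x)) → ∀ y → P y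
    all {P} h y = subst P (to-from y) (h (from y))
    to-inj : ∀ {x y} → to x ≡ to y → x ≡ y
    to-inj {x} {y} h = trans (sym (from-to x)) (trans (cong from h) (from-to y))
    iso₀₂ : ∀ x → to (τ₀ s (τ₂ s x)) ≡ τ₀ s′ (τ₂ s′ (to x))
    iso₀₂ x = trans (iso₀ _) (cong (τ₀ s′) (iso₂ x))

-- Unicellular maps as structures

adjacent-labels : ∀ a b → ℤ.∣ + a ℤ.- + b ∣ ≤ 1 → b ≡ suc a ⊎ b ≡ a ⊎ suc b ≡ a
adjacent-labels a b h = go a b (subst (λ z → ℤ.∣ z ∣ ≤ 1) (ℤₚ.m-n≡m⊖n a b) h)
  where
  go : ∀ a b → ℤ.∣ a ℤ.⊖ b ∣ ≤ 1 → b ≡ suc a ⊎ b ≡ a ⊎ suc b ≡ a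
  go zero    zero          _ = inj₂ (inj₁ refl)
  go zero    (suc zero)    _ = inj₁ refl
  go zero    (suc (suc b)) (s≤s ())
  go (suc zero)    zero    _ = inj₂ (inj₂ refl)
  go (suc (suc a)) zero    (s≤s ())
  go (suc a) (suc b) h with go a b (subst (λ z → ℤ.∣ z ∣ ≤ 1) (ℤₚ.[1+m]⊖[1+n]≡m⊖n a b) h)
  ... | inj₁ e        = inj₁ (cong suc e)
  ... | inj₂ (inj₁ e) = inj₂ (inj₁ (cong suc e))
  ... | inj₂ (inj₂ e) = inj₂ (inj₂ (cong suc e))

labels-adjacent : ∀ a b → b ≡ suc a ⊎ b ≡ a ⊎ suc b ≡ a → ℤ.∣ + a ℤ.- + b ∣ ≤ 1
labels-adjacent a b h = subst (λ z → ℤ.∣ z ∣ ≤ 1) (sym (ℤₚ.m-n≡m⊖n a b)) (go a b h)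
  where
  up : ∀ a → ℤ.∣ a ℤ.⊖ suc a ∣ ≤ 1
  up zero    = s≤s z≤n
  up (suc a) = subst (λ z → ℤ.∣ z ∣ ≤ 1) (sym (ℤₚ.[1+m]⊖[1+n]≡m⊖n a (suc a))) (up a)
  down : ∀ b → ℤ.∣ suc b ℤ.⊖ b ∣ ≤ 1
  down zero    = s≤s z≤n
  down (suc b) = subst (λ z → ℤ.∣ z ∣ ≤ 1) (sym (ℤₚ.[1+m]⊖[1+n]≡m⊖n (suc b) b)) (down b)
  go : ∀ a b → b ≡ suc a ⊎ b ≡ a ⊎ suc b ≡ a → ℤ.∣ a ℤ.⊖ b ∣ ≤ 1
  go a _ (inj₁ refl)        = up a
  go a _ (inj₂ (inj₁ refl)) = subst (λ z → ℤ.∣ z ∣ ≤ 1) (sym (ℤₚ.n⊖n≡0 a)) z≤n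
  go _ b (inj₂ (inj₂ refl)) = down b

cancel-shift : ∀ x y c → (x ℤ.+ c) ℤ.- (y ℤ.+ c) ≡ x ℤ.- y
cancel-shift = solve-∀

+-cancelʳ : ∀ c {a b} → a ℤ.+ c ≡ b ℤ.+ c → a ≡ b
+-cancelʳ c {a} {b} h = trans (drop a c) (trans (cong (ℤ._- c) h) (sym (drop b c)))
  where
  drop : ∀ a c → a ≡ (a ℤ.+ c) ℤ.- c
  drop = solve-∀

+-cancelˡ : ∀ c {a b} → c ℤ.+ a ≡ c ℤ.+ b → a ≡ b
+-cancelˡ c {a} {b} h = +-cancelʳ c (trans (ℤₚ.+-comm a c) (trans h (ℤₚ.+-comm c b)))

argmin : {A : Set} (f : A → ℤ) (a : A) (xs : List A) → ∃ λ m → f m ℤ.≤ f a × (∀ x → x ∈ xs → f m ℤ.≤ f x)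
argmin f a [] = a , ℤₚ.≤-refl , λ x ()
argmin f a (y ∷ xs) with argmin f a xs
... | m , m≤a , m≤ with ℤₚ.≤-total (f m) (f y)
...   | inj₁ m≤y = m , m≤a , λ { x (here refl) → m≤y ; x (there i) → m≤ x i }
...   | inj₂ y≤m = y , ℤₚ.≤-trans y≤m m≤a , λ { x (here refl) → ℤₚ.≤-refl ; x (there i) → ℤₚ.≤-trans y≤m (m≤ x i) }

-- Each of the levels 1 to `ℓ x` is attained, and different levels need different flags.
level-bound : ∀ {k} (ℓ : Fin k → ℕ) → (∀ x i → 1 ≤ i → i ≤ ℓ x → ∃ λ y → ℓ y ≡ i) → ∀ x → ℓ x ≤ k
level-bound ℓ hit x = injection⇒≤ (λ i → proj₁ (at i)) λ i j h → Finₚ.toℕ-injective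
    (ℕₚ.suc-injective (trans (sym (proj₂ (at i))) (trans (cong ℓ h) (proj₂ (at j)))))
  where
  at : (i : Fin (ℓ x)) → ∃ λ y → ℓ y ≡ suc (toℕ i)
  at i = hit x (suc (toℕ i)) (s≤s z≤n) (Finₚ.toℕ<n i)

-- Labels and levels differ by the constant `shift`. Levels begin at 1, so the minimal label is
-- `1 + shift`.
record RepL {S : Surface} {n : ℕ} (L : LUMap S n) {N : ℕ} (s : Str N) : Set where
  open LUMap L
  private
    module M = RootedMap m
    module s = Str s
  field
    pre     : Pre s
    θ       : Fin N → Fin M.size
    θ⁻¹     : Fin M.size → Fin N
    θ⁻¹-θ   : ∀ x → θ⁻¹ (θ x) ≡ x
    θ-θ⁻¹   : ∀ y → θ (θ⁻¹ y) ≡ y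
    θ₀      : ∀ x → θ (s.τ₀ x) ≡ M.τ₀ (θ x)
    θ₁      : ∀ x → θ (s.τ₁ x) ≡ M.τ₁ (θ x)
    θ₂      : ∀ x → θ (s.τ₂ x) ≡ M.τ₂ (θ x)
    shift   : ℤ
    θ-label : ∀ x → label (θ x) ≡ + s.ℓ x ℤ.+ shift
    θ-root  : θ s.root ≡ M.root

module RepLLaws {S : Surface} {n : ℕ} {L : LUMap S n} {N : ℕ} {s : Str N} (rep : RepL L s) where

  open LUMap L
  open RepL rep public
  private
    module M = RootedMap m
    module s = Str s
  open Frame (proj₁ pre) public
  open Gluing (proj₂ pre) public

  θ⁻¹-comm : ∀ {t : Fin N → Fin N} {t′ : Fin M.size → Fin M.size} → (∀ x → θ (t x) ≡ t′ (θ x)) → ∀ y → θ⁻¹ (t′ y) ≡ t (θ⁻¹ y)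
  θ⁻¹-comm {t} {t′} h y = trans (cong (θ⁻¹ ∘ t′) (sym (θ-θ⁻¹ y))) (trans (cong θ⁻¹ (sym (h _))) (θ⁻¹-θ _))

  module T {f g : Fin N → Fin N} {f′ g′ : Fin M.size → Fin M.size}
    (ff : ∀ x → f (f x) ≡ x) (gg : ∀ x → g (g x) ≡ x) (ff′ : ∀ x → f′ (f′ x) ≡ x) (gg′ : ∀ x → g′ (g′ x) ≡ x)
    (θf : ∀ x → θ (f x) ≡ f′ (θ x)) (θg : ∀ x → θ (g x) ≡ g′ (θ x)) where

    step-to : ∀ {x y} → Step₂ f g x y → Step₂ f′ g′ (θ x) (θ y)
    step-to (inj₁ refl) = inj₁ (θf _)
    step-to (inj₂ refl) = inj₂ (θg _)

    step-from : ∀ {x y} → Step₂ f′ g′ x y → Step₂ f g (θ⁻¹ x) (θ⁻¹ y)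
    step-from (inj₁ refl) = inj₁ (θ⁻¹-comm {f} {f′} θf _)
    step-from (inj₂ refl) = inj₂ (θ⁻¹-comm {g} {g′} θg _)

    open Transfer {R = Step₂ f g} {R′ = Step₂ f′ g′} (step₂-sym ff gg) (step₂-sym ff′ gg′) θ θ⁻¹ θ⁻¹-θ θ-θ⁻¹ step-to step-from public

  module TV = T {s.τ₁} {s.τ₂} {M.τ₁} {M.τ₂} τ₁-inv τ₂-inv M.τ₁-inv M.τ₂-inv θ₁ θ₂
  module TF = T {s.τ₀} {s.τ₁} {M.τ₀} {M.τ₁} τ₀-inv τ₁-inv M.τ₀-inv M.τ₁-inv θ₀ θ₁
  corner-to : ∀ {x y} → y ≡ s.τ₁ x → θ y ≡ M.τ₁ (θ x)
  corner-to refl = θ₁ _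

  corner-from : ∀ {x y} → y ≡ M.τ₁ x → θ⁻¹ y ≡ s.τ₁ (θ⁻¹ x)
  corner-from refl = θ⁻¹-comm {s.τ₁} {M.τ₁} θ₁ _

  module TC = Transfer {R = λ x y → y ≡ s.τ₁ x} {R′ = λ x y → y ≡ M.τ₁ x} (flip-involution τ₁-inv) (flip-involution M.τ₁-inv)
    θ θ⁻¹ θ⁻¹-θ θ-θ⁻¹ corner-to corner-from

  label⇒level : ∀ {i y} → label y ≡ + i ℤ.+ shift → s.ℓ (θ⁻¹ y) ≡ i
  label⇒level {i} {y} h = ℤₚ.+-injective (+-cancelʳ shift (trans (sym (θ-label _)) (trans (cong label (θ-θ⁻¹ y)) h)))

  oneFaced : OneFaced s
  oneFaced x y = subst₂ (Conn s.τ₀ s.τ₁) (θ⁻¹-θ x) (θ⁻¹-θ y) (TF.star-from (Closure⇒Star (same (θ x) (θ y))))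
    where
    open IsEquivalence (closure-isEquiv {R = M.FStep} (step₂-sym M.τ₀-inv M.τ₁-inv)) using () renaming (refl to ~refl; sym to ~sym; trans to ~trans)
    single : (i j : Fin 1) → i ≡ j
    single zero zero = refl
    same : ∀ x y → M.SameF x y
    same x y = let e , _ , _ , sur = unicell ; i , a = sur x tt ; j , b = sur y tt in
      ~trans a (~sym (subst (λ k → M.SameF y (e k)) (single j i) b))

  good : GoodU S n s
  good = pre , oneFaced , orientedAs-map S o-from o-to (proj₁ (onSurface⇒ S onS)) , euler (proj₂ (onSurface⇒ S onS))
    where
    o-from : M.Orientable → Orientation s
    o-from (c , a , b , d) = c ∘ θ , (λ x → trans (cong c (θ₀ x)) (¬≡⇒not (a _))) ,
      (λ x → trans (cong c (θ₁ x)) (¬≡⇒not (b _))) , (λ x → trans (cong c (θ₂ x)) (¬≡⇒not (d _)))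
    o-to : Orientation s → M.Orientable
    o-to (c , a , b , d) = c ∘ θ⁻¹ , (λ x → not⇒¬≡ (trans (cong c (θ⁻¹-comm {s.τ₀} {M.τ₀} θ₀ x)) (a _))) ,
      (λ x → not⇒¬≡ (trans (cong c (θ⁻¹-comm {s.τ₁} {M.τ₁} θ₁ x)) (b _))) , (λ x → not⇒¬≡ (trans (cong c (θ⁻¹-comm {s.τ₂} {M.τ₂} θ₂ x)) (d _)))
    euler : M.EulerChar (χ S) → χ S ≡ (+ proj₁ (inv s) ℤ.- + n) ℤ.+ + 1
    euler (v , e , f , hv , he , hf , h) = trans h (cong₂ ℤ._+_
      (cong₂ (λ a b → + a ℤ.- + b)
        (classCount-unique (closure-isEquiv {R = M.VStep} (step₂-sym M.τ₁-inv M.τ₂-inv)) hv (TV.count-to (λ _ → tt) (λ _ → tt) (proj₁ (inv-spec s pre))))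
        (classCount-unique (closure-isEquiv {R = M.EStep} (step₂-sym M.τ₀-inv M.τ₂-inv)) he edges))
      (cong +_ (classCount-unique (closure-isEquiv {R = M.FStep} (step₂-sym M.τ₀-inv M.τ₁-inv)) hf unicell)))

  vertices-at : ∀ i → HasClassCount M.SameV (λ y → label y ≡ + i ℤ.+ shift) (proj₁ (at-level (inv s) i))
  vertices-at i = TV.count-to (λ {x} h → trans (θ-label x) (cong (λ k → + k ℤ.+ shift) h)) label⇒level (proj₁ (proj₂ (inv-spec s pre) i))

  corners-at : ∀ i → HasClassCount M.SameC (λ y → label y ≡ + i ℤ.+ shift) (proj₂ (at-level (inv s) i))
  corners-at i = TC.count-to (λ {x} h → trans (θ-label x) (cong (λ k → + k ℤ.+ shift) h)) label⇒level (proj₂ (proj₂ (inv-spec s pre) i))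

  relabelled : ∀ {s′ : Str N} → Iso s s′ → RepL L s′
  relabelled {s′} f = record
    { pre = iso-pre f pre ; θ = θ ∘ from ; θ⁻¹ = to ∘ θ⁻¹
    ; θ⁻¹-θ = λ x → trans (cong to (θ⁻¹-θ _)) (to-from x) ; θ-θ⁻¹ = λ y → trans (cong θ (from-to _)) (θ-θ⁻¹ y)
    ; θ₀ = λ x → trans (cong θ (g.iso₀ x)) (θ₀ _) ; θ₁ = λ x → trans (cong θ (g.iso₁ x)) (θ₁ _) ; θ₂ = λ x → trans (cong θ (g.iso₂ x)) (θ₂ _)
    ; shift = shift ; θ-label = λ x → trans (θ-label _) (cong (λ k → + k ℤ.+ shift) (g.iso-ℓ x))
    ; θ-root = trans (cong θ g.iso-r) θ-root }
    where
    open Iso f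
    module g = Iso (iso-sym f)

  min-shift : ∀ {ℓmin} → IsMinLabel L ℓmin → ℓmin ≡ + 1 ℤ.+ shift
  min-shift {ℓmin} ((x , hx) , low) = ℤₚ.≤-antisym
    (subst (ℓmin ℤ.≤_) (trans (θ-label _) (cong (λ k → + k ℤ.+ shift) (proj₂ lowest))) (low _))
    (subst (+ 1 ℤ.+ shift ℤ.≤_) (trans (sym (θ-label _)) (trans (cong label (θ-θ⁻¹ x)) hx))
      (ℤₚ.+-monoˡ-≤ shift (ℤ.+≤+ (positive (θ⁻¹ x)))))

module _ {S : Surface} {n : ℕ} {L L′ : LUMap S n} {N : ℕ} {s s′ : Str N} (rep : RepL L s) (rep′ : RepL L′ s′) where

  private
    module A = RepLLaws rep
    module B = RepLLaws rep′
    module m = RootedMap (LUMap.m L)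
    module m′ = RootedMap (LUMap.m L′)

  ≅L⇒iso : L ≅L L′ → Iso s s′
  ≅L⇒iso (φ , lab) = record
    { to = B.θ⁻¹ ∘ to ∘ A.θ ; from = A.θ⁻¹ ∘ from ∘ B.θ
    ; from-to = λ x → trans (cong (A.θ⁻¹ ∘ from) (B.θ-θ⁻¹ _)) (trans (cong A.θ⁻¹ (from-to _)) (A.θ⁻¹-θ x))
    ; to-from = λ x → trans (cong (B.θ⁻¹ ∘ to) (A.θ-θ⁻¹ _)) (trans (cong B.θ⁻¹ (to-from _)) (B.θ⁻¹-θ x))
    ; iso₀ = λ x → trans (cong (B.θ⁻¹ ∘ to) (A.θ₀ x)) (trans (cong B.θ⁻¹ (comm₀ _)) (B.θ⁻¹-comm {Str.τ₀ s′} {m′.τ₀} B.θ₀ _))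
    ; iso₁ = λ x → trans (cong (B.θ⁻¹ ∘ to) (A.θ₁ x)) (trans (cong B.θ⁻¹ (comm₁ _)) (B.θ⁻¹-comm {Str.τ₁ s′} {m′.τ₁} B.θ₁ _))
    ; iso₂ = λ x → trans (cong (B.θ⁻¹ ∘ to) (A.θ₂ x)) (trans (cong B.θ⁻¹ (comm₂ _)) (B.θ⁻¹-comm {Str.τ₂ s′} {m′.τ₂} B.θ₂ _))
    ; iso-ℓ = λ x → B.label⇒level (trans (lab _) (trans (A.θ-label x) (cong (λ z → + Str.ℓ s x ℤ.+ z) (sym shift≡))))
    ; iso-r = trans (cong (B.θ⁻¹ ∘ to) A.θ-root) (trans (cong B.θ⁻¹ (trans root-pres (sym B.θ-root))) (B.θ⁻¹-θ _)) }
    where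
    open RIso φ
    min′ : IsMinLabel L′ (+ 1 ℤ.+ A.shift)
    min′ = (to (A.θ (proj₁ A.lowest)) , trans (lab _) (trans (A.θ-label _) (cong (λ k → + k ℤ.+ A.shift) (proj₂ A.lowest)))) ,
      λ y → subst (+ 1 ℤ.+ A.shift ℤ.≤_)
        (trans (sym (A.θ-label _)) (trans (cong (LUMap.label L) (A.θ-θ⁻¹ _)) (trans (sym (lab _)) (cong (LUMap.label L′) (to-from y)))))
        (ℤₚ.+-monoˡ-≤ A.shift (ℤ.+≤+ (A.positive (A.θ⁻¹ (from y)))))
    shift≡ : B.shift ≡ A.shift
    shift≡ = +-cancelˡ (+ 1) (sym (B.min-shift min′))

  iso⇒≅L : Iso s s′ → L ≅L L′
  iso⇒≅L f = record
    { to = B.θ ∘ to ∘ A.θ⁻¹ ; from = A.θ ∘ from ∘ B.θ⁻¹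
    ; from-to = λ x → trans (cong (A.θ ∘ from) (B.θ⁻¹-θ _)) (trans (cong A.θ (from-to _)) (A.θ-θ⁻¹ x))
    ; to-from = λ x → trans (cong (B.θ ∘ to) (A.θ⁻¹-θ _)) (trans (cong B.θ (to-from _)) (B.θ-θ⁻¹ x))
    ; comm₀ = λ x → trans (cong (B.θ ∘ to) (A.θ⁻¹-comm {Str.τ₀ s} {m.τ₀} A.θ₀ x)) (trans (cong B.θ (iso₀ _)) (B.θ₀ _))
    ; comm₁ = λ x → trans (cong (B.θ ∘ to) (A.θ⁻¹-comm {Str.τ₁ s} {m.τ₁} A.θ₁ x)) (trans (cong B.θ (iso₁ _)) (B.θ₁ _))
    ; comm₂ = λ x → trans (cong (B.θ ∘ to) (A.θ⁻¹-comm {Str.τ₂ s} {m.τ₂} A.θ₂ x)) (trans (cong B.θ (iso₂ _)) (B.θ₂ _))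
    ; root-pres = trans (cong (B.θ ∘ to) (trans (cong A.θ⁻¹ (sym A.θ-root)) (A.θ⁻¹-θ _))) (trans (cong B.θ iso-r) B.θ-root) } ,
    λ x → trans (B.θ-label _) (trans (cong₂ (λ a b → + a ℤ.+ b) (iso-ℓ _) (sym shift≡)) (trans (sym (A.θ-label _)) (cong (LUMap.label L) (A.θ-θ⁻¹ x))))
    where
    open Iso f
    shift≡ : A.shift ≡ B.shift
    shift≡ = +-cancelˡ (+ Str.ℓ s (Str.root s))
      (trans (sym (A.θ-label _)) (trans (cong (LUMap.label L) A.θ-root) (trans (LUMap.label-root L)
        (trans (sym (LUMap.label-root L′)) (trans (cong (LUMap.label L′) (sym B.θ-root)) (trans (B.θ-label _)
          (cong (λ k → + k ℤ.+ B.shift) (trans (cong (Str.ℓ s′) (sym iso-r)) (iso-ℓ _)))))))))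

edge-count : ∀ {n} (s : Str (n * 4)) → Pre s → HasClassCount (Conn (Str.τ₀ s) (Str.τ₂ s)) (λ _ → ⊤) n
edge-count {n} s (fr , _) = subst (HasClassCount (Conn (Str.τ₀ s) (Str.τ₂ s)) _) (sym (ℕₚ.*-cancelʳ-≡ n _ 4 (klein-blocks τ₀-inv τ₂-inv τ₀-fpf τ₂-fpf comm τ₀τ₂-fpf (proj₂ c)))) (proj₂ c)
  where
  open Frame fr
  c = classCount (conn-equiv τ₀-inv τ₂-inv) (Warshall.star? _ (λ x y → (y Finₚ.≟ Str.τ₀ s x) ⊎-dec (y Finₚ.≟ Str.τ₂ s x))) {λ _ → ⊤} (λ _ → yes tt)

closure-count : ∀ {k} {R : Fin k → Fin k → Set} → (∀ {x y} → R x y → R y x) → ∀ {P : Fin k → Set} {m} → HasClassCount (Star R) P m → HasClassCount (Closure R) P m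
closure-count R-sym = Transfer.count-to R-sym R-sym id id (λ _ → refl) (λ _ → refl) id id id id

star-count : ∀ {k} {R : Fin k → Fin k → Set} → (∀ {x y} → R x y → R y x) → ∀ {P : Fin k → Set} {m} → HasClassCount (Closure R) P m → HasClassCount (Star R) P m
star-count R-sym = Transfer.count-from R-sym R-sym id id (λ _ → refl) (λ _ → refl) id id id id

module FromFunctions {N : ℕ} (t₀ t₁ t₂ : Fin N → Fin N) (lev : Fin N → ℕ) (bound : ∀ x → lev x < suc N) (r : Fin N) where

  str : Str N
  str = mk (tabulate t₀) (tabulate t₁) (tabulate t₂) (tabulate λ x → fromℕ< (bound x)) r

  open Str str

  τ₀≡ : ∀ x → τ₀ x ≡ t₀ x
  τ₀≡ = Vecₚ.lookup∘tabulate t₀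

  τ₁≡ : ∀ x → τ₁ x ≡ t₁ x
  τ₁≡ = Vecₚ.lookup∘tabulate t₁

  τ₂≡ : ∀ x → τ₂ x ≡ t₂ x
  τ₂≡ = Vecₚ.lookup∘tabulate t₂

  ℓ≡ : ∀ x → ℓ x ≡ lev x
  ℓ≡ x = trans (cong toℕ (Vecₚ.lookup∘tabulate (λ x → fromℕ< (bound x)) x)) (Finₚ.toℕ-fromℕ< (bound x))

  str-pre : Frame t₀ t₂ lev → Gluing lev t₁ → Pre str
  str-pre fr gl = record
    { τ₀-inv = λ x → trans (twice {τ₀} {τ₀} τ₀≡ τ₀≡ x) (fr.τ₀-inv x)
    ; τ₂-inv = λ x → trans (twice {τ₂} {τ₂} τ₂≡ τ₂≡ x) (fr.τ₂-inv x)
    ; τ₀-fpf = λ x h → fr.τ₀-fpf x (trans (sym (τ₀≡ x)) h)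
    ; τ₂-fpf = λ x h → fr.τ₂-fpf x (trans (sym (τ₂≡ x)) h)
    ; comm = λ x → trans (twice {τ₀} {τ₂} τ₀≡ τ₂≡ x) (trans (fr.comm x) (sym (twice {τ₂} {τ₀} τ₂≡ τ₀≡ x)))
    ; τ₀τ₂-fpf = λ x h → fr.τ₀τ₂-fpf x (trans (sym (twice {τ₀} {τ₂} τ₀≡ τ₂≡ x)) h)
    ; ℓ-τ₂ = λ x → trans (cong ℓ (τ₂≡ x)) (trans (ℓ≡ _) (trans (fr.ℓ-τ₂ x) (sym (ℓ≡ x))))
    ; adjacent = λ x → subst₂ (λ a b → a ≡ suc b ⊎ a ≡ b ⊎ suc a ≡ b) (sym (trans (cong ℓ (τ₀≡ x)) (ℓ≡ _))) (sym (ℓ≡ x)) (fr.adjacent x)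
    ; positive = λ x → subst (1 ≤_) (sym (ℓ≡ x)) (fr.positive x)
    ; bounded = λ x → subst (_≤ N) (sym (ℓ≡ x)) (fr.bounded x)
    ; lowest = proj₁ fr.lowest , trans (ℓ≡ _) (proj₂ fr.lowest) } , record
    { τ₁-inv = λ x → trans (twice {τ₁} {τ₁} τ₁≡ τ₁≡ x) (gl.τ₁-inv x)
    ; τ₁-fpf = λ x h → gl.τ₁-fpf x (trans (sym (τ₁≡ x)) h)
    ; ℓ-τ₁ = λ x → trans (cong ℓ (τ₁≡ x)) (trans (ℓ≡ _) (trans (gl.ℓ-τ₁ x) (sym (ℓ≡ x)))) }
    where
    module fr = Frame fr
    module gl = Gluing gl
    twice : ∀ {f g f′ g′ : Fin N → Fin N} → (∀ x → f x ≡ f′ x) → (∀ x → g x ≡ g′ x) → ∀ x → f (g x) ≡ f′ (g′ x)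
    twice {f} hf hg x = trans (cong f (hg x)) (hf _)

opaque

  decodeL : ∀ {S n} (s : Str (n * 4)) → GoodU S n s → Σ (LUMap S n) λ L → RepL L s
  decodeL {S} {n} s (pre , one , orient , euler) = L , record
      { pre = pre ; θ = id ; θ⁻¹ = id ; θ⁻¹-θ = λ _ → refl ; θ-θ⁻¹ = λ _ → refl ; θ₀ = λ _ → refl ; θ₁ = λ _ → refl ; θ₂ = λ _ → refl
      ; shift = shift ; θ-label = λ _ → refl ; θ-root = refl }
    where
    open Str s
    open Frame (proj₁ pre)
    open Gluing (proj₂ pre)
    shift : ℤ
    -- Forced by the label 1 of the root vertex.
    shift = + 1 ℤ.- + ℓ root
    M : Map
    M = record
      { size = n * 4 ; τ₀ = τ₀ ; τ₁ = τ₁ ; τ₂ = τ₂ ; τ₀-inv = τ₀-inv ; τ₁-inv = τ₁-inv ; τ₂-inv = τ₂-inv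
      ; τ₀-fpf = τ₀-fpf ; τ₁-fpf = τ₁-fpf ; τ₂-fpf = τ₂-fpf ; τ₀τ₂-comm = comm ; τ₀τ₂-fpf = τ₀τ₂-fpf
      ; connected = λ x y → Star⇒Closure (Star.map inj₁ (one x y)) }
    face : Map.IsUnicellular M
    face = (λ _ → root) , (λ _ → tt) , (λ { zero zero _ → refl }) , λ x _ → zero , Star⇒Closure (one x root)
    edges : Map.#E M n
    edges = closure-count (step₂-sym τ₀-inv τ₂-inv) (edge-count s pre)
    L : LUMap S n
    L = record
      { m = record { map = M ; root = root } ; label = λ x → + ℓ x ℤ.+ shift
      ; label-v₁ = λ x → cong (λ k → + k ℤ.+ shift) (ℓ-τ₁ x) ; label-v₂ = λ x → cong (λ k → + k ℤ.+ shift) (ℓ-τ₂ x)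
      ; label-root = root-label (+ ℓ root)
      ; label-adj = λ x → subst (λ z → ℤ.∣ z ∣ ≤ 1) (sym (cancel-shift (+ ℓ x) (+ ℓ (τ₀ x)) shift)) (labels-adjacent _ _ (adjacent x))
      ; unicell = face
      ; onS = ⇒onSurface S (orientedAs-map S
          (λ (c , a , b , d) → c , (not⇒¬≡ ∘ a) , (not⇒¬≡ ∘ b) , (not⇒¬≡ ∘ d))
          (λ (c , a , b , d) → c , (¬≡⇒not ∘ a) , (¬≡⇒not ∘ b) , (¬≡⇒not ∘ d)) orient)
          (_ , _ , _ , closure-count (step₂-sym τ₁-inv τ₂-inv) (proj₁ (inv-spec s pre)) , edges , face , euler)
      ; edges = edges }
      where
      root-label : ∀ r → r ℤ.+ (+ 1 ℤ.- r) ≡ + 1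
      root-label = solve-∀

  encodeL : ∀ {S n} (L : LUMap S n) → Σ (Str (n * 4)) λ s → RepL L s
  encodeL {S} {n} L = subst (λ N → Σ (Str N) λ s → RepL L s)
      (klein-blocks M.τ₀-inv M.τ₂-inv M.τ₀-fpf M.τ₂-fpf M.τ₀τ₂-comm M.τ₀τ₂-fpf (star-count (step₂-sym M.τ₀-inv M.τ₂-inv) edges))
      (S.str , rep)
    where
    open LUMap L
    module M = RootedMap m
    min : ∃ λ x → ∀ y → label x ℤ.≤ label y
    min = let x , _ , low = argmin label M.root (List.allFin M.size) in x , λ y → low y (∈-allFin y)
    x₀ : Fin M.size
    x₀ = proj₁ min
    lev : Fin M.size → ℕ
    -- The difference to a minimal label is nonnegative, so the absolute value loses nothing; `suc`
    -- puts the minimum at level 1.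
    lev x = suc ℤ.∣ label x ℤ.- label x₀ ∣
    shift : ℤ
    shift = label x₀ ℤ.- + 1
    lev-label : ∀ x → label x ≡ + lev x ℤ.+ shift
    lev-label x = trans (rearrange (label x) (label x₀))
      (cong (λ z → (+ 1 ℤ.+ z) ℤ.+ shift) (sym (ℤₚ.0≤i⇒+∣i∣≡i (ℤₚ.i≤j⇒0≤j-i (proj₂ min x)))))
      where
      rearrange : ∀ a b → a ≡ (+ 1 ℤ.+ (a ℤ.- b)) ℤ.+ (b ℤ.- + 1)
      rearrange = solve-∀
    lev-adjacent : ∀ x → lev (M.τ₀ x) ≡ suc (lev x) ⊎ lev (M.τ₀ x) ≡ lev x ⊎ suc (lev (M.τ₀ x)) ≡ lev x
    lev-adjacent x = adjacent-labels (lev x) (lev (M.τ₀ x)) (subst (λ z → ℤ.∣ z ∣ ≤ 1)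
      (trans (cong₂ ℤ._-_ (lev-label x) (lev-label (M.τ₀ x))) (cancel-shift (+ lev x) (+ lev (M.τ₀ x)) shift)) (label-adj x))
    lev-x₀ : lev x₀ ≡ 1
    lev-x₀ = cong (suc ∘ ℤ.∣_∣) (ℤₚ.+-inverseʳ (label x₀))
    lev₁ : ∀ x → lev (M.τ₁ x) ≡ lev x
    lev₁ x = cong (λ z → suc ℤ.∣ z ℤ.- label x₀ ∣) (label-v₁ x)
    lev₂ : ∀ x → lev (M.τ₂ x) ≡ lev x
    lev₂ x = cong (λ z → suc ℤ.∣ z ℤ.- label x₀ ∣) (label-v₂ x)
    -- A step changes the level by at most 1, so a path from x to level 1 passes through every level
    -- in between.
    descend : ∀ {x y} i → 1 ≤ i → i ≤ lev x → lev y ≡ 1 → Closure M.AnyStep x y → ∃ λ z → lev z ≡ i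
    descend {x} i 1≤i i≤ hy c with lev x ℕ.≟ i
    ... | yes e = x , e
    descend i 1≤i i≤ hy here | no ≢ = contradiction (ℕₚ.≤-antisym (subst (_≤ i) (sym hy) 1≤i) i≤) ≢
    descend {x} i 1≤i i≤ hy (step (inj₁ (inj₁ refl)) c) | no ≢ = descend i 1≤i (next (lev-adjacent x)) hy c
      where
      i< : i < lev x
      i< = ℕₚ.≤∧≢⇒< i≤ (≢ ∘ sym)
      next : lev (M.τ₀ x) ≡ suc (lev x) ⊎ lev (M.τ₀ x) ≡ lev x ⊎ suc (lev (M.τ₀ x)) ≡ lev x → i ≤ lev (M.τ₀ x)
      next (inj₁ h)        = ℕₚ.≤-trans i≤ (ℕₚ.≤-trans (ℕₚ.n≤1+n _) (ℕₚ.≤-reflexive (sym h)))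
      next (inj₂ (inj₁ h)) = ℕₚ.≤-trans i≤ (ℕₚ.≤-reflexive (sym h))
      next (inj₂ (inj₂ h)) = ℕₚ.≤-pred (ℕₚ.≤-trans i< (ℕₚ.≤-reflexive (sym h)))
    descend {x} i 1≤i i≤ hy (step (inj₁ (inj₂ refl)) c) | no ≢ = descend i 1≤i (subst (i ≤_) (sym (lev₁ x)) i≤) hy c
    descend {x} i 1≤i i≤ hy (step (inj₂ refl) c) | no ≢ = descend i 1≤i (subst (i ≤_) (sym (lev₂ x)) i≤) hy c
    bound : ∀ x → lev x < suc M.size
    bound x = s≤s (level-bound lev (λ x i 1≤i i≤ → descend i 1≤i i≤ lev-x₀ (M.connected x x₀)) x)
    module S = FromFunctions M.τ₀ M.τ₁ M.τ₂ lev bound M.root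
    rep : RepL L S.str
    rep = record
      { pre = S.str-pre
          (record { τ₀-inv = M.τ₀-inv ; τ₂-inv = M.τ₂-inv ; τ₀-fpf = M.τ₀-fpf ; τ₂-fpf = M.τ₂-fpf ; comm = M.τ₀τ₂-comm
            ; τ₀τ₂-fpf = M.τ₀τ₂-fpf ; ℓ-τ₂ = lev₂ ; adjacent = lev-adjacent ; positive = λ _ → s≤s z≤n
            ; bounded = λ x → ℕₚ.≤-pred (bound x) ; lowest = x₀ , lev-x₀ })
          (record { τ₁-inv = M.τ₁-inv ; τ₁-fpf = M.τ₁-fpf ; ℓ-τ₁ = lev₁ })
      ; θ = id ; θ⁻¹ = id ; θ⁻¹-θ = λ _ → refl ; θ-θ⁻¹ = λ _ → refl ; θ₀ = S.τ₀≡ ; θ₁ = S.τ₁≡ ; θ₂ = S.τ₂≡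
      ; shift = shift ; θ-label = λ x → trans (lev-label x) (cong (λ k → + k ℤ.+ shift) (sym (S.ℓ≡ x))) ; θ-root = refl }

-- Quadrangulations as structures

parity : ℕ → Bool
parity zero    = true
parity (suc n) = not (parity n)

xor-notˡ : ∀ a b → not a xor b ≡ not (a xor b)
xor-notˡ true  b = sym (Boolₚ.not-involutive b)
xor-notˡ false b = refl

xor-notʳ : ∀ a b → a xor not b ≡ not (a xor b)
xor-notʳ true  b = refl
xor-notʳ false b = refl

-- Walks, distances and face degrees in a map

module MapLemmas (M : Map) where

  open Map M

  sameV-equiv : IsEquivalence SameV
  sameV-equiv = closure-isEquiv (step₂-sym τ₁-inv τ₂-inv)

  sameE-equiv : IsEquivalence SameE
  sameE-equiv = closure-isEquiv (step₂-sym τ₀-inv τ₂-inv)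

  sameF-equiv : IsEquivalence SameF
  sameF-equiv = closure-isEquiv (step₂-sym τ₀-inv τ₁-inv)

  sameC-equiv : IsEquivalence SameC
  sameC-equiv = closure-isEquiv (flip-involution τ₁-inv)

  walk-around : ∀ {k x y z} → Walk k x y → SameV y z → Walk k x z
  walk-around stay       here       = stay
  walk-around stay       (step s c) = turn s (walk-around stay c)
  walk-around (turn s w) c          = turn s (walk-around w c)
  walk-around (go w)     c          = go (walk-around w c)

  around-walk : ∀ {k x y z} → SameV x y → Walk k y z → Walk k x z
  around-walk here       w = w
  around-walk (step s c) w = turn s (around-walk c w)

  walk-go : ∀ {k x y} → Walk k x y → Walk (suc k) x (τ₀ y)
  walk-go stay       = go stay
  walk-go (turn s w) = turn s (walk-go w)
  walk-go (go w)     = go (walk-go w)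

  walk-zero : ∀ {x y} → Walk 0 x y → SameV x y
  walk-zero stay       = here
  walk-zero (turn s w) = step s (walk-zero w)

  walk-first : ∀ {k x y} → Walk (suc k) x y → ∃ λ z → SameV x z × Walk k (τ₀ z) y
  walk-first (turn s w) = let z , c , v = walk-first w in z , step s c , v
  walk-first (go w)     = _ , here , w

  walk-last : ∀ {k x y} → Walk (suc k) x y → ∃ λ w → Walk k x w × SameV (τ₀ w) y
  walk-last {zero} w = let z , c , v = walk-first w in z , walk-around stay c , walk-zero v
  walk-last {suc k} w with walk-first w
  ... | z , c , v with walk-last v
  ...   | u , p , q = u , around-walk c (go p) , q

  dist-unique : ∀ {x y i j} → Dist x y i → Dist x y j → i ≡ j
  dist-unique {i = i} {j} (w , low) (w′ , low′) with ℕₚ.<-cmp i j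
  ... | tri< i<j _ _ = contradiction w (low′ i i<j)
  ... | tri≈ _ e _   = e
  ... | tri> _ _ j<i = contradiction w′ (low j j<i)

  dist-≤ : ∀ {x y i k} → Dist x y i → Walk k x y → i ≤ k
  dist-≤ (_ , low) w = ℕₚ.≮⇒≥ λ k<i → low _ k<i w

  open Dihedral τ₀ τ₁ τ₀-inv τ₁-inv

  private
    K : Fin size → ℕ
    K x = suc (proj₁ (order rot rot-inj x))

  rot-face : ∀ k x → SameF x (iter rot k x)
  rot-face k x = Star⇒Closure (run k)
    where
    run : ∀ k → Star FStep x (iter rot k x)
    run zero    = ε
    run (suc k) = run k ◅◅ inj₁ refl ◅ inj₂ refl ◅ ε

  face-orbit : ∀ {x y} → SameF x y → ∃ λ k → y ≡ iter rot k x ⊎ τ₁ y ≡ iter rot k x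
  face-orbit {x} c = run 0 (inj₁ refl) (Closure⇒Star c)
    where
    run : ∀ k {w y} → w ≡ iter rot k x ⊎ τ₁ w ≡ iter rot k x → Star FStep w y → ∃ λ k → y ≡ iter rot k x ⊎ τ₁ y ≡ iter rot k x
    run k h ε = k , h
    run k (inj₁ refl) (inj₁ refl ◅ c) = run (suc k) (inj₂ refl) c
    run k (inj₁ refl) (inj₂ refl ◅ c) = run k (inj₂ (τ₁-inv _)) c
    run k (inj₂ h)    (inj₂ refl ◅ c) = run k (inj₁ h) c
    run zero {w} (inj₂ h) (inj₁ refl ◅ c) with inverse-power 1 x
    ... | m , e , _ = run m (inj₁ (trans (cong τ₀ (trans (sym (τ₁-inv w)) (cong τ₁ h))) (sym e))) c
    run (suc k) {w} (inj₂ h) (inj₁ refl ◅ c) = run k (inj₁ (trans (cong τ₀ (trans (sym (τ₁-inv w)) (trans (cong τ₁ h) (τ₁-inv _)))) (τ₀-inv _))) c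

  no-reflection : ∀ x i j → ¬ iter rot i x ≡ τ₁ (iter rot j x)
  no-reflection x i (suc j) h = rot≢σ-rot τ₀-fpf τ₁-fpf x i j (trans h (τ₁-inv _))
  no-reflection x i zero    h with periodic rot rot-inj x
  ... | k , e = rot≢σ-rot τ₀-fpf τ₁-fpf x i k (trans h (trans (cong τ₁ (sym e)) (τ₁-inv _)))

  sameC-cases : ∀ {x y} → SameC x y → y ≡ x ⊎ y ≡ τ₁ x
  sameC-cases c = run (inj₁ refl) (Closure⇒Star c)
    where
    run : ∀ {x w y} → w ≡ x ⊎ w ≡ τ₁ x → Star CStep w y → y ≡ x ⊎ y ≡ τ₁ x
    run h ε = h
    run (inj₁ refl) (refl ◅ c) = run (inj₂ refl) c
    run (inj₂ refl) (refl ◅ c) = run (inj₁ (τ₁-inv _)) c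

  -- On its way around the face, `rot` meets each corner through only one of its two flags, by
  -- `no-reflection`. The corners are therefore counted by the period of `rot`.
  faceDegree : ∀ x k → iter rot (suc k) x ≡ x → (∀ j → j < k → ¬ iter rot (suc j) x ≡ x) → FaceDegree x (suc k)
  faceDegree x k per low = (λ i → iter rot (toℕ i) x) , (λ i → rot-face (toℕ i) x) , inj , sur
    where
    inj′ : ∀ i j → i < j → j < suc k → ¬ iter rot i x ≡ iter rot j x
    inj′ i j i<j j<k h = low m (ℕₚ.≤-pred (ℕₚ.≤-<-trans (subst (suc m ≤_) eq (ℕₚ.m≤n+m (suc m) i)) j<k))
        (iter-injective rot rot-inj i (trans (sym (iter-+ rot i (suc m) x)) (trans (cong (λ t → iter rot t x) eq) (sym h))))
      where
      m : ℕ
      m = j ∸ suc i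
      eq : i + suc m ≡ j
      eq = trans (ℕₚ.+-suc i m) (ℕₚ.m+[n∸m]≡n i<j)
    inj : ∀ i j → SameC (iter rot (toℕ i) x) (iter rot (toℕ j) x) → i ≡ j
    inj i j c with sameC-cases c
    ... | inj₂ h = contradiction h (no-reflection x (toℕ j) (toℕ i))
    ... | inj₁ h with ℕₚ.<-cmp (toℕ i) (toℕ j)
    ...   | tri< i<j _ _ = contradiction (sym h) (inj′ _ _ i<j (Finₚ.toℕ<n j))
    ...   | tri≈ _ e _   = Finₚ.toℕ-injective e
    ...   | tri> _ _ j<i = contradiction h (inj′ _ _ j<i (Finₚ.toℕ<n i))
    sur : ∀ y → SameF x y → Σ (Fin (suc k)) λ i → SameC y (iter rot (toℕ i) x)
    sur y c with face-orbit c
    ... | m , h = fromℕ< (m%n<n m (suc k)) , corner (subst (λ z → y ≡ z ⊎ τ₁ y ≡ z) red h)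
      where
      red : iter rot m x ≡ iter rot (toℕ (fromℕ< (m%n<n m (suc k)))) x
      red = trans (cong (λ t → iter rot t x) (m≡m%n+[m/n]*n m (suc k)))
        (trans (iter-+ rot (m % suc k) _ x) (trans (cong (iter rot (m % suc k)) (iter-fix-* rot (suc k) per (m / suc k)))
          (cong (λ t → iter rot t x) (sym (Finₚ.toℕ-fromℕ< (m%n<n m (suc k)))))))
      corner : ∀ {z} → y ≡ z ⊎ τ₁ y ≡ z → SameC y z
      corner (inj₁ refl) = here
      corner (inj₂ refl) = step refl here

  square⇒degree : ∀ x → iter rot 4 x ≡ x → ¬ iter rot 2 x ≡ x → FaceDegree x 4
  square⇒degree x four two = faceDegree x 3 four λ
    { zero _ h → two (trans (cong rot h) h)
    ; (suc zero) _ h → two h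
    ; (suc (suc zero)) _ h → two (let e = trans (cong rot (sym h)) four in trans (cong rot e) e)
    ; (suc (suc (suc _))) (s≤s (s≤s (s≤s ()))) _ }

  degree⇒square : ∀ x → FaceDegree x 4 → iter rot 4 x ≡ x × ¬ iter rot 2 x ≡ x
  degree⇒square x deg with order rot rot-inj x
  ... | k , per , low with ℕₚ.suc-injective (classCount-unique sameC-equiv (faceDegree x k per low) deg)
  ...   | refl = per , low 1 (s≤s (s≤s z≤n))

-- θ identifies the flags of M with the ends of the sides of s, and the height of an end with its
-- distance to v₀.
record RepM (M : Map) (v₀ : Fin (Map.size M)) {N : ℕ} (s : Str N) : Set where
  private
    module M = Map M
    module s = Str s
  open Sides s.τ₀ s.τ₁ s.τ₂ s.ℓ
  field
    pre    : Pre s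
    θ      : Flag → Fin M.size
    θ⁻¹    : Fin M.size → Flag
    θ⁻¹-θ  : ∀ a → θ⁻¹ (θ a) ≡ a
    θ-θ⁻¹  : ∀ y → θ (θ⁻¹ y) ≡ y
    θ₀     : ∀ a → θ (T₀ a) ≡ M.τ₀ (θ a)
    θ₁     : ∀ a → θ (T₁ a) ≡ M.τ₁ (θ a)
    θ₂     : ∀ a → θ (T₂ a) ≡ M.τ₂ (θ a)
    θ-dist : ∀ a → M.Dist v₀ (θ a) (ht a)

module RepMLaws {M : Map} {v₀ : Fin (Map.size M)} {N : ℕ} {s : Str N} (rep : RepM M v₀ s) where

  open RepM rep public
  private
    module M = Map M
    module s = Str s
  open MapLemmas M
  open SideLaws (proj₁ pre) (proj₂ pre) public

  τ₀-θ⁻¹ : ∀ y → θ⁻¹ (M.τ₀ y) ≡ T₀ (θ⁻¹ y)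
  τ₀-θ⁻¹ y = trans (cong (θ⁻¹ ∘ M.τ₀) (sym (θ-θ⁻¹ y))) (trans (cong θ⁻¹ (sym (θ₀ _))) (θ⁻¹-θ _))

  τ₁-θ⁻¹ : ∀ y → θ⁻¹ (M.τ₁ y) ≡ T₁ (θ⁻¹ y)
  τ₁-θ⁻¹ y = trans (cong (θ⁻¹ ∘ M.τ₁) (sym (θ-θ⁻¹ y))) (trans (cong θ⁻¹ (sym (θ₁ _))) (θ⁻¹-θ _))

  τ₂-θ⁻¹ : ∀ y → θ⁻¹ (M.τ₂ y) ≡ T₂ (θ⁻¹ y)
  τ₂-θ⁻¹ y = trans (cong (θ⁻¹ ∘ M.τ₂) (sym (θ-θ⁻¹ y))) (trans (cong θ⁻¹ (sym (θ₂ _))) (θ⁻¹-θ _))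

  vertex-to : ∀ {a b} → Vertex a b → M.SameV (θ a) (θ b)
  vertex-to = Star⇒Closure ∘ Star.gmap θ λ { (inj₁ refl) → inj₁ (θ₁ _) ; (inj₂ refl) → inj₂ (θ₂ _) }

  vertex-from : ∀ {y z} → M.SameV y z → Vertex (θ⁻¹ y) (θ⁻¹ z)
  vertex-from = Star.gmap θ⁻¹ (λ { (inj₁ refl) → inj₁ (τ₁-θ⁻¹ _) ; (inj₂ refl) → inj₂ (τ₂-θ⁻¹ _) }) ∘ Closure⇒Star

  face-to : ∀ {a b} → Face a b → M.SameF (θ a) (θ b)
  face-to = Star⇒Closure ∘ Star.gmap θ λ { (inj₁ refl) → inj₁ (θ₀ _) ; (inj₂ refl) → inj₂ (θ₁ _) }

  face-from : ∀ {y z} → M.SameF y z → Face (θ⁻¹ y) (θ⁻¹ z)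
  face-from = Star.gmap θ⁻¹ (λ { (inj₁ refl) → inj₁ (τ₀-θ⁻¹ _) ; (inj₂ refl) → inj₂ (τ₁-θ⁻¹ _) }) ∘ Closure⇒Star

  vertex-back : ∀ {a b} → M.SameV (θ a) (θ b) → Vertex a b
  vertex-back {a} {b} c = subst₂ Vertex (θ⁻¹-θ a) (θ⁻¹-θ b) (vertex-from c)

  dist-of : ∀ y → M.Dist v₀ y (ht (θ⁻¹ y))
  dist-of y = subst (λ z → M.Dist v₀ z (ht (θ⁻¹ y))) (θ-θ⁻¹ y) (θ-dist (θ⁻¹ y))

  at-bottom : ∀ a → ht a ≡ 0 → M.SameV v₀ (θ a)
  at-bottom a h = walk-zero (subst (λ k → M.Walk k v₀ (θ a)) h (proj₁ (θ-dist a)))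

  -- Height 0 occurs only at the vertex v₀. The last edge of a shortest walk to any other vertex
  -- arrives there at an upper end, and turning around the vertex from a lower end to an upper one
  -- passes a flag leading down.
  desc : Desc s.τ₁ s.τ₂
  desc = a , b
    where
    a : ∀ x z → s.ℓ x ≡ 1 → s.ℓ z ≡ 1 → Conn s.τ₁ (low s.τ₂) x z
    a x z hx hz with vertex⇒low ε refl (vertex-back (IsEquivalence.trans sameV-equiv
        (IsEquivalence.sym sameV-equiv (at-bottom (x , false) (cong ℕ.pred hx))) (at-bottom (z , false) (cong ℕ.pred hz))))
    ... | inj₂ (_ , refl , c) = c
    ... | inj₁ (w , d , c) = contradiction (positive (s.τ₀ w)) (subst (λ k → ¬ 1 ≤ k)
            (sym (ℕₚ.suc-injective (trans d (trans (Glued.conn-level (proj₁ pre) (proj₂ pre) return-τ₂ c) hx)))) λ ())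
    b : ∀ x → 2 ≤ s.ℓ x → ∃ λ z → Down z × Conn s.τ₁ (low s.τ₂) x z
    b x h = go (s.ℓ x) refl h
      where
      finish : ∀ {k} z c → k ≡ ht (z , c) → ht (T₀ (z , c)) < k → Vertex (x , false) (z , c) → ∃ λ z → Down z × Conn s.τ₁ (low s.τ₂) x z
      finish z false refl lt v = contradiction lt (ℕₚ.≤⇒≯ (ℕₚ.pred[n]≤n))
      finish z true  _    lt v with vertex⇒low ε refl v
      ... | inj₁ d = d
      go : ∀ n → s.ℓ x ≡ n → 2 ≤ n → ∃ λ z → Down z × Conn s.τ₁ (low s.τ₂) x z
      go (suc zero)    e (s≤s ())
      go (suc (suc k)) e _ with walk-last (subst (λ j → M.Walk j v₀ (θ (x , false))) (cong ℕ.pred e) (proj₁ (θ-dist (x , false))))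
      ... | w , wk , c = finish {suc k} (proj₁ t) (proj₂ t) (sym (trans (ht-vertex v) (cong ℕ.pred e)))
              (subst (λ a → ht a < suc k) (trans (cong θ⁻¹ (sym (M.τ₀-inv w))) (τ₀-θ⁻¹ _)) (s≤s (dist-≤ (dist-of w) wk))) v
        where
        t : Flag
        t = θ⁻¹ (M.τ₀ w)
        v : Vertex (x , false) t
        v = subst (λ a → Vertex a t) (θ⁻¹-θ _) (vertex-from (IsEquivalence.sym sameV-equiv c))

  open Descending desc public

  oneFaced-G : OneFaced (G s)
  oneFaced-G = let q , e = G-spec s pre in subst OneFaced (sym e) (desc⇒oneFaced s q desc)

  colour-T₁ : ∀ {c : Fin N → Bool} → Orients c s.τ₀ → Orients c s.τ₂ → ∀ a → c (proj₁ (T₁ a)) ≡ not (c (proj₁ a))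
  colour-T₁ c₀ c₂ (x , true) with up? x
  ... | yes _ = c₀ x
  ... | no _  = c₂ x
  colour-T₁ c₀ c₂ (x , false) with up? x | s.ℓ (s.τ₀ x) ℕ.≟ s.ℓ x
  ... | yes _ | _     = c₂ x
  ... | no _  | yes _ = c₀ x
  ... | no _  | no _  = c₀ x

  parity-T₀ : ∀ a → parity (ht (T₀ a)) ≡ not (parity (ht a))
  parity-T₀ (x , true)  = trans (sym (Boolₚ.not-involutive (parity (ℕ.pred (s.ℓ x))))) (cong (not ∘ parity) (suc-pred-ℓ x))
  parity-T₀ (x , false) = cong parity (sym (suc-pred-ℓ x))

  -- T₁ and T₂ change the colour of the side and keep the height; T₀ keeps the side and changes the
  -- parity of the height. Colour plus parity is thus changed by all three.
  orientable-to : Orientation s → M.Orientable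
  orientable-to (c , c₀ , c₁ , c₂) = C , flips {M.τ₀} {T₀} t₀ τ₀-θ⁻¹ , flips {M.τ₁} {T₁} t₁ τ₁-θ⁻¹ , flips {M.τ₂} {T₂} t₂ τ₂-θ⁻¹
    where
    C′ : Flag → Bool
    C′ a = c (proj₁ a) xor parity (ht a)
    C : Fin M.size → Bool
    C y = C′ (θ⁻¹ y)
    flips : ∀ {t : Fin M.size → Fin M.size} {T : Flag → Flag} → (∀ a → C′ (T a) ≡ not (C′ a)) → (∀ y → θ⁻¹ (t y) ≡ T (θ⁻¹ y)) → ∀ y → ¬ C (t y) ≡ C y
    flips h e y = not⇒¬≡ (trans (cong C′ (e y)) (h _))
    t₀ : ∀ a → C′ (T₀ a) ≡ not (C′ a)
    t₀ a = trans (cong (c (proj₁ a) xor_) (parity-T₀ a)) (xor-notʳ (c (proj₁ a)) (parity (ht a)))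
    t₁ : ∀ a → C′ (T₁ a) ≡ not (C′ a)
    t₁ a = trans (cong₂ _xor_ (colour-T₁ {c} c₀ c₂ a) (cong parity (ht-T₁ a))) (xor-notˡ (c (proj₁ a)) _)
    t₂ : ∀ a → C′ (T₂ a) ≡ not (C′ a)
    t₂ a = trans (cong₂ _xor_ (c₁ (proj₁ a)) (cong parity (ht-T₂ a))) (xor-notˡ (c (proj₁ a)) _)

  -- Adding the parity of the height makes an orientation of `M` invariant under T₀, so it descends
  -- from ends to sides. There T₁ acts as τ₀ or τ₂, and T₂ as τ₁.
  orientable-from : M.Orientable → Orientation s
  orientable-from (C , C₀ , C₁ , C₂) = c , flip₀ , (λ x → d₂ (x , true)) , flip₂
    where
    d : Flag → Bool
    d a = C (θ a) xor parity (ht a)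
    c : Fin N → Bool
    c x = d (x , true)
    d₁ : ∀ a → d (T₁ a) ≡ not (d a)
    d₁ a = trans (cong₂ _xor_ (trans (cong C (θ₁ a)) (¬≡⇒not (C₁ _))) (cong parity (ht-T₁ a))) (xor-notˡ (C (θ a)) _)
    d₂ : ∀ a → d (T₂ a) ≡ not (d a)
    d₂ a = trans (cong₂ _xor_ (trans (cong C (θ₂ a)) (¬≡⇒not (C₂ _))) (cong parity (ht-T₂ a))) (xor-notˡ (C (θ a)) _)
    d₀ : ∀ a → d (T₀ a) ≡ d a
    d₀ a = trans (cong₂ _xor_ (trans (cong C (θ₀ a)) (¬≡⇒not (C₀ _))) (parity-T₀ a))
      (trans (xor-notˡ (C (θ a)) _) (trans (cong not (xor-notʳ (C (θ a)) _)) (Boolₚ.not-involutive _)))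
    d≡c : ∀ x b → d (x , b) ≡ c x
    d≡c x true  = refl
    d≡c x false = d₀ (x , true)
    via : ∀ {x y} b b′ → T₁ (x , b) ≡ (y , b′) → c y ≡ not (c x)
    via {x} {y} b b′ h = trans (sym (d≡c y b′)) (trans (cong d (sym h)) (trans (d₁ (x , b)) (cong not (d≡c x b))))
    flip₀ : Orients c s.τ₀
    flip₀ x with adjacent x
    ... | inj₁ u        = via true false (T₁-up-true u)
    ... | inj₂ (inj₁ f) = via false false (T₁-flat-false f)
    ... | inj₂ (inj₂ e) = via false true (T₁-down-false e)
    flip₂ : Orients c s.τ₂
    flip₂ x with up? x
    ... | yes u = via false false (T₁-up-false u)
    ... | no ¬u = via true true (T₁-¬up-true ¬u)

  quadrangulation : M.IsQuadrangulation
  quadrangulation y = square⇒degree y (lift 4 (proj₁ sq)) λ h → proj₂ sq (trans (sym (θ⁻¹-θ _))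
      (cong θ⁻¹ (trans (rot-θ 2 (θ⁻¹ y)) (trans (cong (iter R 2) (θ-θ⁻¹ y)) h))))
    where
    open Dihedral M.τ₀ M.τ₁ M.τ₀-inv M.τ₁-inv using () renaming (rot to R)
    sq = square (θ⁻¹ y)
    rot-θ : ∀ k a → θ (iter rotF k a) ≡ iter R k (θ a)
    rot-θ = iter-conj rotF R θ λ a → trans (θ₁ _) (cong M.τ₁ (θ₀ a))
    lift : ∀ k → iter rotF k (θ⁻¹ y) ≡ θ⁻¹ y → iter R k y ≡ y
    lift k h = trans (cong (iter R k) (sym (θ-θ⁻¹ y))) (trans (sym (rot-θ k _)) (trans (cong θ h) (θ-θ⁻¹ y)))

  bipartite : M.IsBipartite
  bipartite = (parity ∘ ht ∘ θ⁻¹) ,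
    (λ y → cong parity (trans (cong ht (τ₁-θ⁻¹ y)) (ht-T₁ (θ⁻¹ y)))) ,
    (λ y → cong parity (trans (cong ht (τ₂-θ⁻¹ y)) (ht-T₂ (θ⁻¹ y)))) ,
    λ y → not⇒¬≡ (trans (cong (parity ∘ ht) (τ₀-θ⁻¹ y)) (parity-T₀ (θ⁻¹ y)))

  faces-to : ∀ {n} → HasClassCount (Conn s.τ₀ s.τ₂) (λ _ → ⊤) n → M.#F n
  faces-to = transportCount sameF-equiv (λ x → θ (x , true)) (face-to ∘ edge⇒face)
    (λ {x} {y} c → subst₂ (Conn s.τ₀ s.τ₂) (cong proj₁ (θ⁻¹-θ _)) (cong proj₁ (θ⁻¹-θ _)) (face⇒edge (face-from c))) (λ _ → tt)
    λ y _ → let x , b = θ⁻¹ y in x , tt , subst (λ z → M.SameF z (θ (x , true))) (θ-θ⁻¹ y) (face-to (top-of x b))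
    where
    top-of : ∀ x b → Face (x , b) (x , true)
    top-of x true  = ε
    top-of x false = inj₁ refl ◅ ε

  faces-from : ∀ {n} → M.#F n → HasClassCount (Conn s.τ₀ s.τ₂) (λ _ → ⊤) n
  faces-from = transportCount (conn-equiv τ₀-inv τ₂-inv) (proj₁ ∘ θ⁻¹) (face⇒edge ∘ face-from)
    (λ {y} {z} c → IsEquivalence.trans sameF-equiv (to-top y) (IsEquivalence.trans sameF-equiv (face-to (edge⇒face c))
      (IsEquivalence.sym sameF-equiv (to-top z)))) (λ _ → tt)
    λ x _ → θ (x , true) , tt , subst (Conn s.τ₀ s.τ₂ x) (sym (cong proj₁ (θ⁻¹-θ (x , true)))) ε
    where
    top-of : ∀ a → Face a (proj₁ a , true)
    top-of (x , true)  = ε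
    top-of (x , false) = inj₁ refl ◅ ε
    to-top : ∀ y → M.SameF y (θ (proj₁ (θ⁻¹ y) , true))
    to-top y = subst (λ z → M.SameF z (θ (proj₁ (θ⁻¹ y) , true))) (θ-θ⁻¹ y) (face-to (top-of (θ⁻¹ y)))

  edge-to : ∀ {x y} → SameCorner s x y → M.SameE (θ (x , true)) (θ (y , true))
  edge-to = Star⇒Closure ∘ Star.gmap (λ x → θ (x , true)) λ { refl → inj₂ (θ₂ _) }

  edge-from : ∀ {y z} → M.SameE y z → SameCorner s (proj₁ (θ⁻¹ y)) (proj₁ (θ⁻¹ z))
  edge-from c = go (Closure⇒Star c)
    where
    go : ∀ {y z} → Star M.EStep y z → SameCorner s (proj₁ (θ⁻¹ y)) (proj₁ (θ⁻¹ z))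
    go ε = ε
    go {z = z} (inj₁ refl ◅ c) = subst (λ x → SameCorner s x (proj₁ (θ⁻¹ z))) (cong proj₁ (τ₀-θ⁻¹ _)) (go c)
    go (inj₂ refl ◅ c) = cong proj₁ (τ₂-θ⁻¹ _) ◅ go c

  edge-back : ∀ {x y} → M.SameE (θ (x , true)) (θ (y , true)) → SameCorner s x y
  edge-back c = subst₂ (SameCorner s) (cong proj₁ (θ⁻¹-θ _)) (cong proj₁ (θ⁻¹-θ _)) (edge-from c)

  edges-to : ∀ {n} → HasClassCount (SameCorner s) (λ _ → ⊤) n → M.#E n
  edges-to = transportCount sameE-equiv (λ x → θ (x , true)) edge-to edge-back (λ _ → tt)
    λ y _ → let x , b = θ⁻¹ y in x , tt , subst (λ z → M.SameE z (θ (x , true))) (θ-θ⁻¹ y) (top-of x b)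
    where
    top-of : ∀ x b → M.SameE (θ (x , b)) (θ (x , true))
    top-of x true  = here
    top-of x false = step (inj₁ (θ₀ (x , false))) here

  -- The additional vertex is v₀, the only one at which no side has its upper end.
  vertices-to : ∀ {t} → HasClassCount (TopVertex s) (λ _ → ⊤) t → M.#V (suc t)
  vertices-to {t} (e , _ , inj , sur) = e′ , (λ _ → tt) , inj′ , sur′
    where
    open IsEquivalence sameV-equiv using () renaming (refl to ~refl; sym to ~sym; trans to ~trans)
    e′ : Fin (suc t) → Fin M.size
    e′ zero    = v₀
    e′ (suc i) = θ (e i , true)
    v₀≢ : ∀ i → ¬ M.SameV v₀ (θ (e i , true))
    v₀≢ i c = contradiction (positive (e i)) (subst (λ k → ¬ 1 ≤ k)
      (dist-unique {x = v₀} {y = θ (e i , true)} (walk-around M.stay c , λ j ()) (θ-dist (e i , true))) λ ())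
    inj′ : ∀ i j → M.SameV (e′ i) (e′ j) → i ≡ j
    inj′ zero    zero    c = refl
    inj′ zero    (suc j) c = contradiction c (v₀≢ j)
    inj′ (suc i) zero    c = contradiction (~sym c) (v₀≢ i)
    inj′ (suc i) (suc j) c = cong suc (inj i j (vertex-back c))
    sur′ : ∀ y → ⊤ → Σ (Fin (suc t)) λ i → M.SameV y (e′ i)
    sur′ y _ with ht (θ⁻¹ y) ℕ.≟ 0
    ... | yes h = zero , ~sym (subst (M.SameV v₀) (θ-θ⁻¹ y) (at-bottom (θ⁻¹ y) h))
    ... | no ¬h with top (θ⁻¹ y) (ℕₚ.n≢0⇒n>0 ¬h)
    ...   | x , v with sur x tt
    ...     | i , c = suc i , ~trans (subst (λ z → M.SameV z (θ (x , true))) (θ-θ⁻¹ y) (vertex-to v)) (vertex-to c)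

  layer-vertices : ∀ j {m} → HasClassCount (TopVertex s) (λ x → s.ℓ x ≡ suc j) m →
    HasClassCount M.SameV (λ y → M.Dist v₀ y (suc j)) m
  layer-vertices j = transportCount sameV-equiv (λ x → θ (x , true)) vertex-to vertex-back
    (λ {x} h → subst (M.Dist v₀ (θ (x , true))) h (θ-dist (x , true)))
    λ y d → let h = dist-unique (dist-of y) d ; x , v = top (θ⁻¹ y) (subst (1 ≤_) (sym h) (s≤s z≤n)) in
      x , trans (ht-vertex v) h , subst (λ z → M.SameV z (θ (x , true))) (θ-θ⁻¹ y) (vertex-to v)

  layer-edges : ∀ j {m} → HasClassCount (SameCorner s) (λ x → s.ℓ x ≡ suc j) m →
    HasClassCount M.SameE (λ y → M.Dist v₀ y (suc j) × M.Dist v₀ (M.τ₀ y) j) m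
  layer-edges j = transportCount sameE-equiv (λ x → θ (x , true)) edge-to edge-back
    (λ {x} h → subst (M.Dist v₀ (θ (x , true))) h (θ-dist (x , true)) ,
               subst₂ (M.Dist v₀) (θ₀ (x , true)) (cong ℕ.pred h) (θ-dist (x , false)))
    λ y (d , d′) → upper y (θ⁻¹ y) refl (dist-unique (dist-of y) d)
      (trans (cong ht (sym (τ₀-θ⁻¹ y))) (dist-unique (dist-of (M.τ₀ y)) d′))
    where
    upper : ∀ y a → θ⁻¹ y ≡ a → ht (θ⁻¹ y) ≡ suc j → ht (T₀ (θ⁻¹ y)) ≡ j → ∃ λ x → s.ℓ x ≡ suc j × M.SameE y (θ (x , true))
    upper y (x , true) e h h′ rewrite e = x , h , subst (M.SameE y) (trans (sym (θ-θ⁻¹ y)) (cong θ e)) here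
    upper y (x , false) e h h′ rewrite e = contradiction (trans (cong suc (sym h)) (trans (suc-pred-ℓ x) h′)) (ℕₚ.m+1+n≢n 1)

module _ {N : ℕ} {s s′ : Str N} (f : Iso s s′) (pre : Pre s) where

  open Iso f
  private
    module A = SideLaws (proj₁ pre) (proj₂ pre)
    module B = SideLaws (proj₁ (iso-pre f pre)) (proj₂ (iso-pre f pre))

  iso-flag : A.Flag → B.Flag
  iso-flag (x , b) = to x , b

  iso-ℓτ₀ : ∀ x → Str.ℓ s′ (Str.τ₀ s′ (to x)) ≡ Str.ℓ s (Str.τ₀ s x)
  iso-ℓτ₀ x = trans (cong (Str.ℓ s′) (sym (iso₀ x))) (iso-ℓ _)

  iso-up : ∀ {x} → A.Up x → B.Up (to x)
  iso-up {x} u = trans (iso-ℓτ₀ x) (trans u (cong suc (sym (iso-ℓ x))))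

  iso-down : ∀ {x} → A.Down x → B.Down (to x)
  iso-down {x} d = trans (cong suc (iso-ℓτ₀ x)) (trans d (sym (iso-ℓ x)))

  iso-flat : ∀ {x} → Str.ℓ s (Str.τ₀ s x) ≡ Str.ℓ s x → Str.ℓ s′ (Str.τ₀ s′ (to x)) ≡ Str.ℓ s′ (to x)
  iso-flat {x} h = trans (iso-ℓτ₀ x) (trans h (sym (iso-ℓ x)))

  iso-T₁ : ∀ a → iso-flag (A.T₁ a) ≡ B.T₁ (iso-flag a)
  iso-T₁ (x , true) with A.adjacent x
  ... | inj₁ u        = trans (cong iso-flag (A.T₁-up-true u)) (trans (cong (_, false) (iso₀ x)) (sym (B.T₁-up-true (iso-up u))))
  ... | inj₂ (inj₁ h) = trans (cong iso-flag (A.T₁-¬up-true (A.¬flat-up h))) (trans (cong (_, true) (iso₂ x)) (sym (B.T₁-¬up-true (B.¬flat-up (iso-flat h)))))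
  ... | inj₂ (inj₂ d) = trans (cong iso-flag (A.T₁-¬up-true (A.¬up-down d))) (trans (cong (_, true) (iso₂ x)) (sym (B.T₁-¬up-true (B.¬up-down (iso-down d)))))
  iso-T₁ (x , false) with A.adjacent x
  ... | inj₁ u        = trans (cong iso-flag (A.T₁-up-false u)) (trans (cong (_, false) (iso₂ x)) (sym (B.T₁-up-false (iso-up u))))
  ... | inj₂ (inj₁ h) = trans (cong iso-flag (A.T₁-flat-false h)) (trans (cong (_, false) (iso₀ x)) (sym (B.T₁-flat-false (iso-flat h))))
  ... | inj₂ (inj₂ d) = trans (cong iso-flag (A.T₁-down-false d)) (trans (cong (_, true) (iso₀ x)) (sym (B.T₁-down-false (iso-down d))))

  iso-T₂ : ∀ a → iso-flag (A.T₂ a) ≡ B.T₂ (iso-flag a)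
  iso-T₂ (x , b) = cong (_, b) (iso₁ x)

  iso-ht : ∀ a → B.ht (iso-flag a) ≡ A.ht a
  iso-ht (x , true)  = iso-ℓ x
  iso-ht (x , false) = cong ℕ.pred (iso-ℓ x)

RepQ : ∀ {S n} → QPair S n → ∀ {N} → Str N → Bool → Set
RepQ p s b = Σ (RepM (RootedMap.map (QPair.q p)) (QPair.v₀ p) s) λ rep → RepM.θ rep (Str.root s , b) ≡ RootedMap.root (QPair.q p)

relabelledQ : ∀ {S n} {p : QPair S n} {N} {s s′ : Str N} {b} → Iso s s′ → RepQ p s b → RepQ p s′ b
relabelledQ {s = s} {s′} {b} f (rep , θr) = record
    { pre = iso-pre f pre ; θ = θ ∘ ψ ; θ⁻¹ = iso-flag f pre ∘ θ⁻¹
    ; θ⁻¹-θ = λ (x , c) → trans (cong (iso-flag f pre) (θ⁻¹-θ _)) (cong (_, c) (to-from x))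
    ; θ-θ⁻¹ = λ y → trans (cong (λ x → θ (x , proj₂ (θ⁻¹ y))) (from-to _)) (θ-θ⁻¹ y)
    ; θ₀ = λ a → θ₀ (ψ a)
    ; θ₁ = λ a → trans (cong θ (iso-T₁ g (iso-pre f pre) a)) (θ₁ _)
    ; θ₂ = λ a → trans (cong θ (iso-T₂ g (iso-pre f pre) a)) (θ₂ _)
    ; θ-dist = λ a → subst (Map.Dist _ _ (θ (ψ a))) (iso-ht g (iso-pre f pre) a) (θ-dist (ψ a)) } ,
    trans (cong (λ x → θ (x , b)) (Iso.iso-r g)) θr
  where
  open Iso f
  open RepM rep
  g : Iso s′ s
  g = iso-sym f
  ψ = iso-flag g (iso-pre f pre)

orientation-G⇔ : ∀ {N} (s : Str N) → Pre s → (Orientation s → Orientation (G s)) × (Orientation (G s) → Orientation s)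
orientation-G⇔ s p =
  (λ o → let q , e = G-spec s p in subst Orientation (sym e) (orientation-G s q o)) ,
  (λ o → let q , e = F-spec (G s) (G-pre s p) in subst Orientation (trans (sym e) (FG≡ s p)) (orientation-F (G s) q o))

corner-count : ∀ {n} (s : Str (n * 4)) → Pre s → HasClassCount (SameCorner s) (λ _ → ⊤) (n * 2)
corner-count {n} s (_ , gl) = subst (HasClassCount (SameCorner s) (λ _ → ⊤)) (ℕₚ.*-cancelʳ-≡ _ _ 2
    (trans (sym (involution-blocks {f = Str.τ₁ s} τ₁-inv τ₁-fpf (proj₂ c))) (sym (ℕₚ.*-assoc n 2 2)))) (proj₂ c)
  where
  open Gluing gl
  c = classCount (star-isEquiv (flip-involution τ₁-inv)) (Warshall.star? _ (λ x y → y Finₚ.≟ Str.τ₁ s x)) {λ _ → ⊤} (λ _ → yes tt)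

-- Left: a quadrangulation with t + 1 vertices, 2n edges and n faces. Right: a map with t vertices,
-- n edges and one face.
euler-shift : ∀ t n → (+ suc t ℤ.- + (n * 2)) ℤ.+ + n ≡ (+ t ℤ.- + n) ℤ.+ + 1
euler-shift t n = trans (cong (λ z → (+ suc t ℤ.- z) ℤ.+ + n) (ℤₚ.pos-* n 2)) (ring (+ t) (+ n))
  where
  ring : ∀ t n → ((+ 1 ℤ.+ t) ℤ.- n ℤ.* + 2) ℤ.+ n ≡ (t ℤ.- n) ℤ.+ + 1
  ring = solve-∀

module _ {M : Map} {v₀ : Fin (Map.size M)} {n : ℕ} {s : Str (n * 4)} (rep : RepM M v₀ s) where

  open RepMLaws rep
  private
    module M = Map M

  euler-map : M.#V (suc (proj₁ (inv (G s)))) × M.#E (n * 2) × M.#F n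
  euler-map = vertices-to (proj₁ (invQ-spec s pre)) , edges-to (corner-count {n} s pre) , faces-to (edge-count s pre)

  onSurface-to : ∀ S → GoodQ S n s → OnSurface M S
  onSurface-to S (_ , _ , _ , o , e) = ⇒onSurface S
    (orientedAs-map S (orientable-to ∘ proj₂ (orientation-G⇔ s pre)) (proj₁ (orientation-G⇔ s pre) ∘ orientable-from) o)
    (_ , _ , _ , proj₁ euler-map , proj₁ (proj₂ euler-map) , proj₂ (proj₂ euler-map) ,
     trans e (sym (euler-shift (proj₁ (inv (G s))) n)))

  onSurface-from : ∀ S → OnSurface M S → GoodQ S n s
  onSurface-from S h = pre , G-pre s pre , oneFaced-G ,
    orientedAs-map S (proj₁ (orientation-G⇔ s pre) ∘ orientable-from) (orientable-to ∘ proj₂ (orientation-G⇔ s pre)) (proj₁ (onSurface⇒ S h)) ,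
    euler (proj₂ (onSurface⇒ S h))
    where
    open MapLemmas M
    euler : M.EulerChar (χ S) → χ S ≡ (+ proj₁ (inv (G s)) ℤ.- + n) ℤ.+ + 1
    euler (v , e , f , hv , he , hf , h) = trans h (trans (cong₂ ℤ._+_
      (cong₂ (λ a b → + a ℤ.- + b) (classCount-unique sameV-equiv hv (proj₁ euler-map)) (classCount-unique sameE-equiv he (proj₁ (proj₂ euler-map))))
      (cong +_ (classCount-unique sameF-equiv hf (proj₂ (proj₂ euler-map))))) (euler-shift (proj₁ (inv (G s))) n))

-- Isomorphisms of pointed quadrangulations and of their structures

module _ {S : Surface} {n : ℕ} {p p′ : QPair S n} {N : ℕ} {s s′ : Str N} {b b′ : Bool} (rep : RepQ p s b) (rep′ : RepQ p′ s′ b′) where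

  private
    module A = RepMLaws (proj₁ rep)
    module B = RepMLaws (proj₁ rep′)
    module q = RootedMap (QPair.q p)
    module q′ = RootedMap (QPair.q p′)
    module LA = MapLemmas q.map
    module LB = MapLemmas q′.map

  -- An isomorphism keeps distances from v₀, so it respects upper and lower ends and acts on the
  -- sides. For the same reason it keeps the end at which the root sits, which tells the two
  -- preimages of a labelled map apart.
  ≅Q⇒iso : p ≅Q p′ → Iso s s′ × b ≡ b′
  ≅Q⇒iso (φ , hv) = record
      { to = σ ; from = σ⁻¹
      ; from-to = λ x → cong proj₁ (trans (cong Ψ⁻¹ (sym (Ψ-flag (x , true)))) (Ψ⁻¹-Ψ _))
      ; to-from = λ y → cong proj₁ (trans (cong Ψ (sym (Ψ⁻¹-flag (y , true)))) (Ψ-Ψ⁻¹ _))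
      ; iso₀ = iso₀ ; iso₁ = λ x → cong proj₁ (trans (sym (Ψ-flag (Str.τ₁ s x , true))) (trans (Ψ₂ (x , true)) (cong B.T₂ (Ψ-flag (x , true)))))
      ; iso₂ = iso₂ ; iso-ℓ = λ x → trans (cong B.ht (sym (Ψ-flag (x , true)))) (Ψ-ht (x , true))
      ; iso-r = cong proj₁ root≡ } , cong proj₂ root≡
    where
    open RIso φ
    from-comm : ∀ {t : Fin q.size → Fin q.size} {t′ : Fin q′.size → Fin q′.size} → (∀ x → to (t x) ≡ t′ (to x)) → ∀ y → from (t′ y) ≡ t (from y)
    from-comm {t} {t′} h y = trans (cong (from ∘ t′) (sym (to-from y))) (trans (cong from (sym (h _))) (from-to _))
    walk-to : ∀ {k x y} → q.Walk k x y → q′.Walk k (to x) (to y)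
    walk-to q.stay                 = q′.stay
    walk-to (q.turn (inj₁ refl) w) = q′.turn (inj₁ (comm₁ _)) (walk-to w)
    walk-to (q.turn (inj₂ refl) w) = q′.turn (inj₂ (comm₂ _)) (walk-to w)
    walk-to (q.go {z = z} w)       = q′.go (subst (λ u → q′.Walk _ u (to z)) (comm₀ _) (walk-to w))
    walk-from : ∀ {k x y} → q′.Walk k x y → q.Walk k (from x) (from y)
    walk-from q′.stay                = q.stay
    walk-from (q′.turn (inj₁ refl) w) = q.turn (inj₁ (from-comm {q.τ₁} {q′.τ₁} comm₁ _)) (walk-from w)
    walk-from (q′.turn (inj₂ refl) w) = q.turn (inj₂ (from-comm {q.τ₂} {q′.τ₂} comm₂ _)) (walk-from w)
    walk-from (q′.go {z = z} w)       = q.go (subst (λ u → q.Walk _ u (from z)) (from-comm {q.τ₀} {q′.τ₀} comm₀ _) (walk-from w))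
    v-from : q.SameV (QPair.v₀ p) (from (QPair.v₀ p′))
    v-from = LA.walk-zero (subst (λ u → q.Walk 0 u _) (from-to _) (walk-from (LB.walk-around q′.stay hv)))
    dist-to : ∀ {y i} → q.Dist (QPair.v₀ p) y i → q′.Dist (QPair.v₀ p′) (to y) i
    dist-to {y} (w , low) = LB.around-walk (IsEquivalence.sym LB.sameV-equiv hv) (walk-to w) ,
      λ j j<i w′ → low j j<i (LA.around-walk v-from (subst (q.Walk j _) (from-to y) (walk-from w′)))
    Ψ : A.Flag → B.Flag
    Ψ a = B.θ⁻¹ (to (A.θ a))
    Ψ⁻¹ : B.Flag → A.Flag
    Ψ⁻¹ a = A.θ⁻¹ (from (B.θ a))
    Ψ⁻¹-Ψ : ∀ a → Ψ⁻¹ (Ψ a) ≡ a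
    Ψ⁻¹-Ψ a = trans (cong (A.θ⁻¹ ∘ from) (B.θ-θ⁻¹ _)) (trans (cong A.θ⁻¹ (from-to _)) (A.θ⁻¹-θ a))
    Ψ-Ψ⁻¹ : ∀ a → Ψ (Ψ⁻¹ a) ≡ a
    Ψ-Ψ⁻¹ a = trans (cong (B.θ⁻¹ ∘ to) (A.θ-θ⁻¹ _)) (trans (cong B.θ⁻¹ (to-from _)) (B.θ⁻¹-θ a))
    Ψ₀ : ∀ a → Ψ (A.T₀ a) ≡ B.T₀ (Ψ a)
    Ψ₀ a = trans (cong (B.θ⁻¹ ∘ to) (A.θ₀ a)) (trans (cong B.θ⁻¹ (comm₀ _)) (B.τ₀-θ⁻¹ _))
    Ψ₁ : ∀ a → Ψ (A.T₁ a) ≡ B.T₁ (Ψ a)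
    Ψ₁ a = trans (cong (B.θ⁻¹ ∘ to) (A.θ₁ a)) (trans (cong B.θ⁻¹ (comm₁ _)) (B.τ₁-θ⁻¹ _))
    Ψ₂ : ∀ a → Ψ (A.T₂ a) ≡ B.T₂ (Ψ a)
    Ψ₂ a = trans (cong (B.θ⁻¹ ∘ to) (A.θ₂ a)) (trans (cong B.θ⁻¹ (comm₂ _)) (B.τ₂-θ⁻¹ _))
    Ψ-ht : ∀ a → B.ht (Ψ a) ≡ A.ht a
    Ψ-ht a = LB.dist-unique (B.dist-of (to (A.θ a))) (dist-to (A.θ-dist a))
    -- Ψ preserves heights, hence upper ends.
    σ : Fin N → Fin N
    σ x = proj₁ (Ψ (x , true))
    upper : ∀ x → proj₂ (Ψ (x , true)) ≡ true
    upper x with Ψ (x , true) in eq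
    ... | y , true  = refl
    -- Otherwise the height of the lower end of y would be `ℓ x` and that of its upper end one less.
    ... | y , false = contradiction
            (ℕₚ.≤-trans (ℕₚ.≤-reflexive (trans (cong suc (sym e₁)) (trans (B.suc-pred-ℓ y) e₂))) ℕₚ.pred[n]≤n) ℕₚ.1+n≰n
      where
      e₁ : ℕ.pred (Str.ℓ s′ y) ≡ Str.ℓ s x
      e₁ = trans (cong B.ht (sym eq)) (Ψ-ht (x , true))
      e₂ : Str.ℓ s′ y ≡ ℕ.pred (Str.ℓ s x)
      e₂ = trans (cong B.ht (sym (trans (Ψ₀ (x , true)) (cong B.T₀ eq)))) (Ψ-ht (x , false))
    Ψ-flag : ∀ a → Ψ a ≡ (σ (proj₁ a) , proj₂ a)
    Ψ-flag (x , true)  = cong (σ x ,_) (upper x)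
    Ψ-flag (x , false) = trans (Ψ₀ (x , true)) (cong B.T₀ (Ψ-flag (x , true)))
    σ⁻¹ : Fin N → Fin N
    σ⁻¹ y = proj₁ (Ψ⁻¹ (y , true))
    Ψ⁻¹-flag : ∀ a → Ψ⁻¹ a ≡ (σ⁻¹ (proj₁ a) , proj₂ a)
    Ψ⁻¹-flag (y , c) with Ψ⁻¹ (y , true) in eq
    ... | x , d = trans (cong Ψ⁻¹ (sym lem)) (Ψ⁻¹-Ψ (x , c))
      where
      e : (y , true) ≡ (σ x , d)
      e = trans (sym (Ψ-Ψ⁻¹ (y , true))) (trans (cong Ψ eq) (Ψ-flag (x , d)))
      lem : Ψ (x , c) ≡ (y , c)
      lem = trans (Ψ-flag (x , c)) (cong (_, c) (sym (cong proj₁ e)))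
    T₁-σ : ∀ x c → B.T₁ (σ x , c) ≡ (σ (proj₁ (A.T₁ (x , c))) , proj₂ (A.T₁ (x , c)))
    T₁-σ x c = trans (cong B.T₁ (sym (Ψ-flag (x , c)))) (trans (sym (Ψ₁ (x , c))) (Ψ-flag _))
    -- Leading up is visible in T₁ alone: exactly then it takes the upper end of a side to a lower
    -- end.
    σ-up : ∀ {x} → A.Up x → B.Up (σ x)
    σ-up {x} u with B.up? (σ x)
    ... | yes v = v
    ... | no ¬v = contradiction (trans (sym (cong proj₂ (B.T₁-¬up-true ¬v))) (trans (cong proj₂ (T₁-σ x true)) (cong proj₂ (A.T₁-up-true u)))) λ ()
    σ-¬up : ∀ {x} → ¬ A.Up x → ¬ B.Up (σ x)
    σ-¬up {x} ¬u v = contradiction (trans (sym (cong proj₂ (B.T₁-up-true v))) (trans (cong proj₂ (T₁-σ x true)) (cong proj₂ (A.T₁-¬up-true ¬u)))) λ ()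
    neighbour : ∀ x c {y y′ d d′} → A.T₁ (x , c) ≡ (y , d) → B.T₁ (σ x , c) ≡ (y′ , d′) → σ y ≡ y′
    neighbour x c h h′ = trans (cong (σ ∘ proj₁) (sym h)) (trans (cong proj₁ (sym (T₁-σ x c))) (cong proj₁ h′))
    low-A : ∀ {x} → ¬ A.Up x → ∃ λ d → A.T₁ (x , false) ≡ (Str.τ₀ s x , d)
    low-A {x} ¬u with A.adjacent x
    ... | inj₁ u        = contradiction u ¬u
    ... | inj₂ (inj₁ h) = false , A.T₁-flat-false h
    ... | inj₂ (inj₂ h) = true , A.T₁-down-false h
    low-B : ∀ {x} → ¬ B.Up x → ∃ λ d → B.T₁ (x , false) ≡ (Str.τ₀ s′ x , d)
    low-B {x} ¬u with B.adjacent x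
    ... | inj₁ u        = contradiction u ¬u
    ... | inj₂ (inj₁ h) = false , B.T₁-flat-false h
    ... | inj₂ (inj₂ h) = true , B.T₁-down-false h
    iso₀ : ∀ x → σ (Str.τ₀ s x) ≡ Str.τ₀ s′ (σ x)
    iso₀ x with A.up? x
    ... | yes u = neighbour x true (A.T₁-up-true {x} u) (B.T₁-up-true {σ x} (σ-up {x} u))
    ... | no ¬u = neighbour x false (proj₂ (low-A {x} ¬u)) (proj₂ (low-B {σ x} (σ-¬up {x} ¬u)))
    iso₂ : ∀ x → σ (Str.τ₂ s x) ≡ Str.τ₂ s′ (σ x)
    iso₂ x with A.up? x
    ... | yes u = neighbour x false (A.T₁-up-false {x} u) (B.T₁-up-false {σ x} (σ-up {x} u))
    ... | no ¬u = neighbour x true (A.T₁-¬up-true {x} ¬u) (B.T₁-¬up-true {σ x} (σ-¬up {x} ¬u))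
    root≡ : (σ (Str.root s) , b) ≡ (Str.root s′ , b′)
    root≡ = trans (sym (Ψ-flag (Str.root s , b))) (trans (cong (B.θ⁻¹ ∘ to) (proj₂ rep))
      (trans (cong B.θ⁻¹ (trans root-pres (sym (proj₂ rep′)))) (B.θ⁻¹-θ _)))

  iso⇒≅Q : Iso s s′ → b ≡ b′ → p ≅Q p′
  iso⇒≅Q f refl = record
      { to = B.θ ∘ i ∘ A.θ⁻¹ ; from = A.θ ∘ j ∘ B.θ⁻¹
      ; from-to = λ x → trans (cong (A.θ ∘ j) (B.θ⁻¹-θ _)) (trans (cong (λ y → A.θ (y , proj₂ (A.θ⁻¹ x))) (from-to _)) (A.θ-θ⁻¹ x))
      ; to-from = λ y → trans (cong (B.θ ∘ i) (A.θ⁻¹-θ _)) (trans (cong (λ z → B.θ (z , proj₂ (B.θ⁻¹ y))) (to-from _)) (B.θ-θ⁻¹ y))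
      ; comm₀ = λ x → trans (cong (B.θ ∘ i) (A.τ₀-θ⁻¹ x)) (B.θ₀ _)
      ; comm₁ = λ x → trans (cong (B.θ ∘ i) (A.τ₁-θ⁻¹ x)) (trans (cong B.θ (i-T₁ (A.θ⁻¹ x))) (B.θ₁ (i (A.θ⁻¹ x))))
      ; comm₂ = λ x → trans (cong (B.θ ∘ i) (A.τ₂-θ⁻¹ x)) (trans (cong B.θ (iso-T₂ f A.pre (A.θ⁻¹ x))) (B.θ₂ (i (A.θ⁻¹ x))))
      ; root-pres = trans (cong (B.θ ∘ i) (trans (cong A.θ⁻¹ (sym (proj₂ rep))) (A.θ⁻¹-θ _)))
          (trans (cong (λ x → B.θ (x , b)) iso-r) (proj₂ rep′)) } ,
      IsEquivalence.sym LB.sameV-equiv (B.at-bottom (i (A.θ⁻¹ (QPair.v₀ p))) (trans (iso-ht f A.pre (A.θ⁻¹ (QPair.v₀ p)))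
        (LA.dist-unique {x = QPair.v₀ p} {y = QPair.v₀ p} (A.dist-of (QPair.v₀ p)) (q.stay , λ k ()))))
    where
    open Iso f
    i : A.Flag → B.Flag
    i = iso-flag f A.pre
    j : B.Flag → A.Flag
    j (y , c) = from y , c
    i-T₁ : ∀ a → i (A.T₁ a) ≡ B.T₁ (i a)
    i-T₁ = iso-T₁ f A.pre

-- The quadrangulation built from a layered gluing

bit : Bool → Fin 2
bit true  = zero
bit false = suc zero

unbit : Fin 2 → Bool
unbit zero       = true
unbit (suc zero) = false

unbit-bit : ∀ b → unbit (bit b) ≡ b
unbit-bit true  = refl
unbit-bit false = refl

bit-unbit : ∀ i → bit (unbit i) ≡ i
bit-unbit zero       = refl
bit-unbit (suc zero) = refl

module SideMap {N : ℕ} (s : Str N) (pre : Pre s) (desc : Framed.Desc (proj₁ pre) (Str.τ₁ s) (Str.τ₂ s)) where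

  open SideLaws (proj₁ pre) (proj₂ pre)
  open Descending desc

  code : Flag → Fin (N * 2)
  code (x , b) = combine x (bit b)

  decode : Fin (N * 2) → Flag
  decode y = let x , i = remQuot {N} 2 y in x , unbit i

  decode-code : ∀ a → decode (code a) ≡ a
  decode-code (x , b) = trans (cong (λ (z , i) → z , unbit i) (Finₚ.remQuot-combine {N} {2} x (bit b))) (cong (x ,_) (unbit-bit b))

  code-decode : ∀ y → code (decode y) ≡ y
  code-decode y = trans (cong (combine (proj₁ (remQuot {N} 2 y))) (bit-unbit (proj₂ (remQuot {N} 2 y)))) (Finₚ.combine-remQuot {N} 2 y)

  lift : (Flag → Flag) → Fin (N * 2) → Fin (N * 2)
  lift T y = code (T (decode y))

  lift-inv : ∀ {T} → (∀ a → T (T a) ≡ a) → ∀ y → lift T (lift T y) ≡ y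
  lift-inv {T} TT y = trans (cong (code ∘ T) (decode-code _)) (trans (cong code (TT _)) (code-decode y))

  lift-fpf : ∀ {T} → (∀ a → ¬ T a ≡ a) → ∀ y → ¬ lift T y ≡ y
  lift-fpf {T} ≢ y h = ≢ (decode y) (trans (sym (decode-code _)) (cong decode h))

  lift-∘ : ∀ T T′ y → lift T (lift T′ y) ≡ lift (T ∘ T′) y
  lift-∘ T T′ y = cong (code ∘ T) (decode-code _)

  AnyFlag : Flag → Flag → Set
  AnyFlag a b = (b ≡ T₀ a ⊎ b ≡ T₁ a) ⊎ b ≡ T₂ a

  any-sym : ∀ {a b} → AnyFlag a b → AnyFlag b a
  any-sym (inj₁ (inj₁ e)) = inj₁ (inj₁ (flip-involution T₀-inv e))
  any-sym (inj₁ (inj₂ e)) = inj₁ (inj₂ (flip-involution T₁-inv e))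
  any-sym (inj₂ e)        = inj₂ (flip-involution T₂-inv e)

  vertex-any : ∀ {a b} → Vertex a b → Star AnyFlag a b
  vertex-any = Star.map λ { (inj₁ e) → inj₁ (inj₂ e) ; (inj₂ e) → inj₂ e }

  origin : Flag
  origin = proj₁ lowest , false

  ht-origin : ht origin ≡ 0
  ht-origin = cong ℕ.pred (proj₂ lowest)

  to-origin : ∀ k a → ht a ≡ k → Star AnyFlag a origin
  to-origin zero    a h = vertex-any (bottom a origin h ht-origin)
  to-origin (suc k) a h with top a (subst (1 ≤_) (sym h) (s≤s z≤n))
  ... | y , v = vertex-any v ◅◅ inj₁ (inj₁ refl) ◅ to-origin k (y , false) (cong ℕ.pred (trans (ht-vertex v) h))

  M : Map
  M = record
    { size = N * 2 ; τ₀ = lift T₀ ; τ₁ = lift T₁ ; τ₂ = lift T₂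
    ; τ₀-inv = lift-inv {T₀} T₀-inv ; τ₁-inv = lift-inv {T₁} T₁-inv ; τ₂-inv = lift-inv {T₂} T₂-inv
    ; τ₀-fpf = lift-fpf {T₀} T₀-fpf ; τ₁-fpf = lift-fpf {T₁} T₁-fpf ; τ₂-fpf = lift-fpf {T₂} T₂-fpf
    ; τ₀τ₂-comm = λ y → trans (lift-∘ T₀ T₂ y) (sym (lift-∘ T₂ T₀ y))
    ; τ₀τ₂-fpf = λ y h → lift-fpf {T₀ ∘ T₂} T₀T₂-fpf y (trans (sym (lift-∘ T₀ T₂ y)) h)
    ; connected = λ y z → Star⇒Closure (subst₂ (Star _) (code-decode y) (code-decode z) (Star.gmap code step-code
        (to-origin _ (decode y) refl ◅◅ Star.reverse any-sym (to-origin _ (decode z) refl)))) }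
    where
    step-code : ∀ {a b} → AnyFlag a b → (code b ≡ lift T₀ (code a) ⊎ code b ≡ lift T₁ (code a)) ⊎ code b ≡ lift T₂ (code a)
    step-code (inj₁ (inj₁ refl)) = inj₁ (inj₁ (cong (code ∘ T₀) (sym (decode-code _))))
    step-code (inj₁ (inj₂ refl)) = inj₁ (inj₂ (cong (code ∘ T₁) (sym (decode-code _))))
    step-code (inj₂ refl)        = inj₂ (cong (code ∘ T₂) (sym (decode-code _)))

  module M = Map M
  open MapLemmas M

  lift-code : ∀ T a → code (T a) ≡ lift T (code a)
  lift-code T a = cong (code ∘ T) (sym (decode-code a))

  vertex-code : ∀ {a b} → Vertex a b → M.SameV (code a) (code b)
  vertex-code = Star⇒Closure ∘ Star.gmap code λ { (inj₁ refl) → inj₁ (lift-code T₁ _) ; (inj₂ refl) → inj₂ (lift-code T₂ _) }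

  walk-to : ∀ k a → ht a ≡ k → M.Walk k (code origin) (code a)
  walk-to zero    a h = walk-around M.stay (vertex-code (bottom origin a ht-origin h))
  walk-to (suc k) a h with top a (subst (1 ≤_) (sym h) (s≤s z≤n))
  ... | y , v = walk-around (subst (M.Walk (suc k) (code origin)) (sym (lift-code T₀ (y , false)))
                  (walk-go (walk-to k (y , false) (cong ℕ.pred (trans (ht-vertex v) h))))) (IsEquivalence.sym sameV-equiv (vertex-code v))

  H : Fin (N * 2) → ℕ
  H y = ht (decode y)

  ht-T₀-≤ : ∀ a → ht (T₀ a) ≤ suc (ht a)
  ht-T₀-≤ (x , true)  = ℕₚ.≤-trans ℕₚ.pred[n]≤n (ℕₚ.n≤1+n _)
  ht-T₀-≤ (x , false) = ℕₚ.≤-reflexive (sym (suc-pred-ℓ x))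

  -- An edge raises the height by at most 1, so a walk from height 0 is at least as long as the
  -- height it reaches. Together with `walk-to`, heights are distances.
  walk-height : ∀ {k x y} → M.Walk k x y → H y ≤ k + H x
  walk-height M.stay = ℕₚ.≤-refl
  walk-height {k} {x} (M.turn (inj₁ refl) w) = subst (λ h → _ ≤ k + h) (trans (cong ht (decode-code _)) (ht-T₁ (decode x))) (walk-height w)
  walk-height {k} {x} (M.turn (inj₂ refl) w) = subst (λ h → _ ≤ k + h) (trans (cong ht (decode-code _)) (ht-T₂ (decode x))) (walk-height w)
  walk-height {suc k} {x} (M.go w) = ℕₚ.≤-trans (walk-height w) (ℕₚ.≤-trans
    (ℕₚ.+-monoʳ-≤ k (subst (_≤ suc (H x)) (cong ht (sym (decode-code _))) (ht-T₀-≤ (decode x)))) (ℕₚ.≤-reflexive (ℕₚ.+-suc k (H x))))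

  repM : RepM M (code origin) s
  repM = record
    { pre = pre ; θ = code ; θ⁻¹ = decode ; θ⁻¹-θ = decode-code ; θ-θ⁻¹ = code-decode
    ; θ₀ = lift-code T₀ ; θ₁ = lift-code T₁ ; θ₂ = lift-code T₂
    ; θ-dist = λ a → walk-to (ht a) a refl , λ j j< w → ℕₚ.<⇒≱ j< (ℕₚ.≤-trans (ℕₚ.≤-reflexive (sym (cong ht (decode-code a))))
        (ℕₚ.≤-trans (walk-height w) (ℕₚ.≤-reflexive (trans (cong (λ h → j + h) (trans (cong ht (decode-code origin)) ht-origin)) (ℕₚ.+-identityʳ j))))) }

goodQ⇒desc : ∀ {S n N} (s : Str N) (g : GoodQ S n s) → Framed.Desc (proj₁ (proj₁ g)) (Str.τ₁ s) (Str.τ₂ s)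
goodQ⇒desc s (pre , _ , one , _) = let q , e = G-spec s pre in oneFaced⇒desc s q (subst OneFaced e one)

opaque

  decodeQ : ∀ {S n} (s : Str (n * 4)) → GoodQ S n s → ∀ b → Σ (QPair S n) λ p → RepQ p s b
  decodeQ {S} {n} s g b = record
      { q = record { map = M ; root = code (Str.root s , b) } ; quad = quadrangulation ; bip = bipartite
      ; onS = onSurface-to {n = n} {s} repM S g ; faces = proj₂ (proj₂ (euler-map {n = n} {s} repM)) ; v₀ = code origin } , repM , refl
    where
    open SideMap s (proj₁ g) (goodQ⇒desc {S} {n} s g)
    open RepMLaws {M} {code origin} {n * 4} {s} repM using (quadrangulation; bipartite)

-- Cutting a pointed quadrangulation into sides

module Distances {S : Surface} {n : ℕ} (p : QPair S n) where

  open QPair p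
  open RootedMap q public using (size; τ₀; τ₁; τ₂; τ₀-inv; τ₁-inv; τ₂-inv; Walk; Dist; SameV; VStep; AnyStep)
  private
    module M = RootedMap q
  open MapLemmas M.map public

  sameV? : ∀ x y → Dec (SameV x y)
  sameV? x y = map′ Star⇒Closure Closure⇒Star (Warshall.star? VStep (λ x y → (y Finₚ.≟ τ₁ x) ⊎-dec (y Finₚ.≟ τ₂ x)) x y)

  walk? : ∀ k x y → Dec (Walk k x y)
  walk? zero    x y = map′ (walk-around M.stay) walk-zero (sameV? x y)
  walk? (suc k) x y = map′ (λ (z , c , w) → around-walk c (M.go w)) walk-first
    (Finₚ.any? λ z → sameV? x z ×-dec walk? k (τ₀ z) y)

  some-walk : ∀ {x y} → Closure AnyStep x y → ∃ λ k → Walk k x y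
  some-walk here                          = 0 , M.stay
  some-walk (step (inj₁ (inj₁ refl)) c) = let k , w = some-walk c in suc k , M.go w
  some-walk (step (inj₁ (inj₂ refl)) c) = let k , w = some-walk c in k , M.turn (inj₁ refl) w
  some-walk (step (inj₂ refl) c)        = let k , w = some-walk c in k , M.turn (inj₂ refl) w

  opaque
    distance : ∀ x → ∃ λ i → Dist v₀ x i
    distance x = let k , w = some-walk (M.connected v₀ x) ; i , w′ , _ , low = least (λ j → walk? j v₀ x) k w in i , w′ , low

  d : Fin size → ℕ
  d x = proj₁ (distance x)

  d-dist : ∀ x → Dist v₀ x (d x)
  d-dist x = proj₂ (distance x)

  d-around : ∀ {x y} → SameV x y → d y ≡ d x
  d-around {x} {y} c = dist-unique (d-dist y) (walk-around (proj₁ (d-dist x)) c ,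
    λ j j< w → proj₂ (d-dist x) j j< (walk-around w (IsEquivalence.sym sameV-equiv c)))

  d₁ : ∀ x → d (τ₁ x) ≡ d x
  d₁ x = d-around (step (inj₁ refl) here)

  d₂ : ∀ x → d (τ₂ x) ≡ d x
  d₂ x = d-around (step (inj₂ refl) here)

  d-v₀ : d v₀ ≡ 0
  d-v₀ = dist-unique {x = v₀} {y = v₀} (d-dist v₀) (M.stay , λ j ())

  colour-walk : ∀ {k x y} → Walk k x y → proj₁ bip y ≡ iter not k (proj₁ bip x)
  colour-walk M.stay = refl
  colour-walk {k} (M.turn (inj₁ refl) w) = trans (colour-walk w) (cong (iter not k) (proj₁ (proj₂ bip) _))
  colour-walk {k} (M.turn (inj₂ refl) w) = trans (colour-walk w) (cong (iter not k) (proj₁ (proj₂ (proj₂ bip)) _))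
  colour-walk {suc k} {x} (M.go w) = trans (colour-walk w)
    (trans (cong (iter not k) (¬≡⇒not (proj₂ (proj₂ (proj₂ bip)) x))) (sym (iter-suc not k _)))

  Up : Fin size → Set
  Up y = suc (d (τ₀ y)) ≡ d y

  -- Distances of adjacent vertices differ by at most 1. If they were equal, walks of the same
  -- length would reach both ends and give them the same colour, against bipartiteness.
  ¬up-d : ∀ {y} → ¬ Up y → d (τ₀ y) ≡ suc (d y)
  ¬up-d {y} ¬u with ℕₚ.<-cmp (d (τ₀ y)) (d y)
  ... | tri< lt _ _ = contradiction (ℕₚ.≤-antisym lt (dist-≤ (d-dist y)
          (subst (Walk _ v₀) (τ₀-inv y) (walk-go (proj₁ (d-dist (τ₀ y))))))) ¬u
  ... | tri≈ _ e _  = contradiction (trans (colour-walk (proj₁ (d-dist (τ₀ y))))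
          (trans (cong (λ k → iter not k (proj₁ bip v₀)) e) (sym (colour-walk (proj₁ (d-dist y)))))) (proj₂ (proj₂ (proj₂ bip)) y)
  ... | tri> _ _ gt = ℕₚ.≤-antisym (dist-≤ (d-dist (τ₀ y)) (walk-go (proj₁ (d-dist y)))) gt

  up? : ∀ y → Dec (Up y)
  up? y = suc (d (τ₀ y)) ℕ.≟ d y

  up-τ₀ : ∀ {y} → ¬ Up y → Up (τ₀ y)
  up-τ₀ {y} ¬u = trans (cong (suc ∘ d) (τ₀-inv y)) (sym (¬up-d ¬u))

  ¬up-τ₀ : ∀ {y} → Up y → ¬ Up (τ₀ y)
  ¬up-τ₀ {y} u u′ = ℕₚ.m≢1+n+m (d y) {1} (trans (sym u) (cong suc (trans (sym u′) (cong (suc ∘ d) (τ₀-inv y)))))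

  up-or-down : ∀ y → Up y ⊎ d (τ₀ y) ≡ suc (d y)
  up-or-down y with up? y
  ... | yes u = inj₁ u
  ... | no ¬u = inj₂ (¬up-d ¬u)

module EncodeQ {S : Surface} {n : ℕ} (p : QPair S n) where

  open QPair p
  open Distances p
  private
    module M = RootedMap q
  open Dihedral τ₀ τ₁ τ₀-inv τ₁-inv using (rot)

  τ₀-inj : ∀ {x y} → τ₀ x ≡ τ₀ y → x ≡ y
  τ₀-inj {x} {y} h = trans (sym (τ₀-inv x)) (trans (cong τ₀ h) (τ₀-inv y))

  τ₁-inj : ∀ {x y} → τ₁ x ≡ τ₁ y → x ≡ y
  τ₁-inj {x} {y} h = trans (sym (τ₁-inv x)) (trans (cong τ₁ h) (τ₁-inv y))

  tops : ∃ (Transversal _≡_ Up (_∈ List.allFin size))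
  tops = transversal isEquivalence Finₚ._≟_ up? (List.allFin size)

  m : ℕ
  m = proj₁ tops

  up : Fin m → Fin size
  up = proj₁ (proj₂ tops)

  up-up : ∀ x → Up (up x)
  up-up = proj₁ (proj₂ (proj₂ tops))

  up-inj : ∀ {x y} → up x ≡ up y → x ≡ y
  up-inj {x} {y} = proj₁ (proj₂ (proj₂ (proj₂ tops))) x y

  side-of : ∀ y → Up y → ∃ λ x → y ≡ up x
  side-of y = proj₂ (proj₂ (proj₂ (proj₂ tops))) y (∈-allFin y)

  opaque
    side : Fin size → Fin m
    side y with up? y
    ... | yes u = proj₁ (side-of y u)
    ... | no ¬u = proj₁ (side-of (τ₀ y) (up-τ₀ ¬u))

    up-side : ∀ {y} → Up y → up (side y) ≡ y
    up-side {y} u with up? y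
    ... | yes v = sym (proj₂ (side-of y v))
    ... | no ¬u = contradiction u ¬u

    up-side-¬ : ∀ {y} → ¬ Up y → up (side y) ≡ τ₀ y
    up-side-¬ {y} ¬u with up? y
    ... | yes u = contradiction u ¬u
    ... | no ¬v = sym (proj₂ (side-of (τ₀ y) (up-τ₀ ¬v)))

  side-up : ∀ x → side (up x) ≡ x
  side-up x = up-inj (up-side (up-up x))

  side-τ₀ : ∀ y → side (τ₀ y) ≡ side y
  side-τ₀ y with up? y
  ... | yes u = up-inj (trans (up-side-¬ (¬up-τ₀ u)) (trans (τ₀-inv y) (sym (up-side u))))
  ... | no ¬u = up-inj (trans (up-side (up-τ₀ ¬u)) (sym (up-side-¬ ¬u)))

  same-side : ∀ {y z} → side y ≡ side z → y ≡ z ⊎ y ≡ τ₀ z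
  same-side {y} {z} h with up? y | up? z
  ... | yes u | yes v = inj₁ (trans (sym (up-side u)) (trans (cong up h) (up-side v)))
  ... | yes u | no ¬v = inj₂ (trans (sym (up-side u)) (trans (cong up h) (up-side-¬ ¬v)))
  ... | no ¬u | yes v = inj₂ (τ₀-inj (trans (sym (up-side-¬ ¬u)) (trans (cong up h) (trans (up-side v) (sym (τ₀-inv z))))))
  ... | no ¬u | no ¬v = inj₁ (τ₀-inj (trans (sym (up-side-¬ ¬u)) (trans (cong up h) (up-side-¬ ¬v))))

  lev : Fin m → ℕ
  lev x = d (up x)

  -- The sides following x in its face, at the upper and at the lower end of x.
  f g h : Fin m → Fin size
  f x = up x
  g x = τ₁ (f x)
  h x = τ₁ (τ₀ (f x))

  α β : Fin m → Fin m
  α x = side (g x)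
  β x = side (h x)

  -- `Up (g x)` says that the face does not go on upwards after the upper end of x. If it does, τ₀
  -- is the neighbour at the upper end and τ₂ the one at the lower end, otherwise the reverse; this
  -- undoes T₁ of `Sides`.
  t₀ t₁ t₂ : Fin m → Fin m
  t₀ x with up? (g x)
  ... | yes _ = β x
  ... | no _  = α x
  t₁ x = side (τ₂ (up x))
  t₂ x with up? (g x)
  ... | yes _ = α x
  ... | no _  = β x

  t₀-yes : ∀ {x} → Up (g x) → t₀ x ≡ β x
  t₀-yes {x} u with up? (g x)
  ... | yes _ = refl
  ... | no ¬u = contradiction u ¬u

  t₀-no : ∀ {x} → ¬ Up (g x) → t₀ x ≡ α x
  t₀-no {x} ¬u with up? (g x)
  ... | yes u = contradiction u ¬u
  ... | no _  = refl

  t₂-yes : ∀ {x} → Up (g x) → t₂ x ≡ α x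
  t₂-yes {x} u with up? (g x)
  ... | yes _ = refl
  ... | no ¬u = contradiction u ¬u

  t₂-no : ∀ {x} → ¬ Up (g x) → t₂ x ≡ β x
  t₂-no {x} ¬u with up? (g x)
  ... | yes u = contradiction u ¬u
  ... | no _  = refl

  opposite : Fin m → Fin size
  opposite x = τ₁ (τ₀ (h x))

  -- The face of x has exactly four sides.
  closing : ∀ x → τ₀ (opposite x) ≡ τ₁ (τ₀ (g x))
  closing x = τ₁-inj (trans (τ₀-inj (trans (τ₁-inj (trans (proj₁ (degree⇒square (f x) (quad (f x)))) (sym (τ₁-inv _)))) (sym (τ₀-inv _)))) (sym (τ₁-inv _)))

  opposite-≢ : ∀ x → ¬ opposite x ≡ f x
  opposite-≢ x = proj₂ (degree⇒square (f x) (quad (f x)))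

  d-opposite : ∀ x → d (opposite x) ≡ d (τ₀ (h x))
  d-opposite x = d₁ _

  d-h : ∀ x → d (h x) ≡ d (τ₀ (f x))
  d-h x = d₁ _

  -- With e the distance of the lower end of x, the face, read from that end along x, has distances
  -- e, e+1, e+2, e+1 (`rising`), e, e+1, e, e+1 (`flat`) or e, e+1, e, e-1 (`falling`). The names
  -- are those of the direction of the edge of the map.
  data Kind (x : Fin m) : Set where
    rising  : ¬ Up (g x) → ¬ Up (h x) → up (α x) ≡ τ₀ (g x) → up (β x) ≡ τ₀ (h x) → Up (g (α x)) → ¬ Up (g (β x)) → Kind x
    flat    : Up (g x) → ¬ Up (h x) → up (α x) ≡ g x → up (β x) ≡ τ₀ (h x) → Up (g (β x)) → Kind x
    falling : Up (g x) → Up (h x) → up (α x) ≡ g x → up (β x) ≡ h x → ¬ Up (g (β x)) → Kind x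

  kind : ∀ x → Kind x
  kind x with up? (g x) | up? (h x)
  ... | no ¬g | yes h↑ = contradiction h↑ ¬h↑
    where
    -- The levels of the face would be e, e + 1, e + 2 and at most e - 1.
    e = d (τ₀ (f x))
    d-o : d (τ₀ (opposite x)) ≡ suc (suc e)
    d-o = trans (cong d (closing x)) (trans (d₁ _) (trans (¬up-d ¬g) (cong suc (trans (d₁ _) (sym (up-up x))))))
    ¬h↑ : ¬ Up (h x)
    ¬h↑ u with up-or-down (opposite x)
    ... | inj₁ v = ℕₚ.m≢1+n+m e {3} (trans (sym (trans u (d-h x))) (cong suc (trans (sym (d-opposite x)) (trans (sym v) (cong suc d-o)))))
    ... | inj₂ v = ℕₚ.m≢1+n+m e {1} (trans (sym (trans u (d-h x))) (cong suc (trans (sym (d-opposite x)) (ℕₚ.suc-injective (trans (sym v) d-o)))))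
  ... | no ¬g | no ¬h = rising ¬g ¬h (up-side-¬ ¬g) (up-side-¬ ¬h)
          (subst (Up ∘ τ₁) (sym (up-side-¬ ¬g)) (subst Up (closing x) (up-τ₀ ¬o)))
          (subst (¬_ ∘ Up ∘ τ₁) (sym (up-side-¬ ¬h)) ¬o)
    where
    e = d (τ₀ (f x))
    d-o : d (τ₀ (opposite x)) ≡ suc (suc e)
    d-o = trans (cong d (closing x)) (trans (d₁ _) (trans (¬up-d ¬g) (cong suc (trans (d₁ _) (sym (up-up x))))))
    ¬o : ¬ Up (opposite x)
    ¬o v = ℕₚ.m≢1+n+m (suc e) {1} (trans (sym (trans (d-opposite x) (trans (¬up-d ¬h) (cong suc (d-h x))))) (trans (sym v) (cong suc d-o)))
  ... | yes g↑ | no ¬h = flat g↑ ¬h (up-side g↑) (up-side-¬ ¬h) (subst (Up ∘ τ₁) (sym (up-side-¬ ¬h)) o↑)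
    where
    o↑ : Up (opposite x)
    o↑ = trans (cong suc (trans (cong d (closing x)) (d₁ _))) (trans g↑ (trans (d₁ _) (trans (sym (up-up x))
           (trans (cong suc (sym (d-h x))) (trans (sym (¬up-d ¬h)) (sym (d-opposite x)))))))
  ... | yes g↑ | yes h↑ = falling g↑ h↑ (up-side g↑) (up-side h↑)
          (subst (¬_ ∘ Up ∘ τ₁) (sym (up-side h↑)) (subst (¬_ ∘ Up) (sym (τ₁-inv _)) (¬up-τ₀ (up-up x))))

  side-f : ∀ x {y} → y ≡ τ₁ (g x) → side y ≡ x
  side-f x refl = trans (cong side (τ₁-inv _)) (side-up x)

  side-τ₀f : ∀ x {y} → y ≡ τ₁ (h x) → side y ≡ x
  side-τ₀f x refl = trans (cong side (τ₁-inv _)) (trans (side-τ₀ _) (side-up x))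

  α-α : ∀ x → up (α x) ≡ g x → α (α x) ≡ x
  α-α x e = side-f x (cong τ₁ e)

  β-α : ∀ x → up (α x) ≡ τ₀ (g x) → β (α x) ≡ x
  β-α x e = side-f x (cong τ₁ (trans (cong τ₀ e) (τ₀-inv _)))

  α-β : ∀ x → up (β x) ≡ h x → α (β x) ≡ x
  α-β x e = side-τ₀f x (cong τ₁ e)

  β-β : ∀ x → up (β x) ≡ τ₀ (h x) → β (β x) ≡ x
  β-β x e = side-τ₀f x (cong τ₁ (trans (cong τ₀ e) (τ₀-inv _)))

  g-α : ∀ x → up (α x) ≡ g x → Up (g (α x))
  g-α x e = subst Up (sym (trans (cong τ₁ e) (τ₁-inv _))) (up-up x)

  t₀-inv : ∀ x → t₀ (t₀ x) ≡ x
  t₀-inv x = by (kind x)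
    where
    by : Kind x → t₀ (t₀ x) ≡ x
    by (rising ¬g _ eα _ gα _) = trans (cong t₀ (t₀-no ¬g)) (trans (t₀-yes gα) (β-α x eα))
    by (flat g↑ _ _ eβ gβ) = trans (cong t₀ (t₀-yes g↑)) (trans (t₀-yes gβ) (β-β x eβ))
    by (falling g↑ _ _ eβ ¬gβ) = trans (cong t₀ (t₀-yes g↑)) (trans (t₀-no ¬gβ) (α-β x eβ))

  t₂-inv : ∀ x → t₂ (t₂ x) ≡ x
  t₂-inv x = by (kind x)
    where
    by : Kind x → t₂ (t₂ x) ≡ x
    by (rising ¬g _ _ eβ _ ¬gβ) = trans (cong t₂ (t₂-no ¬g)) (trans (t₂-no ¬gβ) (β-β x eβ))
    by (flat g↑ _ eα _ _) = trans (cong t₂ (t₂-yes g↑)) (trans (t₂-yes (g-α x eα)) (α-α x eα))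
    by (falling g↑ _ eα _ _) = trans (cong t₂ (t₂-yes g↑)) (trans (t₂-yes (g-α x eα)) (α-α x eα))

  d-≢ : ∀ y → ¬ d (τ₀ y) ≡ d y
  d-≢ y e with up-or-down y
  ... | inj₁ u = ℕₚ.1+n≢n (trans u (sym e))
  ... | inj₂ v = ℕₚ.1+n≢n (trans (sym v) e)

  α-≢ : ∀ x → ¬ α x ≡ x
  α-≢ x e with same-side (trans e (sym (side-up x)))
  ... | inj₁ k = M.τ₁-fpf _ k
  ... | inj₂ k = d-≢ (f x) (trans (cong d (sym k)) (d₁ _))

  β-≢ : ∀ x → ¬ β x ≡ x
  β-≢ x e with same-side (trans e (sym (side-up x)))
  ... | inj₁ k = d-≢ (f x) (trans (sym (d-h x)) (cong d k))
  ... | inj₂ k = M.τ₁-fpf _ k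

  α≢β : ∀ x → ¬ α x ≡ β x
  α≢β x e with same-side e
  ... | inj₁ k = M.τ₀-fpf (f x) (sym (τ₁-inj k))
  ... | inj₂ k = opposite-≢ x (trans (cong τ₁ (sym k)) (τ₁-inv _))

  t₀-fpf : ∀ x → ¬ t₀ x ≡ x
  t₀-fpf x with up? (g x)
  ... | yes _ = β-≢ x
  ... | no _  = α-≢ x

  t₂-fpf : ∀ x → ¬ t₂ x ≡ x
  t₂-fpf x with up? (g x)
  ... | yes _ = α-≢ x
  ... | no _  = β-≢ x

  t₀≢t₂ : ∀ x → ¬ t₂ x ≡ t₀ x
  t₀≢t₂ x with up? (g x)
  ... | yes _ = α≢β x
  ... | no _  = α≢β x ∘ sym

  side-closing : ∀ x {y z} → y ≡ opposite x → z ≡ τ₁ (τ₀ (g x)) → side y ≡ side z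
  side-closing x refl refl = trans (sym (side-τ₀ _)) (cong side (closing x))

  comm-rising : ∀ x → ¬ Up (g x) → t₀ (t₂ x) ≡ t₂ (t₀ x)
  comm-rising x ¬g = by (kind x)
    where
    by : Kind x → t₀ (t₂ x) ≡ t₂ (t₀ x)
    by (rising ¬g _ eα eβ gα ¬gβ) = trans (cong t₀ (t₂-no ¬g)) (trans (t₀-no ¬gβ)
            (trans (side-closing x (cong τ₁ eβ) (cong τ₁ eα)) (trans (sym (t₂-yes gα)) (cong t₂ (sym (t₀-no ¬g))))))
    by (flat g↑ _ _ _ _) = contradiction g↑ ¬g
    by (falling g↑ _ _ _ _) = contradiction g↑ ¬g

  t-comm : ∀ x → t₀ (t₂ x) ≡ t₂ (t₀ x)
  t-comm x = by (kind x)
    where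
    by : Kind x → t₀ (t₂ x) ≡ t₂ (t₀ x)
    by (rising ¬g _ _ _ _ _) = comm-rising x ¬g
    by (flat g↑ _ eα eβ gβ) = trans (cong t₀ (t₂-yes g↑)) (trans (t₀-yes (g-α x eα))
            (trans (sym (side-closing x (cong τ₁ eβ) (cong (τ₁ ∘ τ₀) eα))) (trans (sym (t₂-yes gβ)) (cong t₂ (sym (t₀-yes g↑))))))
    -- `t₀ x` is a rising side of the same face; its identity is carried over by the involution t₀.
    by (falling g↑ _ _ _ ¬gβ) = trans (cong (t₀ ∘ t₂) (sym (t₀-inv x)))
            (trans (cong t₀ (sym (comm-rising (t₀ x) (subst (¬_ ∘ Up ∘ g) (sym (t₀-yes g↑)) ¬gβ)))) (t₀-inv _))

  lev₂ : ∀ x → lev (t₂ x) ≡ lev x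
  lev₂ x = by (kind x)
    where
    by : Kind x → lev (t₂ x) ≡ lev x
    by (rising ¬g ¬h _ eβ _ _) = trans (cong lev (t₂-no ¬g)) (trans (cong d eβ) (trans (¬up-d ¬h) (trans (cong suc (d-h x)) (up-up x))))
    by (flat g↑ _ eα _ _) = trans (cong lev (t₂-yes g↑)) (trans (cong d eα) (d₁ _))
    by (falling g↑ _ eα _ _) = trans (cong lev (t₂-yes g↑)) (trans (cong d eα) (d₁ _))

  lev₀-rising : ∀ x → ¬ Up (g x) → lev (t₀ x) ≡ suc (lev x)
  lev₀-rising x ¬g = trans (cong lev (t₀-no ¬g)) (trans (cong d (up-side-¬ ¬g)) (trans (¬up-d ¬g) (cong suc (d₁ _))))

  lev₀-flat : ∀ x → Up (g x) → ¬ Up (h x) → lev (t₀ x) ≡ lev x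
  lev₀-flat x g↑ ¬h = trans (cong lev (t₀-yes g↑)) (trans (cong d (up-side-¬ ¬h)) (trans (¬up-d ¬h) (trans (cong suc (d-h x)) (up-up x))))

  lev₀-falling : ∀ x → Up (g x) → Up (h x) → suc (lev (t₀ x)) ≡ lev x
  lev₀-falling x g↑ h↑ = trans (cong (suc ∘ lev) (t₀-yes g↑)) (trans (cong (suc ∘ d) (up-side h↑)) (trans (cong suc (d-h x)) (up-up x)))

  lev-adjacent : ∀ x → lev (t₀ x) ≡ suc (lev x) ⊎ lev (t₀ x) ≡ lev x ⊎ suc (lev (t₀ x)) ≡ lev x
  lev-adjacent x = by (kind x)
    where
    by : Kind x → lev (t₀ x) ≡ suc (lev x) ⊎ lev (t₀ x) ≡ lev x ⊎ suc (lev (t₀ x)) ≡ lev x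
    by (rising ¬g _ _ _ _ _) = inj₁ (lev₀-rising x ¬g)
    by (flat g↑ ¬h _ _ _) = inj₂ (inj₁ (lev₀-flat x g↑ ¬h))
    by (falling g↑ h↑ _ _ _) = inj₂ (inj₂ (lev₀-falling x g↑ h↑))

  τ₂-up : ∀ {y} → Up y → Up (τ₂ y)
  τ₂-up {y} u = trans (cong (suc ∘ d) (M.τ₀τ₂-comm y)) (trans (cong suc (d₂ _)) (trans u (sym (d₂ y))))

  up-t₁ : ∀ x → up (t₁ x) ≡ τ₂ (up x)
  up-t₁ x = up-side (τ₂-up (up-up x))

  descend : ∀ {y} i → 1 ≤ i → i ≤ d y → Closure AnyStep y v₀ → ∃ λ x → lev x ≡ i
  descend i 1≤i i≤ here = contradiction (ℕₚ.≤-trans 1≤i (ℕₚ.≤-trans i≤ (ℕₚ.≤-reflexive d-v₀))) λ ()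
  descend i 1≤i i≤ (step (inj₁ (inj₂ refl)) c) = descend i 1≤i (subst (i ≤_) (sym (d₁ _)) i≤) c
  descend i 1≤i i≤ (step (inj₂ refl) c)        = descend i 1≤i (subst (i ≤_) (sym (d₂ _)) i≤) c
  descend {y} i 1≤i i≤ (step (inj₁ (inj₁ refl)) c) with up-or-down y
  ... | inj₂ v = descend i 1≤i (ℕₚ.≤-trans i≤ (ℕₚ.≤-trans (ℕₚ.n≤1+n _) (ℕₚ.≤-reflexive (sym v)))) c
  ... | inj₁ u with i ℕ.≟ d y
  ...   | yes e = side y , trans (cong d (up-side u)) (sym e)
  ...   | no ≢  = descend i 1≤i (ℕₚ.≤-pred (ℕₚ.≤-trans (ℕₚ.≤∧≢⇒< i≤ ≢) (ℕₚ.≤-reflexive (sym u)))) c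

  bound : ∀ x → lev x < suc m
  bound x = s≤s (level-bound lev (λ x i 1≤i i≤ → descend i 1≤i i≤ (M.connected _ v₀)) x)

  v₀-¬up : ¬ Up v₀
  v₀-¬up u = contradiction (trans u d-v₀) λ ()

  frame : Frame t₀ t₂ lev
  frame = record
    { τ₀-inv = t₀-inv ; τ₂-inv = t₂-inv ; τ₀-fpf = t₀-fpf ; τ₂-fpf = t₂-fpf ; comm = t-comm
    ; τ₀τ₂-fpf = λ x e → t₀≢t₂ x (trans (sym (t₀-inv _)) (cong t₀ e))
    ; ℓ-τ₂ = lev₂ ; adjacent = lev-adjacent ; positive = λ x → subst (1 ≤_) (up-up x) (s≤s z≤n)
    ; bounded = λ x → ℕₚ.≤-pred (bound x)
    ; lowest = side v₀ , trans (cong d (up-side-¬ v₀-¬up)) (trans (¬up-d v₀-¬up) (cong suc d-v₀)) }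

  gluing : Gluing lev t₁
  gluing = record
    { τ₁-inv = λ x → up-inj (trans (up-t₁ (t₁ x)) (trans (cong τ₂ (up-t₁ x)) (τ₂-inv _)))
    ; τ₁-fpf = λ x e → M.τ₂-fpf (up x) (trans (sym (up-t₁ x)) (cong up e))
    ; ℓ-τ₁ = λ x → trans (cong d (up-t₁ x)) (d₂ _) }

  module Str′ = FromFunctions t₀ t₁ t₂ lev bound (side M.root)
  open Str′ using (str; str-pre; τ₀≡; τ₁≡; τ₂≡; ℓ≡)

  pre : Pre str
  pre = str-pre frame gluing

  module L = SideLaws (proj₁ pre) (proj₂ pre)

  θ : L.Flag → Fin size
  θ (x , true)  = up x
  θ (x , false) = τ₀ (up x)

  top? : ∀ {y} → Dec (Up y) → Bool
  top? (yes _) = true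
  top? (no _)  = false

  θ⁻¹ : Fin size → L.Flag
  θ⁻¹ y = side y , top? (up? y)

  θ-θ⁻¹ : ∀ y → θ (θ⁻¹ y) ≡ y
  θ-θ⁻¹ y with up? y
  ... | yes u = up-side u
  ... | no ¬u = trans (cong τ₀ (up-side-¬ ¬u)) (τ₀-inv y)

  θ⁻¹-θ : ∀ a → θ⁻¹ (θ a) ≡ a
  θ⁻¹-θ (x , true) with up? (up x)
  ... | yes _ = cong (_, true) (side-up x)
  ... | no ¬u = contradiction (up-up x) ¬u
  θ⁻¹-θ (x , false) with up? (τ₀ (up x))
  ... | yes u = contradiction u (¬up-τ₀ (up-up x))
  ... | no _  = cong (_, false) (trans (side-τ₀ _) (side-up x))

  θ₀ : ∀ a → θ (L.T₀ a) ≡ τ₀ (θ a)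
  θ₀ (x , true)  = refl
  θ₀ (x , false) = sym (τ₀-inv _)

  θ₂ : ∀ a → θ (L.T₂ a) ≡ τ₂ (θ a)
  θ₂ (x , true)  = trans (cong up (τ₁≡ x)) (up-t₁ x)
  θ₂ (x , false) = trans (cong τ₀ (trans (cong up (τ₁≡ x)) (up-t₁ x))) (M.τ₀τ₂-comm _)

  ℓ₀ : ∀ x → Str.ℓ str (Str.τ₀ str x) ≡ lev (t₀ x)
  ℓ₀ x = trans (cong (Str.ℓ str) (τ₀≡ x)) (ℓ≡ _)

  L-up : ∀ x → ¬ Up (g x) → L.Up x
  L-up x ¬g = trans (ℓ₀ x) (trans (lev₀-rising x ¬g) (cong suc (sym (ℓ≡ x))))

  L-flat : ∀ x → Up (g x) → ¬ Up (h x) → Str.ℓ str (Str.τ₀ str x) ≡ Str.ℓ str x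
  L-flat x g↑ ¬h = trans (ℓ₀ x) (trans (lev₀-flat x g↑ ¬h) (sym (ℓ≡ x)))

  L-down : ∀ x → Up (g x) → Up (h x) → L.Down x
  L-down x g↑ h↑ = trans (cong suc (ℓ₀ x)) (trans (lev₀-falling x g↑ h↑) (sym (ℓ≡ x)))

  θ₁ : ∀ a → θ (L.T₁ a) ≡ τ₁ (θ a)
  θ₁ (x , true) = by (kind x)
    where
    by : Kind x → θ (L.T₁ (x , true)) ≡ τ₁ (up x)
    by (rising ¬g _ eα _ _ _) = trans (cong θ (L.T₁-up-true (L-up x ¬g)))
            (trans (cong (τ₀ ∘ up) (trans (τ₀≡ x) (t₀-no ¬g))) (trans (cong τ₀ eα) (τ₀-inv _)))
    by (flat g↑ ¬h eα _ _) = trans (cong θ (L.T₁-¬up-true (L.¬flat-up (L-flat x g↑ ¬h)))) (trans (cong up (trans (τ₂≡ x) (t₂-yes g↑))) eα)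
    by (falling g↑ h↑ eα _ _) = trans (cong θ (L.T₁-¬up-true (L.¬up-down (L-down x g↑ h↑)))) (trans (cong up (trans (τ₂≡ x) (t₂-yes g↑))) eα)
  θ₁ (x , false) = by (kind x)
    where
    by : Kind x → θ (L.T₁ (x , false)) ≡ τ₁ (τ₀ (up x))
    by (rising ¬g ¬h _ eβ _ _) = trans (cong θ (L.T₁-up-false (L-up x ¬g)))
            (trans (cong (τ₀ ∘ up) (trans (τ₂≡ x) (t₂-no ¬g))) (trans (cong τ₀ eβ) (τ₀-inv _)))
    by (flat g↑ ¬h _ eβ _) = trans (cong θ (L.T₁-flat-false (L-flat x g↑ ¬h)))
            (trans (cong (τ₀ ∘ up) (trans (τ₀≡ x) (t₀-yes g↑))) (trans (cong τ₀ eβ) (τ₀-inv _)))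
    by (falling g↑ h↑ _ eβ _) = trans (cong θ (L.T₁-down-false (L-down x g↑ h↑))) (trans (cong up (trans (τ₀≡ x) (t₀-yes g↑))) eβ)

  θ-dist : ∀ a → Dist v₀ (θ a) (L.ht a)
  θ-dist (x , true)  = subst (Dist v₀ (up x)) (sym (ℓ≡ x)) (d-dist (up x))
  θ-dist (x , false) = subst (Dist v₀ (τ₀ (up x))) (trans (cong ℕ.pred (up-up x)) (cong ℕ.pred (sym (ℓ≡ x)))) (d-dist (τ₀ (up x)))

  rep : RepM M.map v₀ str
  rep = record { pre = pre ; θ = θ ; θ⁻¹ = θ⁻¹ ; θ⁻¹-θ = θ⁻¹-θ ; θ-θ⁻¹ = θ-θ⁻¹ ; θ₀ = θ₀ ; θ₁ = θ₁ ; θ₂ = θ₂ ; θ-dist = θ-dist }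

  size≡ : m ≡ n * 4
  size≡ = klein-blocks L.τ₀-inv L.τ₂-inv L.τ₀-fpf L.τ₂-fpf L.comm L.τ₀τ₂-fpf (RepMLaws.faces-from rep faces)

opaque

  encodeQ : ∀ {S n} (p : QPair S n) → Σ (Str (n * 4)) λ s → ∃ (RepQ p s)
  encodeQ p = subst (λ N → Σ (Str N) λ s → ∃ (RepQ p s)) size≡ (str , proj₂ (θ⁻¹ root) , rep , θ-θ⁻¹ root)
    where
    open EncodeQ p
    open Str′ using (str)
    root : Fin (RootedMap.size (QPair.q p))
    root = RootedMap.root (QPair.q p)

-- Counting isomorphism classes

module _ {N : ℕ} {s s′ : Str N} (f : Iso s s′) (pre : Pre s) where

  open Iso f
  private
    g : Iso s′ s
    g = iso-sym f
    pre′ : Pre s′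
    pre′ = iso-pre f pre

  counts-iso : ∀ {V V′ : Fin N → Fin N → Set} → IsEquivalence V′ → (∀ {x y} → V x y → V′ (to x) (to y)) →
    (∀ {x y} → V′ x y → V (from x) (from y)) → ∀ {ι} → HasCounts s V ι → HasCounts s′ V′ ι
  counts-iso {V} {V′} V′-equiv V-to V-from (t , l) =
      transportCount V′-equiv to V-to V-back (λ _ → tt) (λ y _ → from y , tt , hit y) t ,
      λ i → transportCount V′-equiv to V-to V-back level (λ y h → from y , level′ h , hit y) (proj₁ (l i)) ,
            transportCount (star-isEquiv (flip-involution (Gluing.τ₁-inv (proj₂ pre′)))) to C-to C-back level
              (λ y h → from y , level′ h , subst (SameCorner s′ y) (sym (to-from y)) ε) (proj₂ (l i))
    where
    V-back : ∀ {x y} → V′ (to x) (to y) → V x y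
    V-back {x} {y} c = subst₂ V (from-to x) (from-to y) (V-from c)
    hit : ∀ y → V′ y (to (from y))
    hit y = subst (V′ y) (sym (to-from y)) (IsEquivalence.refl V′-equiv)
    level : ∀ {i x} → Str.ℓ s x ≡ i → Str.ℓ s′ (to x) ≡ i
    level h = trans (iso-ℓ _) h
    level′ : ∀ {i y} → Str.ℓ s′ y ≡ i → Str.ℓ s (from y) ≡ i
    level′ h = trans (Iso.iso-ℓ g _) h
    C-to : ∀ {x y} → SameCorner s x y → SameCorner s′ (to x) (to y)
    C-to = Star.gmap to λ { refl → iso₁ _ }
    C-back : ∀ {x y} → SameCorner s′ (to x) (to y) → SameCorner s x y
    C-back {x} {y} c = subst₂ (SameCorner s) (from-to x) (from-to y) (Star.gmap from (λ { refl → Iso.iso₁ g _ }) c)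

  inv-iso : inv s ≡ inv s′
  inv-iso = counts-unique s′ pre′ V-equiv (counts-iso V-equiv
      (Star.gmap to λ { (inj₁ refl) → inj₁ (iso₁ _) ; (inj₂ refl) → inj₂ (iso₂ _) })
      (Star.gmap from λ { (inj₁ refl) → inj₁ (Iso.iso₁ g _) ; (inj₂ refl) → inj₂ (Iso.iso₂ g _) }) (inv-spec s pre))
      (inv-spec s′ pre′)
    where
    V-equiv : IsEquivalence (SameVertex s′)
    V-equiv = conn-equiv (Gluing.τ₁-inv (proj₂ pre′)) (Frame.τ₂-inv (proj₁ pre′))

  -- `G s` and `G s′` need not be isomorphic, since G depends on the numbering. But `inv (G s)`
  -- counts vertices and τ₁-orbits of s itself, by `invQ-spec`, and an isomorphism preserves those.
  invQ-iso : inv (G s) ≡ inv (G s′)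
  invQ-iso = counts-unique s′ pre′ (topVertex-equiv s′ pre′) (counts-iso (topVertex-equiv s′ pre′)
      (Star.gmap (iso-flag f pre) λ { {a} (inj₁ refl) → inj₁ (iso-T₁ f pre a) ; {a} (inj₂ refl) → inj₂ (iso-T₂ f pre a) })
      (Star.gmap (iso-flag g pre′) λ { {a} (inj₁ refl) → inj₁ (iso-T₁ g pre′ a) ; {a} (inj₂ refl) → inj₂ (iso-T₂ g pre′ a) })
      (invQ-spec s pre))
      (invQ-spec s′ pre′)

-- The correspondence

module _ {S : Surface} {n : ℕ} where

  private
    N : ℕ
    N = n * 4

  goodU-resp : ∀ {s s′ : Str N} → Iso s s′ → GoodU S n s → GoodU S n s′
  goodU-resp f g = RepLLaws.good (RepLLaws.relabelled (proj₂ (decodeL {S} {n} _ g)) f)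

  rep⇒goodQ : ∀ (p : QPair S n) {s : Str N} {b} → RepQ p s b → GoodQ S n s
  rep⇒goodQ p (rep , _) = onSurface-from {n = n} rep S (QPair.onS p)

  -- `GoodQ` is stated through G, which does not follow a renumbering. The proof goes through the
  -- quadrangulation instead: s and s′ represent the same one, and representing it implies `GoodQ`.
  goodQ-resp : ∀ {s s′ : Str N} → Iso s s′ → GoodQ S n s → GoodQ S n s′
  goodQ-resp {s} {s′} f g = rep⇒goodQ p {s′} {true} (relabelledQ {p = p} {b = true} f rep)
    where
    p : QPair S n
    p = proj₁ (decodeQ {S} {n} s g true)
    rep : RepQ p s true
    rep = proj₂ (decodeQ {S} {n} s g true)

  connectedU : ∀ (s : Str N) → GoodU S n s → Connected s
  connectedU s (_ , one , _) x y = Star.map inj₁ (one x y)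

  connectedQ : ∀ (s : Str N) → GoodQ S n s → Connected s
  connectedQ s good x y = subst₂ (Star (Step₃ s)) (cong proj₁ (θ⁻¹-θ (x , true))) (cong proj₁ (θ⁻¹-θ (y , true)))
      (path (Closure⇒Star (M.connected (θ (x , true)) (θ (y , true)))))
    where
    M : Map
    M = RootedMap.map (QPair.q (proj₁ (decodeQ {S} {n} s good true)))
    module M = Map M
    open RepMLaws {M} {s = s} (proj₁ (proj₂ (decodeQ {S} {n} s good true)))
    side-T₁ : ∀ a → Step₃ s (proj₁ a) (proj₁ (T₁ a))
    side-T₁ (x , true) with up? x
    ... | yes _ = inj₁ (inj₁ refl)
    ... | no _  = inj₂ refl
    side-T₁ (x , false) with up? x | Str.ℓ s (Str.τ₀ s x) ℕ.≟ Str.ℓ s x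
    ... | yes _ | _     = inj₂ refl
    ... | no _  | yes _ = inj₁ (inj₁ refl)
    ... | no _  | no _  = inj₁ (inj₁ refl)
    side : Fin M.size → Fin N
    side y = proj₁ (θ⁻¹ y)
    path : ∀ {y z} → Star M.AnyStep y z → Star (Step₃ s) (side y) (side z)
    path ε = ε
    path {y} {z} (inj₁ (inj₁ refl) ◅ c) = subst (λ x → Star (Step₃ s) x (side z)) (cong proj₁ (τ₀-θ⁻¹ y)) (path c)
    path {y} {z} (inj₁ (inj₂ refl) ◅ c) = subst (Step₃ s (side y)) (cong proj₁ (sym (τ₁-θ⁻¹ y))) (side-T₁ (θ⁻¹ y)) ◅ path c
    path {y} {z} (inj₂ refl ◅ c) = inj₁ (inj₂ (cong proj₁ (τ₂-θ⁻¹ y))) ◅ path c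

  F-good : ∀ {s : Str N} → GoodU S n s → GoodQ S n (F s)
  F-good {s} g = F-pre s (proj₁ g) , subst (GoodU S n) (sym (GF≡ s (proj₁ g))) g

  open Orbits (iso-equiv {N}) act act-iso iso-act

  module CB = ClassBijection inv≟ {GoodU S n} {GoodQ S n} inv (inv ∘ G) goodU-resp goodQ-resp
    (λ s g σ σ′ → act-free s (connectedU s g) σ σ′) (λ s g σ σ′ → act-free s (connectedQ s g) σ σ′)
    (λ g f → inv-iso f (proj₁ g)) (λ g f → invQ-iso f (proj₁ g))
    F G F-good (λ {s} g → GF≡ s (proj₁ g)) (λ {s} g → cong inv (GF≡ s (proj₁ g)))
    proj₂ (λ {s} g → FG≡ s (proj₁ g)) (λ _ → refl)
    (goodU? S n) (goodQ? S n) iso? structures ∈-structures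

  private
    instance
      nz : ℕ.NonZero (#perms {N})
      nz = #perms-nonZero

  goodOf : (p : QPair S n) → GoodQ S n (proj₁ (encodeQ p))
  goodOf p = rep⇒goodQ p (proj₂ (proj₂ (encodeQ p)))

  opaque
    class : (s : Str N) → GoodQ S n s → Str N
    class = CB.φ

    class-good : ∀ s g → GoodU S n (class s g)
    class-good = CB.φ-good

    class-inv : ∀ s g → inv (class s g) ≡ inv (G s)
    class-inv = CB.φ-inv

    class-cong : ∀ s s′ g g′ → Iso s s′ → class s g ≡ class s′ g′
    class-cong = CB.φ-cong

    class-injective : ∀ s s′ g g′ → Iso (class s g) (class s′ g′) → Iso s s′
    class-injective = CB.φ-injective

    class-surjective : ∀ s → GoodU S n s → ∃ λ t → Σ (GoodQ S n t) λ g → Iso (class t g) s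
    class-surjective = CB.φ-surjective

  -- The Boolean that `encodeQ` finds, the end of the root side at which the root sits, is dropped
  -- here; this makes the correspondence 2-to-1.
  Φ : QPair S n → LUMap S n
  Φ p = proj₁ (decodeL {S} {n} (class (proj₁ (encodeQ p)) (goodOf p)) (class-good (proj₁ (encodeQ p)) (goodOf p)))

  Φ-rep : ∀ p → RepL (Φ p) (class (proj₁ (encodeQ p)) (goodOf p))
  Φ-rep p = proj₂ (decodeL {S} {n} (class (proj₁ (encodeQ p)) (goodOf p)) (class-good (proj₁ (encodeQ p)) (goodOf p)))

  Φ-resp : ∀ p p′ → p ≅Q p′ → Φ p ≅L Φ p′
  Φ-resp p p′ e = iso⇒≅L (Φ-rep p) (Φ-rep p′) (subst (Iso _) (class-cong _ _ (goodOf p) (goodOf p′)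
    (proj₁ (≅Q⇒iso {p = p} {p′} (proj₂ (proj₂ (encodeQ p))) (proj₂ (proj₂ (encodeQ p′))) e))) iso-refl)

  -- By injectivity of `class`, all preimages encode to structures isomorphic to a single t. What
  -- remains free is the end of the root side, and both ends occur.
  two-preimages : (L : LUMap S n) → Σ (QPair S n) λ p₁ → Σ (QPair S n) λ p₂ →
     Φ p₁ ≅L L × Φ p₂ ≅L L × ¬ (p₁ ≅Q p₂) × (∀ p → Φ p ≅L L → p ≅Q p₁ ⊎ p ≅Q p₂)
  two-preimages L = lift true , lift false , Φ≅ true , Φ≅ false ,
      (λ e → contradiction (proj₂ (≅Q⇒iso {p = lift true} {lift false} (lift-rep true) (lift-rep false) e)) λ ()) ,
      λ p e → choose p (proj₁ (proj₂ (encodeQ p))) (proj₂ (proj₂ (encodeQ p))) (same-class p e)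
    where
    s : Str N
    s = proj₁ (encodeL L)
    rep : RepL L s
    rep = proj₂ (encodeL L)
    hit = class-surjective s (RepLLaws.good rep)
    t : Str N
    t = proj₁ hit
    t-good : GoodQ S n t
    t-good = proj₁ (proj₂ hit)
    t~s : Iso (class t t-good) s
    t~s = proj₂ (proj₂ hit)
    lift : Bool → QPair S n
    lift b = proj₁ (decodeQ {S} {n} t t-good b)
    lift-rep : ∀ b → RepQ (lift b) t b
    lift-rep b = proj₂ (decodeQ {S} {n} t t-good b)
    Φ≅ : ∀ b → Φ (lift b) ≅L L
    Φ≅ b = iso⇒≅L (Φ-rep (lift b)) rep (subst (λ u → Iso u s) (sym (class-cong _ _ (goodOf (lift b)) t-good
      (proj₁ (≅Q⇒iso {p = lift b} {lift b} (proj₂ (proj₂ (encodeQ (lift b)))) (lift-rep b)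
        (iso⇒≅Q {p = lift b} {lift b} (lift-rep b) (lift-rep b) iso-refl refl))))) t~s)
    same-class : ∀ p → Φ p ≅L L → Iso (proj₁ (encodeQ p)) t
    same-class p e = class-injective _ _ (goodOf p) t-good
      (iso-trans (≅L⇒iso (Φ-rep p) rep e) (iso-sym t~s))
    choose : ∀ p b → RepQ p (proj₁ (encodeQ p)) b → Iso (proj₁ (encodeQ p)) t → p ≅Q lift true ⊎ p ≅Q lift false
    choose p true  r f = inj₁ (iso⇒≅Q {p = p} {lift true} r (lift-rep true) f refl)
    choose p false r f = inj₂ (iso⇒≅Q {p = p} {lift false} r (lift-rep false) f refl)

  layers : LayerProperty Φ
  layers p j ℓmin min =
      (proj₁ (at-level ι (suc j)) , layer-vertices j (proj₁ (proj₂ (invQ-spec s pre) (suc j))) ,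
       subst₂ (λ c ι → HasClassCount (RootedMap.SameV (LUMap.m (Φ p))) (λ y → LUMap.label (Φ p) y ≡ c) (proj₁ (at-level ι (suc j))))
         level≡ inv≡ (vertices-at (suc j))) ,
      (proj₂ (at-level ι (suc j)) , layer-edges j (proj₂ (proj₂ (invQ-spec s pre) (suc j))) ,
       subst₂ (λ c ι → HasClassCount (RootedMap.SameC (LUMap.m (Φ p))) (λ y → LUMap.label (Φ p) y ≡ c) (proj₂ (at-level ι (suc j))))
         level≡ inv≡ (corners-at (suc j)))
    where
    s : Str N
    s = proj₁ (encodeQ p)
    open RepMLaws (proj₁ (proj₂ (proj₂ (encodeQ p)))) using (pre; layer-vertices; layer-edges)
    open RepLLaws (Φ-rep p) using (shift; vertices-at; corners-at; min-shift)
    ι : Inv N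
    ι = inv (G s)
    inv≡ : inv (class s (goodOf p)) ≡ ι
    inv≡ = class-inv s (goodOf p)
    -- Level 1 carries the minimal label `1 + shift`, so level `suc j` carries the label j above it.
    level≡ : + suc j ℤ.+ shift ≡ ℓmin ℤ.+ + j
    level≡ = trans (ring (+ j) shift) (cong (ℤ._+ + j) (sym (min-shift min)))
      where
      ring : ∀ j c → (+ 1 ℤ.+ j) ℤ.+ c ≡ (+ 1 ℤ.+ c) ℤ.+ j
      ring = solve-∀

theorem3p2 : (S : Surface) (n : ℕ) → 1 ≤ n →
    Σ (QPair S n → LUMap S n) λ Φ → TwoToOne Φ × LayerProperty Φ
theorem3p2 S n _ = Φ , (Φ-resp , two-preimages) , layers
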